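{- Let $\mathrm{M}$ be a loopless matroid of rank $r+1$ on $E$, let $\mathscr{P}_-$ be an order filter of nonempty proper flats, let $Z$ be a flat maximal among nonempty proper flats not in $\mathscr{P}_-$, and put $\mathscr{P}_+=\mathscr{P}_-\cup\{Z\}$. For every positive integer $q$, the homomorphism $$\Phi_Z^q\oplus\bigoplus_{p=1}^{\mathrm{rk}(Z)-1}\Psi_Z^{p,q}: A^q(\mathrm{M},\mathscr{P}_-)\oplus\bigoplus_{p=1}^{\mathrm{rk}(Z)-1}A^{q-p}(\mathrm{M}_Z)\longrightarrow A^q(\mathrm{M},\mathscr{P}_+)$$ is an isomorphism.
   Context: An order filter is a set $\mathscr{P}$ of nonempty proper flats with $F_1\subseteq F_2$, $F_1\in\mathscr{P}\Rightarrow F_2\in\mathscr{P}$. For an order filter $\mathscr{P}$, $A^*(\mathrm{M},\mathscr{P})$ is the graded ring $\mathbb{Z}[x_i,x_F: i\in E, F\in\mathscr{P}]$ modulo the ideal generated by: $x_{F_1}x_{F_2}$ for incomparable $F_1,F_2\in\mathscr P$; $x_ix_F$ for $F\in\mathscr{P}$, $i\in E\setminus F$; $\prod_{i\in I}x_i$ for independent sets $I$ whose closure lies in $\mathscr{P}\cup\{E\}$; and $(x_i+\sum_{F\in\mathscr{P},i\in F}x_F)-(x_j+\sum_{F\in\mathscr{P},j\in F}x_F)$ for distinct $i,j\in E$. For a loopless matroid $\mathrm{N}$, $A^*(\mathrm{N})$ denotes $\mathbb{Z}[x_F: F$ nonempty proper flat of $\mathrm{N}]$ modulo $x_{F_1}x_{F_2}$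 for incomparable $F_1,F_2$ and $\sum_{F\ni i_1}x_F-\sum_{F\ni i_2}x_F$ for distinct elements $i_1,i_2$. $\mathrm{M}_Z$ is the contraction of $\mathrm{M}$ by $Z$, a loopless matroid on $E\setminus Z$ of rank $\mathrm{crk}_\mathrm{M}(Z)$, whose nonempty proper flats are identified with the flats $F$ of $\mathrm{M}$ with $Z\subsetneq F\subsetneq E$. $\Phi_Z:A^*(\mathrm{M},\mathscr{P}_-)\to A^*(\mathrm{M},\mathscr{P}_+)$ is the (well-defined) graded ring homomorphism with $x_F\mapsto x_F$, $x_i\mapsto x_i+x_Z$ if $i\in Z$ and $x_i\mapsto x_i$ if $i\notin Z$; $\Phi^q_Z$ is its degree $q$ part. For positive integers $p,q$, $\Psi_Z^{p,q}:A^{q-p}(\mathrm{M}_Z)\to A^q(\mathrm{M},\mathscr{P}_+)$ is the (well-defined) group homomorphism sending $x_{F_1}\cdots x_{F_{q-p}}\mapsto x_Z^p x_{F_1}\cdots x_{F_{q-p}}$ for chains $F_1\subsetneq\cdots$ of nonempty proper flats of $\mathrm{M}_Z$ (such monomials generate $A^{q-p}(\mathrm{M}_Z)$). -}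

module Defs where

open import Data.Nat using (ℕ; zero; suc; _+_; _∸_; _≤_; _<ᵇ_; _≡ᵇ_)
open import Data.Bool using (Bool; true; false; T; _∧_; _∨_; not; if_then_else_)
open import Data.Unit using (tt)
open import Data.Fin using (Fin)
open import Data.Fin.Subset using (Subset; ⊤; ⁅_⁆; _∪_; _∩_; _⊆_; _∉_; ∣_∣)
open import Data.List using (List; []; _∷_; map; concatMap; allFin; length; mapMaybe)
open import Data.Bool.ListAction using (all; any)
open import Data.List.Relation.Unary.Unique.Propositional using (Unique)
open import Data.List.Relation.Binary.Permutation.Propositional using (_↭_)
open import Data.Vec using (Vec; lookup; tabulate; toList; fromList; replicate; _++_)
  renaming ([] to []ᵛ; _∷_ to _∷ᵛ_)
open import Data.Maybe using (Maybe; just; nothing)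
open import Data.Product using (Σ; _,_; _×_)
open import Data.Sum using (_⊎_; inj₁; inj₂)
open import Relation.Nullary using (¬_; yes; no)
open import Relation.Nullary.Decidable using (T?)
open import Relation.Binary.PropositionalEquality using (_≡_; _≢_; subst)

infixl 6 _⊕_
data Expr (X : Set) : Set where
  gen : X → Expr X
  𝟘   : Expr X
  _⊕_ : Expr X → Expr X → Expr X
  ⊝_  : Expr X → Expr X

bind : {X Y : Set} → (X → Expr Y) → Expr X → Expr Y
bind f (gen x) = f x
bind f 𝟘 = 𝟘
bind f (a ⊕ b) = bind f a ⊕ bind f b
bind f (⊝ a) = ⊝ bind f a

sumE : {X : Set} → List (Expr X) → Expr X
sumE [] = 𝟘
sumE (e ∷ es) = e ⊕ sumE es

data Eq {X : Set} (R : Expr X → Set) : Expr X → Expr X → Set where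
  ≈refl  : ∀ {a} → Eq R a a
  ≈sym   : ∀ {a b} → Eq R a b → Eq R b a
  ≈trans : ∀ {a b c} → Eq R a b → Eq R b c → Eq R a c
  ≈cong⊕ : ∀ {a a' b b'} → Eq R a a' → Eq R b b' → Eq R (a ⊕ b) (a' ⊕ b')
  ≈cong⊝ : ∀ {a a'} → Eq R a a' → Eq R (⊝ a) (⊝ a')
  ≈assoc : ∀ {a b c} → Eq R ((a ⊕ b) ⊕ c) (a ⊕ (b ⊕ c))
  ≈comm  : ∀ {a b} → Eq R (a ⊕ b) (b ⊕ a)
  ≈idl   : ∀ {a} → Eq R (𝟘 ⊕ a) a
  ≈invl  : ∀ {a} → Eq R ((⊝ a) ⊕ a) 𝟘
  ≈rel   : ∀ {a} → R a → Eq R a 𝟘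

IsIso : {X Y : Set} (R₁ : Expr X → Set) (R₂ : Expr Y → Set) → (X → Expr Y) → Set
IsIso R₁ R₂ f =
  (∀ a b → Eq R₁ a b → Eq R₂ (bind f a) (bind f b)) ×
  (∀ a b → Eq R₂ (bind f a) (bind f b) → Eq R₁ a b) ×
  (∀ y → Σ _ λ a → Eq R₂ (bind f a) y)

-- Degree-q part of a graded ring Z[V]/I, I generated by homogeneous elements.
-- Monomials of degree q are Vec V q (up to reordering); G d g says that the
-- formal sum g of degree-d monomials is one of the ideal generators.

mulE : {V : Set} {k d : ℕ} → Vec V k → Expr (Vec V d) → Expr (Vec V (k + d))
mulE u = bind (λ t → gen (u ++ t))

data RingRel (V : Set) (G : (d : ℕ) → Expr (Vec V d) → Set) :
       (q : ℕ) → Expr (Vec V q) → Set where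
  perm  : ∀ {q} (m m' : Vec V q) → toList m ↭ toList m' →
          RingRel V G q (gen m ⊕ ⊝ gen m')
  ideal : ∀ {k d g} (u : Vec V k) → G d g → RingRel V G (k + d) (mulE u g)

record Matroid (n : ℕ) : Set where
  field
    rk        : Subset n → ℕ
    rk-bound  : ∀ X → rk X ≤ ∣ X ∣
    rk-mono   : ∀ X Y → X ⊆ Y → rk X ≤ rk Y
    rk-submod : ∀ X Y → rk (X ∪ Y) + rk (X ∩ Y) ≤ rk X + rk Y
open Matroid public

Loopless : ∀ {n} → Matroid n → Set
Loopless {n} M = ∀ (i : Fin n) → rk M ⁅ i ⁆ ≡ 1

module _ {n : ℕ} where
  _⊆ᵇ_ : Subset n → Subset n → Bool
  A ⊆ᵇ B = all (λ i → not (lookup A i) ∨ lookup B i) (allFin n)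

  _≟ᵇ_ : Subset n → Subset n → Bool
  A ≟ᵇ B = (A ⊆ᵇ B) ∧ (B ⊆ᵇ A)

  nonemptyᵇ : Subset n → Bool
  nonemptyᵇ A = any (λ i → lookup A i) (allFin n)

  properᵇ : Subset n → Bool
  properᵇ A = any (λ i → not (lookup A i)) (allFin n)

  incomparableᵇ : Subset n → Subset n → Bool
  incomparableᵇ A B = not (A ⊆ᵇ B) ∧ not (B ⊆ᵇ A)

  allSubsets : ∀ m → List (Subset m)
  allSubsets zero = []ᵛ ∷ []
  allSubsets (suc m) = concatMap (λ s → (true ∷ᵛ s) ∷ (false ∷ᵛ s) ∷ []) (allSubsets m)

  collect : (Q : Subset n → Bool) → (Subset n → Bool) → List (Σ (Subset n) λ F → T (Q F))
  collect Q b = mapMaybe pick (allSubsets n)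
    where
    pick : Subset n → Maybe (Σ (Subset n) λ F → T (Q F))
    pick F with T? (Q F) | b F
    ... | yes p | true = just (F , p)
    ... | _     | _    = nothing

  toSet : List (Fin n) → Subset n
  toSet [] = tabulate (λ _ → false)
  toSet (i ∷ is) = ⁅ i ⁆ ∪ toSet is

  module _ (M : Matroid n) where
    flatᵇ : Subset n → Bool
    flatᵇ X = all (λ i → lookup X i ∨ (rk M X <ᵇ rk M (X ∪ ⁅ i ⁆))) (allFin n)

    npFlatᵇ : Subset n → Bool
    npFlatᵇ F = flatᵇ F ∧ nonemptyᵇ F ∧ properᵇ F

    cl : Subset n → Subset n
    cl X = tabulate (λ e → lookup X e ∨ (rk M (X ∪ ⁅ e ⁆) ≡ᵇ rk M X))

    IsOrderFilter : (Subset n → Bool) → Set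
    IsOrderFilter P =
      (∀ F → T (P F) → T (npFlatᵇ F)) ×
      (∀ F₁ F₂ → T (P F₁) → T (npFlatᵇ F₂) → F₁ ⊆ F₂ → T (P F₂))

    MaximalOutside : (Subset n → Bool) → Subset n → Set
    MaximalOutside P Z =
      T (npFlatᵇ Z) × ¬ T (P Z) ×
      (∀ F → T (npFlatᵇ F) → ¬ T (P F) → Z ⊆ F → F ≡ Z)

    Var : (Subset n → Bool) → Set
    Var P = Fin n ⊎ Σ (Subset n) (λ F → T (P F))

    linForm : (P : Subset n → Bool) → Fin n → Expr (Vec (Var P) 1)
    linForm P i = gen (inj₁ i ∷ᵛ []ᵛ) ⊕
      sumE (map (λ v → gen (inj₂ v ∷ᵛ []ᵛ)) (collect P (λ F → lookup F i)))

    data GenP (P : Subset n → Bool) : (d : ℕ) → Expr (Vec (Var P) d) → Set where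
      incomp  : ∀ F₁ F₂ (p₁ : T (P F₁)) (p₂ : T (P F₂)) → T (incomparableᵇ F₁ F₂) →
                GenP P 2 (gen (inj₂ (F₁ , p₁) ∷ᵛ inj₂ (F₂ , p₂) ∷ᵛ []ᵛ))
      outside : ∀ (i : Fin n) F (p : T (P F)) → i ∉ F →
                GenP P 2 (gen (inj₁ i ∷ᵛ inj₂ (F , p) ∷ᵛ []ᵛ))
      indep   : ∀ (I : List (Fin n)) → Unique I → rk M (toSet I) ≡ length I →
                (T (P (cl (toSet I))) ⊎ cl (toSet I) ≡ ⊤) →
                GenP P (length I) (gen (Data.Vec.map inj₁ (fromList I)))
      linear  : ∀ (i j : Fin n) → i ≢ j →
                GenP P 1 (linForm P i ⊕ ⊝ linForm P j)

    A : (P : Subset n → Bool) (q : ℕ) → Expr (Vec (Var P) q) → Set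
    A P q = RingRel (Var P) (GenP P) q

    -- A^*(M_Z): nonempty proper flats of M_Z are the flats F of M with Z ⊊ F ⊊ E
    module _ (Z : Subset n) where
      zFlatᵇ : Subset n → Bool
      zFlatᵇ F = flatᵇ F ∧ (Z ⊆ᵇ F) ∧ not (F ⊆ᵇ Z) ∧ properᵇ F

      VarZ : Set
      VarZ = Σ (Subset n) (λ F → T (zFlatᵇ F))

      linFormZ : Fin n → Expr (Vec VarZ 1)
      linFormZ i = sumE (map (λ v → gen (v ∷ᵛ []ᵛ)) (collect zFlatᵇ (λ F → lookup F i)))

      data GenZ : (d : ℕ) → Expr (Vec VarZ d) → Set where
        incomp : ∀ (v₁ v₂ : VarZ) → T (incomparableᵇ (Data.Product.proj₁ v₁) (Data.Product.proj₁ v₂)) →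
                 GenZ 2 (gen (v₁ ∷ᵛ v₂ ∷ᵛ []ᵛ))
        linear : ∀ (i j : Fin n) → i ∉ Z → j ∉ Z → i ≢ j →
                 GenZ 1 (linFormZ i ⊕ ⊝ linFormZ j)

      AZ : (q : ℕ) → Expr (Vec VarZ q) → Set
      AZ q = RingRel VarZ GenZ q

      module _ (P : Subset n → Bool) where
        P₊ : Subset n → Bool
        P₊ F = P F ∨ (F ≟ᵇ Z)

        private
          ∨-inl : ∀ a b → T a → T (a ∨ b)
          ∨-inl true b t = tt
          ∨-inr : ∀ a b → T b → T (a ∨ b)
          ∨-inr true b t = tt
          ∨-inr false b t = t
          ∧-intro : ∀ a b → T a → T b → T (a ∧ b)
          ∧-intro true b _ t = t
          all-true : ∀ {B : Set} (f : B → Bool) → (∀ x → T (f x)) → ∀ xs → T (all f xs)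
          all-true f h [] = tt
          all-true f h (x ∷ xs) = ∧-intro (f x) _ (h x) (all-true f h xs)
          ⊆ᵇ-refl : ∀ A → T (A ⊆ᵇ A)
          ⊆ᵇ-refl A = all-true _ (λ i → lem (lookup A i)) (allFin n)
            where
            lem : ∀ b → T (not b ∨ b)
            lem true = tt
            lem false = tt

        xZ : Var P₊
        xZ = inj₂ (Z , ∨-inr (P Z) _ (∧-intro _ _ (⊆ᵇ-refl Z) (⊆ᵇ-refl Z)))

        choices : ∀ {B : Set} {q} → Vec (List B) q → List (Vec B q)
        choices []ᵛ = []ᵛ ∷ []
        choices (xs ∷ᵛ v) = concatMap (λ x → map (x ∷ᵛ_) (choices v)) xs

        ΦVar : Var P → List (Var P₊)
        ΦVar (inj₁ i) = if lookup Z i then inj₁ i ∷ xZ ∷ [] else inj₁ i ∷ []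
        ΦVar (inj₂ (F , p)) = inj₂ (F , ∨-inl (P F) _ p) ∷ []

        Φ : ∀ {q} → Vec (Var P) q → Expr (Vec (Var P₊) q)
        Φ m = sumE (map gen (choices (Data.Vec.map ΦVar m)))

        -- flats of M_Z as variables of A(M,P₊) (always succeeds under the
        -- hypotheses of the theorem; the fallback nothing is unreachable there)
        ιZ : VarZ → Maybe (Var P₊)
        ιZ (F , _) with T? (P₊ F)
        ... | yes p = just (inj₂ (F , p))
        ... | no _  = nothing

        ιZs : ∀ {k} → Vec VarZ k → Maybe (Vec (Var P₊) k)
        ιZs []ᵛ = just []ᵛ
        ιZs (v ∷ᵛ vs) with ιZ v | ιZs vs
        ... | just w | just ws = just (w ∷ᵛ ws)
        ... | _      | _       = nothing

        Ψ : ∀ p {k} → Vec VarZ k → Expr (Vec (Var P₊) (p + k))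
        Ψ p m with ιZs m
        ... | just m' = gen (replicate p xZ ++ m')
        ... | nothing = 𝟘

        -- generators of A^q(M,P₋) ⊕ ⨁_{p=1}^{rk Z - 1} A^{q-p}(M_Z)
        -- (summands with p > q are zero and are omitted; k = q - p)
        SumGen : ℕ → Set
        SumGen q = Vec (Var P) q ⊎
          Σ ℕ λ p → Σ ℕ λ k → (1 ≤ p) × (p ≤ rk M Z ∸ 1) × (p + k ≡ q) × Vec VarZ k

        data SumRel (q : ℕ) : Expr (SumGen q) → Set where
          left  : ∀ {e} → A P q e → SumRel q (bind (λ m → gen (inj₁ m)) e)
          right : ∀ p k (h₁ : 1 ≤ p) (h₂ : p ≤ rk M Z ∸ 1) (h₃ : p + k ≡ q) {e} →
                  AZ k e → SumRel q (bind (λ m → gen (inj₂ (p , k , h₁ , h₂ , h₃ , m))) e)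

        ΦΨ : ∀ q → SumGen q → Expr (Vec (Var P₊) q)
        ΦΨ q (inj₁ m) = Φ m
        ΦΨ q (inj₂ (p , k , _ , _ , h₃ , m)) = subst (λ j → Expr (Vec (Var P₊) j)) h₃ (Ψ p m)

{-# OPTIONS --safe #-}

-- Write t for x_Z, k for rk Z, and x_i, x_F for the other variables, and let ρ : A(M,P₋) → A(M_Z) be restriction.
-- Any element w supported over Z satisfies w·a = w·ψ(ρ(a)), where ψ lifts x_F to x_F. With w = t this shows
-- t·Φ(a) = t·ψ(ρ(a)). For a basis I of Z, ∏_{i ∈ I} (t − Φ(x_i)) = ± ∏_{i ∈ I} x_i = 0, so A(M,P₊) is spanned
-- over Φ(A(M,P₋)) by 1, …, t^{k−1}; this gives surjectivity.
-- For injectivity, send x_i to (x_i, ρ(x_i)) − [i ∈ Z](0, X), x_F to (x_F, ρ(x_F)) and t to (0, X) in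
-- A(M,P₋) × A(M_Z)[X]. All relations of A(M,P₊) go to zero except ∏_{i ∈ I} x_i for the bases I of Z, which goes to
-- (c, (b − X)^k) with b = ρ(x_i), i ∈ Z, and c the common value of ∏_{i ∈ I} x_i in A(M,P₋). Hence the ideal lands in
-- the pairs (c·ψ(h(0)), (b − X)^k·h). An element of the source of Φ ⊕ ⨁ Ψ goes to a polynomial of degree < k whose
-- coefficients are its components in A(M_Z), so if it is in the kernel then h = 0 and all its components vanish.

module Submission where

open import Defs
open import Level using (0ℓ)
open import Algebra.Bundles using (AbelianGroup; CommutativeRing)
import Algebra.Construct.DirectProduct as DirectProduct
import Algebra.Properties.Group
import Algebra.Properties.Ring
import Algebra.Properties.Semiring.Exp
open import Data.Bool using (Bool; true; false; T; not; _∨_; if_then_else_)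
open import Data.Bool.Properties using (T-irrelevant; T-∨; T-∧; T-≡)
open import Data.Empty using (⊥; ⊥-elim)
open import Data.Unit using (tt)
open import Data.Fin using (Fin)
open import Data.Fin.Subset using (Subset; ⊤; ⁅_⁆; _∪_; _∩_; _⊆_; _∈_; _∉_; ∣_∣)
import Data.Fin.Properties as Finₚ
import Data.Fin.Subset.Properties as Subₚ
open import Data.List using (List; []; _∷_; _++_; map; length; mapMaybe; concatMap; allFin; filter)
import Data.List.Properties as Listₚ
open import Data.List.Membership.Propositional using (lose) renaming (_∈_ to _∈ˡ_; _∉_ to _∉ˡ_)
open import Data.List.Membership.Propositional.Properties using (∈-allFin; ∈-∃++; ∈-filter⁺; ∈-filter⁻)
open import Data.List.Relation.Binary.Permutation.Propositional as Perm using (_↭_)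
import Data.List.Relation.Binary.Permutation.Propositional.Properties as Permₚ
open import Data.List.Relation.Unary.All as All using ()
import Data.List.Relation.Unary.All.Properties as Allₚ
open import Data.List.Relation.Unary.AllPairs using ([]; _∷_)
open import Data.List.Relation.Unary.Any as Any using (here; there)
import Data.List.Relation.Unary.Any.Properties as Anyₚ
open import Data.List.Relation.Unary.Unique.Propositional using (Unique)
open import Data.Maybe using (Maybe; just; nothing; maybe′)
open import Data.Nat using (ℕ; zero; suc; _≤_; _<_; _<ᵇ_; _∸_; z≤n; s≤s) renaming (_+_ to _+ℕ_)
import Data.Nat.Properties as ℕₚ
open import Data.Product using (Σ; ∃; _×_; _,_; proj₁; proj₂)
open import Data.Sum as Sum using (_⊎_; inj₁; inj₂)
open import Data.Vec as Vec using (Vec; toList; fromList; lookup; replicate)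
  renaming ([] to []ᵛ; _∷_ to _∷ᵛ_; _++_ to _++ᵛ_)
import Data.Vec.Properties as Vecₚ
open import Function using (_∘_; id)
open import Function.Bundles using (Equivalence)
open import Relation.Nullary using (¬_; Dec; yes; no; contradiction)
open import Relation.Nullary.Decidable using (T?; _×-dec_; ¬?; decidable-stable)
open import Relation.Binary.PropositionalEquality as ≡ using (_≡_; _≢_; refl; sym; cong; cong₂; subst)

-- The theorem concerns single graded pieces, with monomials as vectors of fixed length, while the
-- argument is about ring homomorphisms. The work is done in ungraded rings on list monomials; as
-- all generators are homogeneous, each graded piece embeds there. A homomorphism out of a presented
-- ring is an assignment of values to the variables that satisfies the relations, a model.
-- Surjectivity and well-definedness take the variables of A(M,P₊) themselves as values, injectivity
-- takes values in the product ring. The obstacle is that ψ need not respect the linear relations of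
-- A(M_Z). It does so after multiplication by an element supported over Z, and both x_Z and c are
-- such elements. This explains the shape of the ideal in the product: when (c , (b - X)^k) is
-- multiplied by the image of a monomial, the first component u of that image has ρ(u) equal to the
-- constant term of the second, so c·u = c·ψ(ρ(u)) is determined by the second component. The bound
-- p ≤ rk(Z) - 1 keeps the degree in X below that of (b - X)^k, whose leading coefficient is ± 1.

module Linear (A : AbelianGroup 0ℓ 0ℓ) where
  open AbelianGroup A renaming
    (Carrier to |A|; _∙_ to _+_; ε to 0#; _⁻¹ to -_; refl to ≈-refl; sym to ≈-sym; trans to ≈-trans)
  open import Algebra.Properties.AbelianGroup A using (⁻¹-∙-comm; ε⁻¹≈ε)
  open import Algebra.Properties.CommutativeSemigroup commutativeSemigroup using (interchange)
  open import Relation.Binary.Reasoning.Setoid setoid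

  lin : {X : Set} → (X → |A|) → Expr X → |A|
  lin f (gen x) = f x
  lin f 𝟘 = 0#
  lin f (a ⊕ b) = lin f a + lin f b
  lin f (⊝ a) = - lin f a

  module _ {X : Set} where
    lin-cong : {f g : X → |A|} → (∀ x → f x ≈ g x) → ∀ e → lin f e ≈ lin g e
    lin-cong h (gen x) = h x
    lin-cong h 𝟘 = ≈-refl
    lin-cong h (a ⊕ b) = ∙-cong (lin-cong h a) (lin-cong h b)
    lin-cong h (⊝ a) = ⁻¹-cong (lin-cong h a)

    lin-bind : {Y : Set} (f : X → |A|) (h : Y → Expr X) (e : Expr Y) →
               lin f (bind h e) ≡ lin (λ y → lin f (h y)) e
    lin-bind f h (gen x) = refl
    lin-bind f h 𝟘 = refl
    lin-bind f h (a ⊕ b) = cong₂ _+_ (lin-bind f h a) (lin-bind f h b)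
    lin-bind f h (⊝ a) = cong -_ (lin-bind f h a)

    lin-0 : ∀ (e : Expr X) → lin (λ _ → 0#) e ≈ 0#
    lin-0 (gen x) = ≈-refl
    lin-0 𝟘 = ≈-refl
    lin-0 (a ⊕ b) = ≈-trans (∙-cong (lin-0 a) (lin-0 b)) (identityˡ 0#)
    lin-0 (⊝ a) = ≈-trans (⁻¹-cong (lin-0 a)) ε⁻¹≈ε

    lin-zero : {f : X → |A|} → (∀ x → f x ≈ 0#) → ∀ e → lin f e ≈ 0#
    lin-zero h e = ≈-trans (lin-cong h e) (lin-0 e)

    lin-+ : (f g : X → |A|) → ∀ e → lin (λ x → f x + g x) e ≈ lin f e + lin g e
    lin-+ f g (gen x) = ≈-refl
    lin-+ f g 𝟘 = ≈-sym (identityˡ 0#)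
    lin-+ f g (a ⊕ b) = ≈-trans (∙-cong (lin-+ f g a) (lin-+ f g b)) (interchange _ _ _ _)
    lin-+ f g (⊝ a) = ≈-trans (⁻¹-cong (lin-+ f g a)) (≈-sym (⁻¹-∙-comm _ _))

    lin-neg : (f : X → |A|) → ∀ e → lin (λ x → - f x) e ≈ - lin f e
    lin-neg f (gen x) = ≈-refl
    lin-neg f 𝟘 = ≈-sym ε⁻¹≈ε
    lin-neg f (a ⊕ b) = ≈-trans (∙-cong (lin-neg f a) (lin-neg f b)) (⁻¹-∙-comm _ _)
    lin-neg f (⊝ a) = ⁻¹-cong (lin-neg f a)

  module _ {X : Set} where
    -- Fubini for a bilinear pairing; the product of `Presented` gets its commutativity from it.
    lin-swap : {Y : Set} (f : X → Y → |A|) → ∀ a b →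
               lin (λ x → lin (f x) b) a ≈ lin (λ y → lin (λ x → f x y) a) b
    lin-swap f (gen x) b = ≈-refl
    lin-swap f 𝟘 b = ≈-sym (lin-0 b)
    lin-swap f (a ⊕ a′) b = ≈-trans (∙-cong (lin-swap f a b) (lin-swap f a′ b)) (≈-sym (lin-+ _ _ b))
    lin-swap f (⊝ a) b = ≈-trans (⁻¹-cong (lin-swap f a b)) (≈-sym (lin-neg _ b))

    -- A derivation in `Eq R` is finite, so the difference of its two sides is a combination of
    -- relations and stays in any subgroup `N` that contains their images. The trivial `N` gives
    -- well-definedness; `N` = `Multiple` describes the image of an ideal.
    lin-resp-mod : (N : |A| → Set) → (∀ {x y} → x ≈ y → N x → N y) → N 0# →
                   (∀ {x y} → N x → N y → N (x + y)) → (∀ {x} → N x → N (- x)) →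
                   {R : Expr X → Set} {f : X → |A|} → (∀ {e} → R e → N (lin f e)) →
                   ∀ {a b} → Eq R a b → N (lin f a + - lin f b)
    lin-resp-mod N N-resp N-0 N-+ N-neg {R} {f} hR = go
      where
      equal : ∀ {x y} → x ≈ y → N (x + - y)
      equal {x} {y} p = N-resp (≈-sym (≈-trans (∙-cong p ≈-refl) (inverseʳ y))) N-0
      go : ∀ {a b} → Eq R a b → N (lin f a + - lin f b)
      go ≈refl = equal ≈-refl
      go (≈sym {a} {b} p) = N-resp (begin
          - (lin f a + - lin f b)     ≈⟨ ⁻¹-∙-comm _ _ ⟨
          - lin f a + - - lin f b     ≈⟨ ∙-cong ≈-refl (⁻¹-involutive _) ⟩
          - lin f a + lin f b         ≈⟨ comm _ _ ⟩
          lin f b + - lin f a         ∎) (N-neg (go p))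
        where open import Algebra.Properties.Group group using (⁻¹-involutive)
      go (≈trans {a} {b} {c} p q) = N-resp (begin
          (lin f a + - lin f b) + (lin f b + - lin f c) ≈⟨ assoc _ _ _ ⟩
          lin f a + (- lin f b + (lin f b + - lin f c)) ≈⟨ ∙-cong ≈-refl (assoc _ _ _) ⟨
          lin f a + ((- lin f b + lin f b) + - lin f c) ≈⟨ ∙-cong ≈-refl (∙-cong (inverseˡ _) ≈-refl) ⟩
          lin f a + (0# + - lin f c)                    ≈⟨ ∙-cong ≈-refl (identityˡ _) ⟩
          lin f a + - lin f c                           ∎) (N-+ (go p) (go q))
      go (≈cong⊕ p q) =
        N-resp (≈-trans (interchange _ _ _ _) (∙-cong ≈-refl (⁻¹-∙-comm _ _))) (N-+ (go p) (go q))
      go (≈cong⊝ p) = N-resp (≈-sym (⁻¹-∙-comm _ _)) (N-neg (go p))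
      go ≈assoc = equal (assoc _ _ _)
      go ≈comm = equal (comm _ _)
      go ≈idl = equal (identityˡ _)
      go ≈invl = equal (inverseˡ _)
      go (≈rel r) = N-resp (≈-sym (≈-trans (∙-cong ≈-refl ε⁻¹≈ε) (identityʳ _))) (hR r)

    lin-resp : {R : Expr X → Set} {f : X → |A|} → (∀ {e} → R e → lin f e ≈ 0#) →
               ∀ {a b} → Eq R a b → lin f a ≈ lin f b
    lin-resp hR p = x∙y⁻¹≈ε⇒x≈y _ _
      (lin-resp-mod (_≈ 0#) (λ p q → ≈-trans (≈-sym p) q) ≈-refl
        (λ p q → ≈-trans (∙-cong p q) (identityˡ 0#)) (λ p → ≈-trans (⁻¹-cong p) ε⁻¹≈ε) hR p)
      where open import Algebra.Properties.Group group using (x∙y⁻¹≈ε⇒x≈y)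

-- Presented abelian groups and rings.

exprGroup : {X : Set} → (Expr X → Set) → AbelianGroup 0ℓ 0ℓ
exprGroup {X} R = record
  { Carrier = Expr X ; _≈_ = Eq R ; _∙_ = _⊕_ ; ε = 𝟘 ; _⁻¹ = ⊝_
  ; isAbelianGroup = record
    { isGroup = record
      { isMonoid = record
        { isSemigroup = record
          { isMagma = record
            { isEquivalence = record { refl = ≈refl ; sym = ≈sym ; trans = ≈trans }
            ; ∙-cong = ≈cong⊕ }
          ; assoc = λ _ _ _ → ≈assoc }
        ; identity = (λ _ → ≈idl) , (λ _ → ≈trans ≈comm ≈idl) }
      ; inverse = (λ _ → ≈invl) , (λ _ → ≈trans ≈comm ≈invl)
      ; ⁻¹-cong = ≈cong⊝ }
    ; comm = λ _ _ → ≈comm } }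

module _ {X : Set} (R : Expr X → Set) where
  open Linear (exprGroup R)

  -- `IsIso` speaks of `bind`; reading it as an additive extension into the group of expressions
  -- makes every fact on `lin` available.
  bind≡lin : {Y : Set} (h : Y → Expr X) (e : Expr Y) → bind h e ≡ lin h e
  bind≡lin h (gen x) = refl
  bind≡lin h 𝟘 = refl
  bind≡lin h (a ⊕ b) = cong₂ _⊕_ (bind≡lin h a) (bind≡lin h b)
  bind≡lin h (⊝ a) = cong ⊝_ (bind≡lin h a)

  bind-resp : {Y : Set} {R′ : Expr Y → Set} (h : Y → Expr X) →
              (∀ {e} → R′ e → Eq R (bind h e) 𝟘) → ∀ {a b} → Eq R′ a b → Eq R (bind h a) (bind h b)
  bind-resp h hR {a} {b} p = ≡.subst₂ (Eq R) (sym (bind≡lin h a)) (sym (bind≡lin h b))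
    (lin-resp (λ {e} r → subst (λ x → Eq R x 𝟘) (bind≡lin h e) (hR r)) p)

  bind-cong : {Y : Set} {h h′ : Y → Expr X} → (∀ y → Eq R (h y) (h′ y)) → ∀ e → Eq R (bind h e) (bind h′ e)
  bind-cong {h = h} {h′} p e =
    ≡.subst₂ (Eq R) (sym (bind≡lin h e)) (sym (bind≡lin h′ e)) (lin-cong p e)

  bind-zero : {Y : Set} {h : Y → Expr X} → (∀ y → Eq R (h y) 𝟘) → ∀ e → Eq R (bind h e) 𝟘
  bind-zero {h = h} p e = subst (λ x → Eq R x 𝟘) (sym (bind≡lin h e)) (lin-zero p e)

bind-bind : {X Y Z : Set} (f : Y → Expr Z) (h : X → Expr Y) (e : Expr X) →
            bind f (bind h e) ≡ bind (λ x → bind f (h x)) e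
bind-bind f h (gen x) = refl
bind-bind f h 𝟘 = refl
bind-bind f h (a ⊕ b) = cong₂ _⊕_ (bind-bind f h a) (bind-bind f h b)
bind-bind f h (⊝ a) = cong ⊝_ (bind-bind f h a)

bind-≗ : {X Y : Set} {f h : X → Expr Y} → (∀ x → f x ≡ h x) → ∀ e → bind f e ≡ bind h e
bind-≗ p (gen x) = p x
bind-≗ p 𝟘 = refl
bind-≗ p (a ⊕ b) = cong₂ _⊕_ (bind-≗ p a) (bind-≗ p b)
bind-≗ p (⊝ a) = cong ⊝_ (bind-≗ p a)

bind-gen : {X : Set} (e : Expr X) → bind gen e ≡ e
bind-gen (gen x) = refl
bind-gen 𝟘 = refl
bind-gen (a ⊕ b) = cong₂ _⊕_ (bind-gen a) (bind-gen b)
bind-gen (⊝ a) = cong ⊝_ (bind-gen a)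

-- Z[V]/(G), with monomials as lists of variables.
module Presented {V : Set} (G : Expr (List V) → Set) where
  -- Multiplying generators by monomials is enough, because `Eq` already closes under sums and
  -- negatives.
  data Rel : Expr (List V) → Set where
    perm  : ∀ {l m} → l ↭ m → Rel (gen l ⊕ ⊝ gen m)
    ideal : ∀ u {g} → G g → Rel (bind (λ m → gen (u ++ m)) g)

  open Linear (exprGroup Rel)
  open import Algebra.Properties.Group (AbelianGroup.group (exprGroup Rel)) using (x∙y⁻¹≈ε⇒x≈y)

  perm⇒≈ : ∀ {l m} → l ↭ m → Eq Rel (gen l) (gen m)
  perm⇒≈ p = x∙y⁻¹≈ε⇒x≈y _ _ (≈rel (perm p))

  infixl 7 _⊛_
  _⊛_ : Expr (List V) → Expr (List V) → Expr (List V)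
  a ⊛ b = bind (λ l → bind (λ m → gen (l ++ m)) b) a

  private
    ⊛-lin : ∀ a b → a ⊛ b ≡ lin (λ l → lin (λ m → gen (l ++ m)) b) a
    ⊛-lin a b = ≡.trans (bind-≗ (λ l → bind≡lin Rel _ b) a) (bind≡lin Rel _ a)

    ⊛-comm : ∀ a b → Eq Rel (a ⊛ b) (b ⊛ a)
    ⊛-comm a b = ≡.subst₂ (Eq Rel) (sym (⊛-lin a b)) (sym (⊛-lin b a))
      (≈trans (lin-swap _ a b) (lin-cong (λ l → lin-cong (λ m → perm⇒≈ (Permₚ.++-comm m l)) a) b))

    ⊛-congˡ : ∀ a {b b′} → Eq Rel b b′ → Eq Rel (a ⊛ b) (a ⊛ b′)
    ⊛-congˡ a p = bind-cong Rel (λ l → bind-resp Rel _ (resp l) p) a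
      where
      resp : ∀ l {e} → Rel e → Eq Rel (bind (λ m → gen (l ++ m)) e) 𝟘
      resp l (perm q) = ≈rel (perm (Permₚ.++⁺ˡ l q))
      resp l (ideal u {g} r) = subst (λ x → Eq Rel x 𝟘)
        (sym (≡.trans (bind-bind _ _ g) (bind-≗ (λ m → cong gen (sym (Listₚ.++-assoc l u m))) g)))
        (≈rel (ideal (l ++ u) r))

    ⊛-cong : ∀ {a a′ b b′} → Eq Rel a a′ → Eq Rel b b′ → Eq Rel (a ⊛ b) (a′ ⊛ b′)
    ⊛-cong {a} {a′} {b} {b′} p q =
      ≈trans (⊛-congˡ a q) (≈trans (⊛-comm a b′) (≈trans (⊛-congˡ b′ p) (⊛-comm b′ a′)))

    ⊛-assoc : ∀ a b c → Eq Rel ((a ⊛ b) ⊛ c) (a ⊛ (b ⊛ c))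
    ⊛-assoc a b c = subst (Eq Rel ((a ⊛ b) ⊛ c))
      (≡.trans (bind-bind _ _ a) (bind-≗ (λ l → ≡.trans (bind-bind _ _ b) (≡.trans (bind-≗ (λ m →
         ≡.trans (bind-≗ (λ k → cong gen (Listₚ.++-assoc l m k)) c) (sym (bind-bind _ _ c))) b) (sym (bind-bind _ _ b)))) a)) ≈refl

    ⊛-distribʳ : ∀ a b c → Eq Rel ((b ⊕ c) ⊛ a) (b ⊛ a ⊕ c ⊛ a)
    ⊛-distribʳ a b c = ≈refl

  ring : CommutativeRing 0ℓ 0ℓ
  ring = record
    { Carrier = Expr (List V) ; _≈_ = Eq Rel ; _+_ = _⊕_ ; _*_ = _⊛_ ; -_ = ⊝_ ; 0# = 𝟘 ; 1# = gen []
    ; isCommutativeRing = record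
      { isRing = record
        { +-isAbelianGroup = AbelianGroup.isAbelianGroup (exprGroup Rel)
        ; *-cong = ⊛-cong
        ; *-assoc = ⊛-assoc
        ; *-identity = ⊛-identityˡ , λ a → ≈trans (⊛-comm a (gen [])) (⊛-identityˡ a)
        ; distrib = (λ a b c → ≈trans (⊛-comm a (b ⊕ c)) (≈cong⊕ (⊛-comm b a) (⊛-comm c a))) , ⊛-distribʳ
        }
      ; *-comm = ⊛-comm } }
    where
    ⊛-identityˡ : ∀ a → Eq Rel (gen [] ⊛ a) a
    ⊛-identityˡ a = subst (λ x → Eq Rel x a) (sym (bind-gen a)) ≈refl

-- Evaluation homomorphisms out of a presented ring.

module Evaluation (C : CommutativeRing 0ℓ 0ℓ) where
  open CommutativeRing C renaming (refl to ≈-refl; sym to ≈-sym; trans to ≈-trans)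
  open Linear +-abelianGroup public
  open import Algebra.Properties.Ring ring using (-‿distribˡ-*)
  open import Algebra.Properties.CommutativeSemigroup *-commutativeSemigroup using (x∙yz≈y∙xz)

  module _ {X : Set} where
    lin-*ʳ : (f : X → Carrier) (c : Carrier) → ∀ e → lin f e * c ≈ lin (λ x → f x * c) e
    lin-*ʳ f c (gen x) = ≈-refl
    lin-*ʳ f c 𝟘 = zeroˡ c
    lin-*ʳ f c (a ⊕ b) = ≈-trans (distribʳ c _ _) (+-cong (lin-*ʳ f c a) (lin-*ʳ f c b))
    lin-*ʳ f c (⊝ a) = ≈-trans (≈-sym (-‿distribˡ-* _ c)) (-‿cong (lin-*ʳ f c a))

    lin-*ˡ : (f : X → Carrier) (c : Carrier) → ∀ e → c * lin f e ≈ lin (λ x → c * f x) e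
    lin-*ˡ f c e = ≈-trans (*-comm c _) (≈-trans (lin-*ʳ f c e) (lin-cong (λ x → *-comm _ c) e))

  module _ {V : Set} where
    prod : (V → Carrier) → List V → Carrier
    prod f [] = 1#
    prod f (v ∷ l) = f v * prod f l

    prod-cong : ∀ {f g} → (∀ v → f v ≈ g v) → ∀ l → prod f l ≈ prod g l
    prod-cong p [] = ≈-refl
    prod-cong p (v ∷ l) = *-cong (p v) (prod-cong p l)

    prod-++ : ∀ f l m → prod f (l ++ m) ≈ prod f l * prod f m
    prod-++ f [] m = ≈-sym (*-identityˡ _)
    prod-++ f (v ∷ l) m = ≈-trans (*-cong ≈-refl (prod-++ f l m)) (≈-sym (*-assoc _ _ _))

    prod-↭ : ∀ f {l m} → l ↭ m → prod f l ≈ prod f m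
    prod-↭ f Perm.refl = ≈-refl
    prod-↭ f (Perm.prep v p) = *-cong ≈-refl (prod-↭ f p)
    prod-↭ f (Perm.swap v w p) = ≈-trans (x∙yz≈y∙xz _ _ _) (*-cong ≈-refl (*-cong ≈-refl (prod-↭ f p)))
    prod-↭ f (Perm.trans p q) = ≈-trans (prod-↭ f p) (prod-↭ f q)

    prod-zero : ∀ f {v l} → f v ≈ 0# → v ∈ˡ l → prod f l ≈ 0#
    prod-zero f p (here refl) = ≈-trans (*-cong p ≈-refl) (zeroˡ _)
    prod-zero f p (there i) = ≈-trans (*-cong ≈-refl (prod-zero f p i)) (zeroʳ _)

    -- The factor is ± 1, but only its existence is recorded: the purpose is to see that one product
    -- vanishes when the other does.
    prod-neg : ∀ f → ∀ l → ∃ λ s → prod (λ v → - f v) l ≈ s * prod f l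
    prod-neg f [] = 1# , ≈-sym (*-identityˡ _)
    prod-neg f (v ∷ l) with prod-neg f l
    ... | s , p = - s , ≈-trans (*-cong ≈-refl p) (≈-trans (≈-sym (-‿distribˡ-* _ _))
                    (≈-trans (-‿cong (x∙yz≈y∙xz _ _ _)) (-‿distribˡ-* _ _)))

    ev : (V → Carrier) → Expr (List V) → Carrier
    ev f = lin (prod f)

    Kills : (V → Carrier) → (Expr (List V) → Set) → Set
    Kills f G = ∀ {g} → G g → ev f g ≈ 0#

    ev-shift : ∀ f u e → ev f (bind (λ m → gen (u ++ m)) e) ≈ prod f u * ev f e
    ev-shift f u e = ≈-trans (reflexive (lin-bind (prod f) _ e))
      (≈-trans (lin-cong (prod-++ f u) e) (≈-sym (lin-*ˡ (prod f) (prod f u) e)))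

    module _ {G : Expr (List V) → Set} where
      open Presented G

      ev-resp : ∀ {f} → Kills f G → ∀ {a b} → Eq Rel a b → ev f a ≈ ev f b
      ev-resp {f} kill = lin-resp λ where
        (perm p) → ≈-trans (+-cong (prod-↭ f p) ≈-refl) (-‿inverseʳ _)
        (ideal u {g} r) → ≈-trans (ev-shift f u g) (≈-trans (*-cong ≈-refl (kill r)) (zeroʳ _))

      ev-⊛ : ∀ f a b → ev f (a ⊛ b) ≈ ev f a * ev f b
      ev-⊛ f a b = ≈-trans (reflexive (lin-bind (prod f) _ a))
        (≈-trans (lin-cong (λ l → ev-shift f l b) a) (≈-sym (lin-*ʳ (prod f) (ev f b) a)))

module _ {V : Set} (G : Expr (List V) → Set) (C : CommutativeRing 0ℓ 0ℓ) where
  open Presented G using (ring)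
  open CommutativeRing C using (Carrier; _≈_; _+_; -_; reflexive; trans; *-cong) renaming (refl to ≈-refl)
  open Evaluation C
  private module Q = Evaluation ring

  ev-lin : {X : Set} (f : V → Carrier) (h : X → Expr (List V)) (e : Expr X) →
           ev f (Q.lin h e) ≡ lin (λ x → ev f (h x)) e
  ev-lin f h (gen x) = refl
  ev-lin f h 𝟘 = refl
  ev-lin f h (a ⊕ b) = cong₂ _+_ (ev-lin f h a) (ev-lin f h b)
  ev-lin f h (⊝ a) = cong -_ (ev-lin f h a)

  -- Composition of substitutions. It holds on expressions, so neither assignment has to satisfy
  -- relations; this allows `ψ`, which respects the relations of A(M_Z) only up to an annihilator,
  -- to be composed with `ρ`.
  ev-ev : {W : Set} (f : V → Carrier) (h : W → Expr (List V)) (e : Expr (List W)) →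
          ev f (Q.ev h e) ≈ ev (λ w → ev f (h w)) e
  ev-ev f h e = trans (reflexive (ev-lin f (Q.prod h) e)) (lin-cong ev-prod e)
    where
    ev-prod : ∀ l → ev f (Q.prod h l) ≈ prod (λ w → ev f (h w)) l
    ev-prod [] = ≈-refl
    ev-prod (w ∷ l) = trans (ev-⊛ {G = G} f (h w) (Q.prod h l)) (*-cong ≈-refl (ev-prod l))

module _ {V : Set} (G : Expr (List V) → Set) where
  open Presented G
  private module Q = Evaluation ring

  ev-var : ∀ e → Eq Rel (Q.ev (λ v → gen (v ∷ [])) e) e
  ev-var e = ≈trans (Q.lin-cong prod-var e) (subst (λ x → Eq Rel x e) (≡.trans (sym (bind-gen e)) (bind≡lin Rel gen e)) ≈refl)
    where
    prod-var : ∀ l → Eq Rel (Q.prod (λ v → gen (v ∷ [])) l) (gen l)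
    prod-var [] = ≈refl
    prod-var (v ∷ l) = bind-resp Rel {R′ = Rel} _
      (λ r → ⊛-zero r) (prod-var l)
      where
      ⊛-zero : ∀ {e} → Rel e → Eq Rel (bind (λ m → gen (v ∷ m)) e) 𝟘
      ⊛-zero r = CommutativeRing.trans ring
        (CommutativeRing.*-cong ring (≈refl {a = gen (v ∷ [])}) (≈rel r)) (CommutativeRing.zeroʳ ring (gen (v ∷ [])))

  -- The tautological assignment. Statements proved for all assignments that kill the generators
  -- thereby become statements about the ring itself.
  var-kills : Q.Kills (λ v → gen (v ∷ [])) G
  var-kills {g} r = ≈trans (ev-var g) (subst (λ x → Eq Rel x 𝟘) (bind-gen g) (≈rel (ideal [] r)))

-- Graded pieces inside the ungraded ring.

ungrade : {V : Set} {d : ℕ} → Expr (Vec V d) → Expr (List V)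
ungrade = bind (λ m → gen (toList m))

data Ungraded {V : Set} (G : (d : ℕ) → Expr (Vec V d) → Set) : Expr (List V) → Set where
  ungraded : ∀ {d g} → G d g → Ungraded G (ungrade g)

module _ {V : Set} where
  -- A list whose length differs from `q` goes to `𝟘`, so that the extension `degree q` is the
  -- projection to the homogeneous part of degree `q`.
  monomial : ∀ q → List V → Expr (Vec V q)
  monomial zero [] = gen []ᵛ
  monomial zero (_ ∷ _) = 𝟘
  monomial (suc q) [] = 𝟘
  monomial (suc q) (v ∷ l) = bind (λ m → gen (v ∷ᵛ m)) (monomial q l)

  monomial-toList : ∀ {q} (m : Vec V q) → monomial q (toList m) ≡ gen m
  monomial-toList []ᵛ = refl
  monomial-toList (v ∷ᵛ m) = cong (bind _) (monomial-toList m)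

  monomial-length : ∀ q l → length l ≢ q → monomial q l ≡ 𝟘
  monomial-length zero [] p = contradiction refl p
  monomial-length zero (_ ∷ _) p = refl
  monomial-length (suc q) [] p = refl
  monomial-length (suc q) (v ∷ l) p = cong (bind _) (monomial-length q l (p ∘ cong suc))

  degree : ∀ q → Expr (List V) → Expr (Vec V q)
  degree q = bind (monomial q)

  degree-ungrade : ∀ {q} (e : Expr (Vec V q)) → degree q (ungrade e) ≡ e
  degree-ungrade e = ≡.trans (bind-bind _ _ e) (≡.trans (bind-≗ monomial-toList e) (bind-gen e))

  degree-ungrade-≢ : ∀ {q} (R : Expr (Vec V q) → Set) {d} → d ≢ q → (e : Expr (Vec V d)) →
                     Eq R (degree q (ungrade e)) 𝟘
  degree-ungrade-≢ {q} R {d} p e = subst (λ x → Eq R x 𝟘) (sym (bind-bind _ _ e)) (bind-zero R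
    (λ m → subst (λ x → Eq R x 𝟘) (sym (monomial-length q (toList m) (p ∘ ≡.trans (sym (Vecₚ.length-toList m))))) ≈refl) e)

  toList-fromList : (l : List V) → toList (fromList l) ≡ l
  toList-fromList [] = refl
  toList-fromList (v ∷ l) = cong (v ∷_) (toList-fromList l)

module _ {V : Set} {G : (d : ℕ) → Expr (Vec V d) → Set} where
  open Presented (Ungraded G)

  ungrade-mulE : ∀ {k d} (u : Vec V k) (g : Expr (Vec V d)) →
                 ungrade (mulE u g) ≡ bind (λ m → gen (toList u ++ m)) (ungrade g)
  ungrade-mulE u g = ≡.trans (bind-bind _ _ g)
    (≡.trans (bind-≗ (λ t → cong gen (Vecₚ.toList-++ u t)) g) (sym (bind-bind _ _ g)))

  ungrade-rel : ∀ {q e} → RingRel V G q e → Eq Rel (ungrade e) 𝟘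
  ungrade-rel (perm m m′ p) = ≈rel (perm p)
  ungrade-rel (ideal {g = g} u r) = subst (λ x → Eq Rel x 𝟘) (sym (ungrade-mulE u g)) (≈rel (ideal (toList u) (ungraded r)))

  ungrade-resp : ∀ {q a b} → Eq (RingRel V G q) a b → Eq Rel (ungrade a) (ungrade b)
  ungrade-resp = bind-resp Rel _ ungrade-rel

  -- All generators are homogeneous: a monomial multiple of one lies in a single degree, so its
  -- projection is a relation if that degree is `q` and zero otherwise.
  degree-resp : ∀ q {a b} → Eq Rel a b → Eq (RingRel V G q) (degree q a) (degree q b)
  degree-resp q = bind-resp R (monomial q) λ where
      (perm {l} {m} p) → degree-perm l m p
      (ideal u (ungraded {d} {g} r)) → degree-ideal u d g r
    where
    R = RingRel V G q
    degree-perm : ∀ l m → l ↭ m → Eq R (monomial q l ⊕ ⊝ monomial q m) 𝟘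
    degree-perm l m p with length l ℕₚ.≟ q
    ... | no l≢q rewrite monomial-length q l l≢q
                       | monomial-length q m (l≢q ∘ ≡.trans (Permₚ.↭-length p)) = ≈trans ≈comm ≈invl
    ... | yes refl = subst (λ x → Eq R (x ⊕ ⊝ monomial q m) 𝟘)
        (≡.trans (sym (monomial-toList (fromList l))) (cong (monomial q) (toList-fromList l)))
        (subst (λ x → Eq R (gen (fromList l) ⊕ ⊝ x) 𝟘) eq
          (≈rel (perm (fromList l) m′ (≡.subst₂ _↭_ (sym (toList-fromList l)) (sym m′≡) p))))
      where
      m′ : Vec V q
      -- `length m` equals `q` only propositionally, hence the cast.
      m′ = Vec.cast (sym (Permₚ.↭-length p)) (fromList m)
      m′≡ : toList m′ ≡ m
      m′≡ = ≡.trans (Vecₚ.toList-cast _ (fromList m)) (toList-fromList m)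
      eq : gen m′ ≡ monomial q m
      eq = ≡.trans (sym (monomial-toList m′)) (cong (monomial q) m′≡)
    degree-ideal : ∀ u d g → G d g → Eq R (degree q (bind (λ m → gen (u ++ m)) (ungrade g))) 𝟘
    degree-ideal u d g r = subst (λ x → Eq R (degree q x) 𝟘)
        (≡.trans (ungrade-mulE (fromList u) g) (cong (λ w → bind (λ m → gen (w ++ m)) (ungrade g)) (toList-fromList u)))
        graded
      where
      graded : Eq R (degree q (ungrade (mulE (fromList u) g))) 𝟘
      graded with (length u +ℕ d) ℕₚ.≟ q
      ... | yes refl = subst (λ x → Eq R x 𝟘) (sym (degree-ungrade (mulE (fromList u) g))) (≈rel (ideal (fromList u) r))
      ... | no p = degree-ungrade-≢ R p (mulE (fromList u) g)

  -- `degree q` is a left inverse of `ungrade` that respects the relations.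
  ungrade-injective : ∀ {q a b} → Eq Rel (ungrade a) (ungrade b) → Eq (RingRel V G q) a b
  ungrade-injective {q} {a} {b} p = ≡.subst₂ (Eq (RingRel V G q)) (degree-ungrade a) (degree-ungrade b) (degree-resp q p)

-- allSubsets is generated in a module with an extra, unused implicit argument.
allSubsets-implicit : ∀ {k k′} m → allSubsets {k} m ≡ allSubsets {k′} m
allSubsets-implicit zero = refl
allSubsets-implicit {k} {k′} (suc m) = cong (concatMap _) (allSubsets-implicit {k} {k′} m)

-- Sums over all subsets.

module SubsetSum (A : AbelianGroup 0ℓ 0ℓ) where
  open AbelianGroup A renaming
    (Carrier to |A|; _∙_ to _+_; ε to 0#; _⁻¹ to -_; refl to ≈-refl; sym to ≈-sym; trans to ≈-trans)
  open Linear A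
  open import Algebra.Properties.CommutativeSemigroup commutativeSemigroup using (interchange)
  open import Relation.Binary.Reasoning.Setoid setoid

  over : {X : Set} → List X → (X → |A|) → |A|
  over [] h = 0#
  over (x ∷ xs) h = h x + over xs h

  over-cong : {X : Set} (xs : List X) {h k : X → |A|} → (∀ x → h x ≈ k x) → over xs h ≈ over xs k
  over-cong [] p = ≈-refl
  over-cong (x ∷ xs) p = ∙-cong (p x) (over-cong xs p)

  over-+ : {X : Set} (xs : List X) (h k : X → |A|) → over xs (λ x → h x + k x) ≈ over xs h + over xs k
  over-+ [] h k = ≈-sym (identityˡ 0#)
  over-+ (x ∷ xs) h k = ≈-trans (∙-cong ≈-refl (over-+ xs h k)) (interchange _ _ _ _)

  ∑ : ∀ {n} → (Subset n → |A|) → |A|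
  ∑ {n} = over (allSubsets {0} n)

  ∑-suc : ∀ {n} (h : Subset (suc n) → |A|) → ∑ h ≈ ∑ (λ s → h (true ∷ᵛ s) + h (false ∷ᵛ s))
  ∑-suc {n} h = go (allSubsets {0} n)
    where
    go : ∀ xs → over (concatMap (λ s → (true ∷ᵛ s) ∷ (false ∷ᵛ s) ∷ []) xs) h ≈
                over xs (λ s → h (true ∷ᵛ s) + h (false ∷ᵛ s))
    go [] = ≈-refl
    go (s ∷ xs) = ≈-trans (∙-cong ≈-refl (∙-cong ≈-refl (go xs))) (≈-sym (assoc _ _ _))

  ∑-single : ∀ {n} (h : Subset n → |A|) Z → (∀ F → F ≢ Z → h F ≈ 0#) → ∑ h ≈ h Z
  ∑-single h []ᵛ p = identityʳ _
  ∑-single h (true ∷ᵛ Z) p = ≈-trans (∑-suc h) (≈-trans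
    (∑-single _ Z (λ F q → ≈-trans (∙-cong (p _ (q ∘ cong Vec.tail)) (p _ (q ∘ cong Vec.tail))) (identityˡ 0#)))
    (≈-trans (∙-cong ≈-refl (p _ λ ())) (identityʳ _)))
  ∑-single h (false ∷ᵛ Z) p = ≈-trans (∑-suc h) (≈-trans
    (∑-single _ Z (λ F q → ≈-trans (∙-cong (p _ (q ∘ cong Vec.tail)) (p _ (q ∘ cong Vec.tail))) (identityˡ 0#)))
    (≈-trans (∙-cong (p _ λ ()) ≈-refl) (identityˡ _)))

  -- Meant for a linear form over P₊ compared with the one over P₋: they agree at every subset but
  -- `Z`, where the smaller filter contributes nothing.
  ∑-insert : ∀ {n} (h k : Subset n → |A|) Z → (∀ F → F ≢ Z → h F ≈ k F) → k Z ≈ 0# → ∑ h ≈ ∑ k + h Z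
  ∑-insert {n} h k Z p q = begin
    ∑ h                                  ≈⟨ over-cong (allSubsets {0} n) (λ F → split (h F) (k F)) ⟩
    ∑ (λ F → k F + (h F + - k F))        ≈⟨ over-+ (allSubsets {0} n) k _ ⟩
    ∑ k + ∑ (λ F → h F + - k F)          ≈⟨ ∙-cong ≈-refl (∑-single _ Z (λ F F≢Z → ≈-trans (∙-cong (p F F≢Z) ≈-refl) (inverseʳ _))) ⟩
    ∑ k + (h Z + - k Z)                  ≈⟨ ∙-cong ≈-refl (∙-cong ≈-refl (≈-trans (⁻¹-cong q) ε⁻¹≈ε)) ⟩
    ∑ k + (h Z + 0#)                     ≈⟨ ∙-cong ≈-refl (identityʳ _) ⟩
    ∑ k + h Z                            ∎
    where
    open import Algebra.Properties.AbelianGroup A using (ε⁻¹≈ε)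
    split : ∀ x y → x ≈ y + (x + - y)
    split x y = ≈-sym (≈-trans (∙-cong ≈-refl (comm _ _)) (≈-trans (≈-sym (assoc _ _ _))
                  (≈-trans (∙-cong (inverseʳ y) ≈-refl) (identityˡ x))))

  module _ {n : ℕ} (Q : Subset n → Bool) where
    -- Extension by zero to all subsets, so that linear forms for different families of flats run
    -- over the same list and can be compared term by term.
    term : (Σ (Subset n) (λ F → T (Q F)) → |A|) → (Subset n → Bool) → Subset n → |A|
    term f b F with T? (Q F) | b F
    ... | yes p | true = f (F , p)
    ... | _     | _    = 0#

    term-in : ∀ f b {F} (p : T (Q F)) → T (b F) → term f b F ≡ f (F , p)
    term-in f b {F} p t with T? (Q F) | b F
    ... | yes p′ | true = cong (λ x → f (F , x)) (T-irrelevant p′ p)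
    ... | no ¬p | _ = contradiction p ¬p

    term-out : ∀ f b {F} → ¬ T (Q F) → term f b F ≡ 0#
    term-out f b {F} ¬p with T? (Q F) | b F
    ... | yes p | true = contradiction p ¬p
    ... | yes p | false = refl
    ... | no _  | _ = refl

    term-false : ∀ f b {F} → ¬ T (b F) → term f b F ≡ 0#
    term-false f b {F} ¬t with T? (Q F) | b F
    ... | yes p | true = contradiction tt ¬t
    ... | yes p | false = refl
    ... | no _  | _ = refl

    term-cong : ∀ {f g} b → (∀ v → f v ≈ g v) → ∀ F → term f b F ≈ term g b F
    term-cong b h F with T? (Q F) | b F
    ... | yes p | true = h (F , p)
    ... | yes p | false = ≈-refl
    ... | no _  | _ = ≈-refl

    private
      -- Names the selection function local to collect.
      collect-mapMaybe : ∀ b → Σ (Subset n → Maybe (Σ (Subset n) λ F → T (Q F))) λ pick →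
                         collect Q b ≡ mapMaybe pick (allSubsets {n} n)
      collect-mapMaybe b = _ , refl

      pick-term : ∀ f b F → maybe′ f 0# (proj₁ (collect-mapMaybe b) F) ≡ term f b F
      pick-term f b F with T? (Q F) | b F
      ... | yes p | true = refl
      ... | yes p | false = refl
      ... | no p | _ = refl

    sum-collect : {X : Set} (f : X → |A|) (g : Σ (Subset n) (λ F → T (Q F)) → X) → ∀ b →
                  lin f (sumE (map (λ v → gen (g v)) (collect Q b))) ≈ ∑ (term (λ v → f (g v)) b)
    sum-collect f g b = subst (λ xs → lin f (sumE (map (λ v → gen (g v)) (collect Q b))) ≈ over xs (term (λ v → f (g v)) b)) (allSubsets-implicit {n} {0} n)
      (go (proj₁ (collect-mapMaybe b)) (pick-term (λ v → f (g v)) b) (allSubsets {n} n))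
      where
      go : (pick : Subset n → Maybe (Σ (Subset n) λ F → T (Q F))) → (∀ F → maybe′ (λ v → f (g v)) 0# (pick F) ≡ term (λ v → f (g v)) b F) → ∀ xs →
           lin f (sumE (map (λ v → gen (g v)) (mapMaybe pick xs))) ≈ over xs (term (λ v → f (g v)) b)
      go pick p [] = ≈-refl
      go pick p (F ∷ xs) with pick F | p F
      ... | just v  | q = ∙-cong (reflexive q) (go pick p xs)
      ... | nothing | q = ≈-trans (go pick p xs) (≈-trans (≈-sym (identityˡ _)) (∙-cong (reflexive q) ≈-refl))

-- Boolean tests on subsets.

T⊎ : ∀ b → T b ⊎ ¬ T b
T⊎ true = inj₁ tt
T⊎ false = inj₂ id

T-not : ∀ {b} → ¬ T b → T (not b)
T-not {true} p = contradiction tt p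
T-not {false} p = tt

not-T : ∀ {b} → T (not b) → ¬ T b
not-T {false} _ ()

module _ {n : ℕ} where
  T⇒∈ : ∀ {A : Subset n} {i} → T (lookup A i) → i ∈ A
  T⇒∈ {A} {i} t = Vecₚ.lookup⇒[]= i A (Equivalence.to T-≡ t)

  ∈⇒T : ∀ {A : Subset n} {i} → i ∈ A → T (lookup A i)
  ∈⇒T p = Equivalence.from T-≡ (Vecₚ.[]=⇒lookup p)

  ⊆ᵇ⇒⊆ : ∀ {A B : Subset n} → T (A ⊆ᵇ B) → A ⊆ B
  ⊆ᵇ⇒⊆ {A} {B} t {i} p with Equivalence.to T-∨ (All.lookup (Allₚ.all⁺ _ (allFin n) t) (∈-allFin i))
  ... | inj₁ q = contradiction (subst (T ∘ not) (Vecₚ.[]=⇒lookup p) q) λ ()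
  ... | inj₂ q = T⇒∈ q

  ⊆⇒⊆ᵇ : ∀ {A B : Subset n} → A ⊆ B → T (A ⊆ᵇ B)
  ⊆⇒⊆ᵇ {A} {B} p = Allₚ.all⁻ _ (All.universal pointwise (allFin n))
    where
    pointwise : ∀ i → T (not (lookup A i) ∨ lookup B i)
    pointwise i with lookup A i in eq
    ... | true  = ∈⇒T (p (Vecₚ.lookup⇒[]= i A eq))
    ... | false = tt

  ≟ᵇ⇒≡ : ∀ {A B : Subset n} → T (A ≟ᵇ B) → A ≡ B
  ≟ᵇ⇒≡ t with Equivalence.to T-∧ t
  ... | p , q = Subₚ.⊆-antisym (⊆ᵇ⇒⊆ p) (⊆ᵇ⇒⊆ q)

  incomparable : ∀ {A B : Subset n} → ¬ (A ⊆ B) → ¬ (B ⊆ A) → T (incomparableᵇ A B)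
  incomparable {A} {B} p q =
    Equivalence.from (T-∧ {not (A ⊆ᵇ B)}) (T-not {b = A ⊆ᵇ B} (λ t → p (⊆ᵇ⇒⊆ t)) , T-not {b = B ⊆ᵇ A} (λ t → q (⊆ᵇ⇒⊆ t)))

  incomparable⁻ : ∀ {A B : Subset n} → T (incomparableᵇ A B) → ¬ (A ⊆ B) × ¬ (B ⊆ A)
  incomparable⁻ {A} {B} t with Equivalence.to (T-∧ {not (A ⊆ᵇ B)}) t
  ... | p , q = (λ s → not-T {b = A ⊆ᵇ B} p (⊆⇒⊆ᵇ s)) , (λ s → not-T {b = B ⊆ᵇ A} q (⊆⇒⊆ᵇ s))

  toSet⁺ : ∀ {i I} → i ∈ˡ I → i ∈ toSet {n} I
  toSet⁺ (here refl) = Subₚ.x∈p∪q⁺ (inj₁ (Subₚ.x∈⁅x⁆ _))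
  toSet⁺ (there p) = Subₚ.x∈p∪q⁺ (inj₂ (toSet⁺ p))

  toSet⁻ : ∀ {i} I → i ∈ toSet {n} I → i ∈ˡ I
  toSet⁻ {i} [] p with ≡.trans (sym (Vecₚ.[]=⇒lookup p)) (Vecₚ.lookup∘tabulate _ i)
  ... | ()
  toSet⁻ (j ∷ I) p with Subₚ.x∈p∪q⁻ ⁅ j ⁆ (toSet I) p
  ... | inj₁ q = here (Subₚ.x∈⁅y⁆⇒x≡y j q)
  ... | inj₂ q = there (toSet⁻ I q)

  toSet-⊆ : ∀ {I} {F : Subset n} → (∀ {i} → i ∈ˡ I → i ∈ F) → toSet I ⊆ F
  toSet-⊆ {I} p q = p (toSet⁻ I q)

  elements : Subset n → List (Fin n)
  elements A = filter (Subₚ._∈? A) (allFin n)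

  elements⁺ : ∀ {A i} → i ∈ A → i ∈ˡ elements A
  elements⁺ {A} {i} p = ∈-filter⁺ (Subₚ._∈? A) (∈-allFin i) p

  elements⁻ : ∀ {A i} → i ∈ˡ elements A → i ∈ A
  elements⁻ {A} p = proj₂ (∈-filter⁻ (Subₚ._∈? A) {xs = allFin n} p)

-- Rank, closure and bases in a matroid.

module _ {n : ℕ} (M : Matroid n) where
  open ℕₚ.≤-Reasoning

  -- Submodularity for `Y` and `⁅ i ⁆ ∪ X`: their union contains `⁅ i ⁆ ∪ Y` and their intersection
  -- contains `X`. The additive form avoids truncated subtraction.
  rk-diminishing : ∀ {X Y} i → X ⊆ Y → rk M (⁅ i ⁆ ∪ Y) +ℕ rk M X ≤ rk M Y +ℕ rk M (⁅ i ⁆ ∪ X)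
  rk-diminishing {X} {Y} i X⊆Y = begin
    rk M (⁅ i ⁆ ∪ Y) +ℕ rk M X                       ≤⟨ ℕₚ.+-mono-≤ (rk-mono M _ _ covers) (rk-mono M _ _ meets) ⟩
    rk M (Y ∪ (⁅ i ⁆ ∪ X)) +ℕ rk M (Y ∩ (⁅ i ⁆ ∪ X)) ≤⟨ rk-submod M Y (⁅ i ⁆ ∪ X) ⟩
    rk M Y +ℕ rk M (⁅ i ⁆ ∪ X)                       ∎
    where
    covers : ⁅ i ⁆ ∪ Y ⊆ Y ∪ (⁅ i ⁆ ∪ X)
    covers p with Subₚ.x∈p∪q⁻ ⁅ i ⁆ Y p
    ... | inj₁ q = Subₚ.x∈p∪q⁺ (inj₂ (Subₚ.x∈p∪q⁺ (inj₁ q)))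
    ... | inj₂ q = Subₚ.x∈p∪q⁺ (inj₁ q)
    meets : X ⊆ Y ∩ (⁅ i ⁆ ∪ X)
    meets p = Subₚ.x∈p∩q⁺ (X⊆Y p , Subₚ.x∈p∪q⁺ (inj₂ p))

  rkˡ : List (Fin n) → ℕ
  rkˡ I = rk M (toSet I)

  rkˡ-mono : ∀ I J → (∀ {i} → i ∈ˡ I → i ∈ˡ J) → rkˡ I ≤ rkˡ J
  rkˡ-mono I J p = rk-mono M _ _ (λ q → toSet⁺ (p (toSet⁻ I q)))

  rkˡ-∷ : ∀ i I → rkˡ (i ∷ I) ≤ suc (rkˡ I)
  rkˡ-∷ i I = begin
    rk M (⁅ i ⁆ ∪ toSet I)                                  ≤⟨ ℕₚ.m≤m+n _ _ ⟩
    rk M (⁅ i ⁆ ∪ toSet I) +ℕ rk M (⁅ i ⁆ ∩ toSet I)        ≤⟨ rk-submod M _ _ ⟩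
    rk M ⁅ i ⁆ +ℕ rkˡ I                                       ≤⟨ ℕₚ.+-monoˡ-≤ (rkˡ I) (ℕₚ.≤-trans (rk-bound M ⁅ i ⁆) (ℕₚ.≤-reflexive (Subₚ.∣⁅x⁆∣≡1 i))) ⟩
    suc (rkˡ I)                                               ∎

  rkˡ≤length : ∀ I → rkˡ I ≤ length I
  rkˡ≤length [] = ℕₚ.≤-trans (rk-bound M (toSet [])) (ℕₚ.≤-reflexive (≡.trans (cong ∣_∣ empty) (Subₚ.∣⊥∣≡0 n)))
    where
    empty : toSet {n} [] ≡ Data.Fin.Subset.⊥
    empty = Subₚ.⊆-antisym (λ p → contradiction (toSet⁻ [] p) λ ()) (λ p → contradiction p Subₚ.∉⊥)
  rkˡ≤length (i ∷ I) = ℕₚ.≤-trans (rkˡ-∷ i I) (s≤s (rkˡ≤length I))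

  record Independent (I : List (Fin n)) : Set where
    constructor full-rank
    field rank : rkˡ I ≡ length I
  open Independent public

  independent : ∀ {I} → length I ≤ rkˡ I → Independent I
  independent {I} p = full-rank (ℕₚ.≤-antisym (rkˡ≤length I) p)

  independent-tail : ∀ {i I} → Independent (i ∷ I) → Independent I
  independent-tail {i} {I} p = independent (ℕₚ.≤-pred (ℕₚ.≤-trans (ℕₚ.≤-reflexive (sym (rank p))) (rkˡ-∷ i I)))

  independent-suffix : ∀ I {J} → Independent (I ++ J) → Independent J
  independent-suffix [] p = p
  independent-suffix (i ∷ I) p = independent-suffix I (independent-tail p)

  -- A repeated element leaves the underlying set, hence the rank, unchanged while the length grows.
  -- The product relations ask for `Unique`.
  independent⇒unique : ∀ {I} → Independent I → Unique I
  independent⇒unique {[]} p = []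
  independent⇒unique {i ∷ I} p = Allₚ.¬Any⇒All¬ I i∉I ∷ independent⇒unique (independent-tail p)
    where
    i∉I : i ∉ˡ I
    i∉I q = ℕₚ.1+n≰n (begin
      suc (length I) ≡⟨ rank p ⟨
      rkˡ (i ∷ I)      ≤⟨ rkˡ-mono (i ∷ I) I (λ { (here refl) → q ; (there r) → r }) ⟩
      rkˡ I            ≤⟨ rkˡ≤length I ⟩
      length I       ∎)

  rkˡ-absorb : ∀ i I J → (∀ {j} → j ∈ˡ I → j ∈ˡ J) → rkˡ (i ∷ I) ≤ rkˡ I → rkˡ (i ∷ J) ≤ rkˡ J
  rkˡ-absorb i I J I⊆J p = ℕₚ.+-cancelʳ-≤ (rkˡ I) _ _ (ℕₚ.≤-trans
    (rk-diminishing i (λ q → toSet⁺ (I⊆J (toSet⁻ I q)))) (ℕₚ.+-monoʳ-≤ (rkˡ J) p))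

  independent-∷ : ∀ {i I} → ¬ rkˡ (i ∷ I) ≤ rkˡ I → Independent I → Independent (i ∷ I)
  independent-∷ {i} {I} p q = independent (ℕₚ.≤-trans (ℕₚ.≤-reflexive (cong suc (sym (rank q)))) (ℕₚ.≰⇒> p))

  -- Greedy choice from the end of the list: an element is dropped when it adds no rank to those
  -- kept, and by `rkˡ-absorb` it then adds none to the whole tail either.
  extract-basis : ∀ L → ∃ λ I → (∀ {i} → i ∈ˡ I → i ∈ˡ L) × Independent I × rkˡ L ≤ rkˡ I
  extract-basis [] = [] , (λ ()) , independent z≤n , ℕₚ.≤-refl
  extract-basis (i ∷ L) with extract-basis L
  ... | I , I⊆L , ind , L≤I with rkˡ (i ∷ I) ℕₚ.≤? rkˡ I
  ... | yes p = I , there ∘ I⊆L , ind , ℕₚ.≤-trans (rkˡ-absorb i I L I⊆L p) L≤I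
  ... | no ¬p = i ∷ I , (λ { (here q) → here q ; (there q) → there (I⊆L q) }) , independent-∷ ¬p ind ,
                ℕₚ.≤-trans (rkˡ-∷ i L) (ℕₚ.≤-trans (s≤s L≤I) (ℕₚ.≰⇒> ¬p))

  flat⇒ : ∀ {F} → T (flatᵇ M F) → ∀ {i} → i ∉ F → rk M F < rk M (⁅ i ⁆ ∪ F)
  flat⇒ {F} t {i} i∉F with Equivalence.to T-∨ (All.lookup (Allₚ.all⁺ _ (allFin n) t) (∈-allFin i))
  ... | inj₁ q = contradiction (T⇒∈ q) i∉F
  ... | inj₂ q = subst (λ X → rk M F < rk M X) (Subₚ.∪-comm F ⁅ i ⁆) (ℕₚ.<ᵇ⇒< _ _ q)

  flat⇐ : ∀ {F} → (∀ {i} → i ∉ F → rk M F < rk M (⁅ i ⁆ ∪ F)) → T (flatᵇ M F)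
  flat⇐ {F} p = Allₚ.all⁻ _ (All.universal pointwise (allFin n))
    where
    pointwise : ∀ i → T (lookup F i ∨ (rk M F <ᵇ rk M (F ∪ ⁅ i ⁆)))
    pointwise i with lookup F i in eq
    ... | true = tt
    ... | false = ℕₚ.<⇒<ᵇ (subst (λ X → rk M F < rk M X) (Subₚ.∪-comm ⁅ i ⁆ F)
                    (p λ q → contradiction (≡.trans (sym eq) (Vecₚ.[]=⇒lookup q)) λ ()))

  cl⁻ : ∀ {X i} → i ∈ cl M X → i ∈ X ⊎ rk M (⁅ i ⁆ ∪ X) ≤ rk M X
  cl⁻ {X} {i} p with Equivalence.to T-∨ (subst T (Vecₚ.lookup∘tabulate _ i) (∈⇒T p))
  ... | inj₁ q = inj₁ (T⇒∈ q)
  ... | inj₂ q = inj₂ (ℕₚ.≤-reflexive (≡.trans (cong (rk M) (Subₚ.∪-comm ⁅ i ⁆ X)) (ℕₚ.≡ᵇ⇒≡ _ _ q)))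

  cl⁺ : ∀ {X i} → rk M (⁅ i ⁆ ∪ X) ≤ rk M X → i ∈ cl M X
  cl⁺ {X} {i} p = T⇒∈ (subst T (sym (Vecₚ.lookup∘tabulate _ i)) (Equivalence.from T-∨ (inj₂ (ℕₚ.≡⇒≡ᵇ _ _
    (ℕₚ.≤-antisym (ℕₚ.≤-trans (ℕₚ.≤-reflexive (cong (rk M) (Subₚ.∪-comm X ⁅ i ⁆))) p)
                  (rk-mono M _ _ (λ q → Subₚ.x∈p∪q⁺ (inj₁ q))))))))

  ⊆-cl : ∀ {X} → X ⊆ cl M X
  ⊆-cl {X} {i} p = T⇒∈ (subst T (sym (Vecₚ.lookup∘tabulate _ i)) (Equivalence.from T-∨ (inj₁ (∈⇒T p))))

  cl-absorbs : ∀ {X i} → i ∈ cl M X → rk M (⁅ i ⁆ ∪ X) ≤ rk M X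
  cl-absorbs {X} {i} p with cl⁻ p
  ... | inj₂ q = q
  ... | inj₁ q = rk-mono M _ _ sub
    where
    sub : ⁅ i ⁆ ∪ X ⊆ X
    sub r with Subₚ.x∈p∪q⁻ ⁅ i ⁆ X r
    ... | inj₁ s = subst (_∈ X) (sym (Subₚ.x∈⁅y⁆⇒x≡y i s)) q
    ... | inj₂ s = s

  -- An element of the closure outside `F` would add rank to the flat `F` but none to its subset
  -- `X`, against `rk-diminishing`.
  cl-⊆-flat : ∀ {X F} → T (flatᵇ M F) → X ⊆ F → cl M X ⊆ F
  cl-⊆-flat {X} {F} flat X⊆F {i} p with i Subₚ.∈? F
  ... | yes q = q
  ... | no i∉F = contradiction (flat⇒ flat i∉F) (ℕₚ.≤⇒≯ (ℕₚ.+-cancelʳ-≤ (rk M X) _ _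
          (ℕₚ.≤-trans (rk-diminishing i X⊆F) (ℕₚ.+-monoʳ-≤ (rk M F) (cl-absorbs p)))))

  -- Adding the elements of the closure to `X` one at a time never raises the rank.
  rk-cl : ∀ X → rk M (cl M X) ≤ rk M X
  rk-cl X = ℕₚ.≤-trans (rk-mono M _ _ cl⊆) (go (elements (cl M X)) elements⁻)
    where
    cl⊆ : cl M X ⊆ toSet (elements (cl M X)) ∪ X
    cl⊆ p = Subₚ.x∈p∪q⁺ (inj₁ (toSet⁺ (elements⁺ p)))
    go : ∀ L → (∀ {i} → i ∈ˡ L → i ∈ cl M X) → rk M (toSet L ∪ X) ≤ rk M X
    go [] p = rk-mono M _ _ λ q → Sum.[ (λ r → contradiction (toSet⁻ [] r) λ ()) , id ] (Subₚ.x∈p∪q⁻ (toSet []) X q)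
    go (i ∷ L) p = ℕₚ.≤-trans (subst (λ Y → rk M Y ≤ rk M (toSet L ∪ X)) (sym (Subₚ.∪-assoc ⁅ i ⁆ (toSet L) X))
      (ℕₚ.+-cancelʳ-≤ (rk M X) _ _ (ℕₚ.≤-trans (rk-diminishing i (Subₚ.q⊆p∪q (toSet L) X))
        (ℕₚ.+-monoʳ-≤ (rk M (toSet L ∪ X)) (cl-absorbs (p (here refl))))))) (go L (p ∘ there))

  cl-flat : ∀ X → T (flatᵇ M (cl M X))
  cl-flat X = flat⇐ λ {i} i∉ → begin-strict
    rk M (cl M X)           ≤⟨ rk-cl X ⟩
    rk M X                  <⟨ ℕₚ.≰⇒> (i∉ ∘ cl⁺) ⟩
    rk M (⁅ i ⁆ ∪ X)        ≤⟨ rk-mono M _ _ (λ p → Subₚ.x∈p∪q⁺ (Sum.map₂ ⊆-cl (Subₚ.x∈p∪q⁻ ⁅ i ⁆ X p))) ⟩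
    rk M (⁅ i ⁆ ∪ cl M X)   ∎

  flat-basis : ∀ {F} → T (flatᵇ M F) → ∃ λ I → Independent I × cl M (toSet I) ≡ F
  flat-basis {F} flat with extract-basis (elements F)
  ... | I , I⊆ , ind , F≤I = I , ind , Subₚ.⊆-antisym
      (cl-⊆-flat flat I⊆F)
      (λ {i} p → cl⁺ (begin
        rk M (⁅ i ⁆ ∪ toSet I) ≤⟨ rk-mono M _ _ (λ q → Sum.[ (λ r → subst (_∈ F) (sym (Subₚ.x∈⁅y⁆⇒x≡y i r)) p) , I⊆F ] (Subₚ.x∈p∪q⁻ ⁅ i ⁆ (toSet I) q)) ⟩
        rk M F                 ≤⟨ rk-mono M _ _ (λ q → toSet⁺ (elements⁺ q)) ⟩
        rkˡ (elements F)         ≤⟨ F≤I ⟩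
        rkˡ I                    ∎))
    where
    I⊆F : toSet I ⊆ F
    I⊆F = toSet-⊆ (λ p → elements⁻ (I⊆ p))

  rk-cl-toSet : ∀ {I F} → Independent I → cl M (toSet I) ≡ F → length I ≡ rk M F
  rk-cl-toSet {I} ind refl = ≡.trans (sym (rank ind)) (ℕₚ.≤-antisym (rk-mono M _ _ ⊆-cl) (rk-cl (toSet I)))

  -- Steinitz exchange: walk along I until j first becomes dependent.
  exchange : ∀ j I A → Independent (j ∷ A) → rkˡ (j ∷ I ++ A) ≤ rkˡ (I ++ A) → ∃ λ i → ∃ λ I′ →
             (I ++ A ↭ i ∷ I′ ++ A) × rkˡ (i ∷ j ∷ I′ ++ A) ≤ rkˡ (j ∷ I′ ++ A)
  exchange j [] A ind dep = contradiction (ℕₚ.≤-trans (ℕₚ.≤-reflexive (sym (rank ind))) (ℕₚ.≤-trans dep (rkˡ≤length A))) ℕₚ.1+n≰n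
  exchange j (i₀ ∷ I) A ind dep with rkˡ (j ∷ I ++ A) ℕₚ.≤? rkˡ (I ++ A)
  ... | yes p with exchange j I A ind p
  ... | i , I′ , p↭ , dep′ = i , i₀ ∷ I′ , Perm.trans (Perm.prep i₀ p↭) (Perm.swap i₀ i Perm.refl) ,
          rkˡ-absorb i (j ∷ I′ ++ A) (j ∷ i₀ ∷ I′ ++ A) (λ { (here q) → here q ; (there q) → there (there q) }) dep′
  exchange j (i₀ ∷ I) A ind dep | no ¬p = i₀ , I , Perm.refl , (begin
    rkˡ (i₀ ∷ j ∷ I ++ A) ≤⟨ rkˡ-mono (i₀ ∷ j ∷ I ++ A) (j ∷ i₀ ∷ I ++ A) (λ { (here q) → there (here q) ; (there (here q)) → here q ; (there (there q)) → there (there q) }) ⟩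
    rkˡ (j ∷ i₀ ∷ I ++ A) ≤⟨ dep ⟩
    rkˡ (i₀ ∷ I ++ A)     ≤⟨ rkˡ-∷ i₀ (I ++ A) ⟩
    suc (rkˡ (I ++ A))    ≤⟨ ℕₚ.≰⇒> ¬p ⟩
    rkˡ (j ∷ I ++ A)      ∎)

-- Flats above Z and bases of Z.

module MaximalFlat {n : ℕ} (M : Matroid n) (P : Subset n → Bool) (filter : IsOrderFilter M P)
                   (Z : Subset n) (maxZ : MaximalOutside M P Z) where
  npFlat⁻ : ∀ {F} → T (npFlatᵇ M F) → T (flatᵇ M F) × T (nonemptyᵇ F) × T (properᵇ F)
  npFlat⁻ {F} t with Equivalence.to T-∧ t
  ... | p , q = p , Equivalence.to (T-∧ {nonemptyᵇ F}) q

  npFlat⁺ : ∀ {F} → T (flatᵇ M F) → T (nonemptyᵇ F) → T (properᵇ F) → T (npFlatᵇ M F)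
  npFlat⁺ {F} p q r = Equivalence.from T-∧ (p , Equivalence.from (T-∧ {nonemptyᵇ F}) (q , r))

  Z-flat : T (flatᵇ M Z)
  Z-flat = proj₁ (npFlat⁻ (proj₁ maxZ))

  Z∉P : ¬ T (P Z)
  Z∉P = proj₁ (proj₂ maxZ)

  nonempty⁻ : ∀ {A : Subset n} → T (nonemptyᵇ A) → ∃ λ i → i ∈ A
  nonempty⁻ {A} t with Any.satisfied (Anyₚ.any⁻ _ (allFin n) t)
  ... | i , p = i , T⇒∈ p

  nonempty⁺ : ∀ {A : Subset n} {i} → i ∈ A → T (nonemptyᵇ A)
  nonempty⁺ {i = i} p = Anyₚ.any⁺ _ (lose (∈-allFin i) (∈⇒T p))

  proper⁻ : ∀ {A : Subset n} → T (properᵇ A) → ∃ λ i → i ∉ A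
  proper⁻ {A} t with Any.satisfied (Anyₚ.any⁻ _ (allFin n) t)
  ... | i , p = i , λ q → not-T {b = lookup A i} p (∈⇒T {A = A} q)

  proper⁺ : ∀ {A : Subset n} {i} → i ∉ A → T (properᵇ A)
  proper⁺ {A} {i} p = Anyₚ.any⁺ _ (lose (∈-allFin i) (T-not {b = lookup A i} (λ t → p (T⇒∈ {A = A} t))))

  Z-nonempty : ∃ λ i → i ∈ Z
  Z-nonempty = nonempty⁻ {Z} (proj₁ (proj₂ (npFlat⁻ {Z} (proj₁ maxZ))))

  Z-proper : ∃ λ i → i ∉ Z
  Z-proper = proper⁻ {Z} (proj₂ (proj₂ (npFlat⁻ {Z} (proj₁ maxZ))))

  P-flat : ∀ {F} → T (P F) → T (flatᵇ M F)
  P-flat {F} p = proj₁ (npFlat⁻ (proj₁ filter F p))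

  P⊈Z : ∀ {F} → T (P F) → ¬ F ⊆ Z
  P⊈Z p q = Z∉P (proj₂ filter _ _ p (proj₁ maxZ) q)

  ∉-witness : ∀ {F G : Subset n} → ¬ F ⊆ G → ∃ λ i → i ∈ F × i ∉ G
  ∉-witness {F} {G} p with Finₚ.any? (λ i → (i Subₚ.∈? F) ×-dec ¬? (i Subₚ.∈? G))
  ... | yes q = q
  ... | no ¬q = contradiction {A = F ⊆ G} (λ {i} i∈F → decidable-stable (i Subₚ.∈? G) (λ i∉G → ¬q (i , i∈F , i∉G))) p

  -- This is where the maximality of `Z` enters: a proper flat above `Z` and outside the filter
  -- would have to equal `Z`.
  above-Z : ∀ {F} → T (flatᵇ M F) → Z ⊆ F → (∃ λ j → j ∈ F × j ∉ Z) → T (P F) ⊎ F ≡ ⊤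
  above-Z {F} flat Z⊆F (j , j∈F , j∉Z) with T? (P F) | ⊤ Subₚ.⊆? F
  ... | yes p | _ = inj₁ p
  ... | no _  | yes q = inj₂ (Subₚ.⊆-antisym Subₚ.⊆⊤ q)
  ... | no ¬p | no ¬q with ∉-witness ¬q
  ... | e , _ , e∉F = contradiction
    (subst (j ∈_) (proj₂ (proj₂ maxZ) F (npFlat⁺ flat (nonempty⁺ j∈F) (proper⁺ e∉F)) ¬p Z⊆F) j∈F) j∉Z

  -- Puts the variables of A(M_Z) among those of A(M,P₋), not just of A(M,P₊); `lift` rests on it.
  -- Properness excludes the case of `E` in `above-Z`.
  zFlat⁻ : ∀ {F} → T (zFlatᵇ M Z F) → Z ⊆ F × T (P F)
  zFlat⁻ {F} t with Equivalence.to T-∧ t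
  ... | flat , t₁ with Equivalence.to (T-∧ {Z ⊆ᵇ F}) t₁
  ... | Z⊆F , t₂ with Equivalence.to (T-∧ {not (F ⊆ᵇ Z)}) t₂
  ... | F⊈Z , proper with above-Z flat (⊆ᵇ⇒⊆ Z⊆F) (∉-witness (λ s → not-T {b = F ⊆ᵇ Z} F⊈Z (⊆⇒⊆ᵇ {A = F} {Z} s)))
  ... | inj₁ p = ⊆ᵇ⇒⊆ Z⊆F , p
  ... | inj₂ refl = contradiction Subₚ.∈⊤ (proj₂ (proper⁻ {⊤} proper))

  zFlat⁺ : ∀ {F} → T (P F) → Z ⊆ F → T (zFlatᵇ M Z F)
  zFlat⁺ {F} p Z⊆F = Equivalence.from T-∧ (P-flat p ,
    Equivalence.from (T-∧ {Z ⊆ᵇ F}) (⊆⇒⊆ᵇ Z⊆F ,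
    Equivalence.from (T-∧ {not (F ⊆ᵇ Z)}) (T-not {b = F ⊆ᵇ Z} (λ t → P⊈Z p (⊆ᵇ⇒⊆ {A = F} {Z} t)) ,
      proj₂ (proj₂ (npFlat⁻ {F} (proj₁ filter F p))))))

  -- If all of `I` lay in the flat `Z`, so would its closure; but neither `E` nor a member of the
  -- filter lies below `Z`. The factor x_j found here makes a product relation insensitive to shifts
  -- by an element supported over Z, which x_j kills.
  leaves-Z : ∀ {I} → T (P (cl M (toSet I))) ⊎ cl M (toSet I) ≡ ⊤ → ∃ λ j → j ∈ˡ I × j ∉ Z
  leaves-Z {I} p with ∉-witness {toSet I} {Z} (λ I⊆Z → not-below p (cl-⊆-flat M Z-flat I⊆Z))
    where
    not-below : ∀ {X} → T (P X) ⊎ X ≡ ⊤ → ¬ X ⊆ Z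
    not-below (inj₁ q) s = P⊈Z q s
    not-below (inj₂ refl) s = proj₂ Z-proper (s Subₚ.∈⊤)
  ... | j , j∈I , j∉Z = j , toSet⁻ I j∈I , j∉Z

  Basis : List (Fin n) → Set
  Basis I = Independent M I × cl M (toSet I) ≡ Z

  basis⊆Z : ∀ {I i} → Basis I → i ∈ˡ I → i ∈ Z
  basis⊆Z (_ , refl) p = ⊆-cl M (toSet⁺ p)

  Z⊆flat : ∀ {I F} → Basis I → T (flatᵇ M F) → (∀ {i} → i ∈ˡ I → i ∈ F) → Z ⊆ F
  Z⊆flat (_ , refl) flat p = cl-⊆-flat M flat (toSet-⊆ p)

  -- The closure of `j ∷ I` is a flat strictly above `Z`, so `j ∷ I` gives a product relation
  -- already in A(M,P₋). Hence the product over a basis of `Z` annihilates x_j.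
  basis-∷ : ∀ {I j} → Basis I → j ∉ Z → Independent M (j ∷ I) × (T (P (cl M (toSet (j ∷ I)))) ⊎ cl M (toSet (j ∷ I)) ≡ ⊤)
  basis-∷ {I} {j} B@(ind , refl) j∉Z =
    independent-∷ M (j∉Z ∘ cl⁺ M) ind ,
    above-Z (cl-flat M (toSet (j ∷ I)))
      (Z⊆flat B (cl-flat M (toSet (j ∷ I))) (λ p → ⊆-cl M (toSet⁺ {I = j ∷ I} (there p))))
      (j , ⊆-cl M (toSet⁺ {I = j ∷ I} (here refl)) , j∉Z)

  basis : ∃ Basis
  basis = flat-basis M Z-flat

  basis-length : ∀ {I} → Basis I → length I ≡ rk M Z
  basis-length (ind , p) = rk-cl-toSet M ind p

  basis-full : ∀ {I} → Independent M I → (∀ {i} → i ∈ˡ I → i ∈ Z) → rk M Z ≤ length I → Basis I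
  basis-full {I} ind I⊆Z len = ind , Subₚ.⊆-antisym (cl-⊆-flat M Z-flat (toSet-⊆ I⊆Z)) λ {i} i∈Z →
    cl⁺ M (ℕₚ.≤-trans (rk-mono M _ _ (λ q →
      Sum.[ (λ r → subst (_∈ Z) (sym (Subₚ.x∈⁅y⁆⇒x≡y i r)) i∈Z) , toSet-⊆ I⊆Z ] (Subₚ.x∈p∪q⁻ ⁅ i ⁆ (toSet I) q)))
      (ℕₚ.≤-trans len (ℕₚ.≤-reflexive (sym (rank ind)))))

-- The common value of `linFormZ` at the elements of `Z`, which lie in every flat above `Z`; this
-- form avoids singling out such an element.
totalZ : ∀ {n} (M : Matroid n) (Z : Subset n) → Expr (Vec (VarZ M Z) 1)
totalZ M Z = sumE (map (λ v → gen (v ∷ᵛ []ᵛ)) (collect (zFlatᵇ M Z) (λ _ → true)))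

-- Assignments that satisfy the relations of A(M,P).

module Models (C : CommutativeRing 0ℓ 0ℓ) {n : ℕ} (M : Matroid n) where
  open CommutativeRing C renaming (refl to ≈-refl; sym to ≈-sym; trans to ≈-trans)
  open Evaluation C public
  open SubsetSum +-abelianGroup public
  open import Algebra.Properties.Group +-group using (x∙y⁻¹≈ε⇒x≈y)
  open import Algebra.Properties.CommutativeSemigroup *-commutativeSemigroup using (x∙yz≈y∙xz)
  open import Relation.Binary.Reasoning.Setoid setoid

  sub-zero : ∀ {x y} → x ≈ y → x + - y ≈ 0#
  sub-zero p = ≈-trans (+-cong p ≈-refl) (-‿inverseʳ _)

  Subsets : (Subset n → Bool) → Set
  Subsets Q = Σ (Subset n) λ F → T (Q F)

  through : (Q : Subset n → Bool) → (Subsets Q → Carrier) → Fin n → Carrier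
  through Q f i = ∑ (term Q f (λ F → lookup F i))

  ev-ungrade : {V : Set} (f : V → Carrier) {d : ℕ} (e : Expr (Vec V d)) →
               ev f (ungrade e) ≈ lin (λ m → prod f (toList m)) e
  ev-ungrade f e = reflexive (lin-bind (prod f) _ e)

  ev-collect : {V : Set} (f : V → Carrier) (Q : Subset n → Bool) (g : Subsets Q → V) (b : Subset n → Bool) →
               lin (λ m → prod f (toList m)) (sumE (map (λ v → gen (g v ∷ᵛ []ᵛ)) (collect Q b))) ≈
               ∑ (term Q (λ v → f (g v)) b)
  ev-collect f Q g b = ≈-trans (sum-collect Q _ (λ v → g v ∷ᵛ []ᵛ) b)
    (over-cong (allSubsets {0} n) (term-cong Q b (λ v → *-identityʳ _)))

  module _ (P : Subset n → Bool) where
    linearValue : (Var M P → Carrier) → Fin n → Carrier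
    linearValue θ i = θ (inj₁ i) + through P (λ v → θ (inj₂ v)) i

    ev-linForm : ∀ θ i → ev θ (ungrade (linForm M P i)) ≈ linearValue θ i
    ev-linForm θ i = ≈-trans (ev-ungrade θ (linForm M P i))
      (+-cong (*-identityʳ _) (ev-collect θ P inj₂ (λ F → lookup F i)))

    -- The product relations are split off since the assignment used for injectivity satisfies all
    -- others over P₊ but fails on those attached to bases of `Z`.
    record IsPreModel (θ : Var M P → Carrier) : Set where
      field
        incomp-zero  : ∀ {F₁ F₂} (p₁ : T (P F₁)) (p₂ : T (P F₂)) → T (incomparableᵇ F₁ F₂) →
                       θ (inj₂ (F₁ , p₁)) * θ (inj₂ (F₂ , p₂)) ≈ 0#
        outside-zero : ∀ {i F} (p : T (P F)) → i ∉ F → θ (inj₁ i) * θ (inj₂ (F , p)) ≈ 0#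
        linear-eq    : ∀ i j → linearValue θ i ≈ linearValue θ j

    record IsModel (θ : Var M P → Carrier) : Set where
      field
        isPreModel   : IsPreModel θ
        indep-zero   : ∀ {I} → Independent M I → T (P (cl M (toSet I))) ⊎ cl M (toSet I) ≡ ⊤ →
                       prod (λ i → θ (inj₁ i)) I ≈ 0#
      open IsPreModel isPreModel public

    private
      prod-fromList : ∀ (θ : Var M P → Carrier) I →
                      prod θ (toList (Vec.map inj₁ (fromList I))) ≡ prod (λ i → θ (inj₁ i)) I
      prod-fromList θ [] = refl
      prod-fromList θ (i ∷ I) = cong (θ (inj₁ i) *_) (prod-fromList θ I)

      pair : ∀ {x y z} → x * (y * 1#) ≈ z → x * y ≈ z
      pair p = ≈-trans (*-cong ≈-refl (≈-sym (*-identityʳ _))) p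

    relation-value : ∀ {θ} → IsPreModel θ → ∀ {g} → Ungraded (GenP M P) g → ev θ g ≈ 0# ⊎
                     ∃ λ I → Independent M I × (T (P (cl M (toSet I))) ⊎ cl M (toSet I) ≡ ⊤) ×
                             ev θ g ≈ prod (λ i → θ (inj₁ i)) I
    relation-value {θ} m = λ where
        (ungraded (incomp F₁ F₂ p₁ p₂ t)) → inj₁ (≈-trans (*-cong ≈-refl (*-identityʳ _)) (incomp-zero p₁ p₂ t))
        (ungraded (outside i F p q)) → inj₁ (≈-trans (*-cong ≈-refl (*-identityʳ _)) (outside-zero p q))
        (ungraded (indep I u r c)) → inj₂ (I , full-rank r , c , reflexive (prod-fromList θ I))
        (ungraded (linear i j q)) → inj₁ (sub-zero (≈-trans (ev-linForm θ i) (≈-trans (linear-eq i j) (≈-sym (ev-linForm θ j)))))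
      where open IsPreModel m

    model⇒kills : ∀ {θ} → IsModel θ → Kills θ (Ungraded (GenP M P))
    model⇒kills m r with relation-value (IsModel.isPreModel m) r
    ... | inj₁ p = p
    ... | inj₂ (I , ind , c , p) = ≈-trans p (IsModel.indep-zero m {I} ind c)

    kills⇒model : ∀ {θ} → Kills θ (Ungraded (GenP M P)) → IsModel θ
    kills⇒model {θ} kill = record
      { isPreModel = record
        { incomp-zero = λ p₁ p₂ t → pair (kill (ungraded (incomp _ _ p₁ p₂ t)))
        ; outside-zero = λ p q → pair (kill (ungraded (outside _ _ p q)))
        ; linear-eq = lin-eq }
      ; indep-zero = λ {I} ind c → ≈-trans (≈-sym (reflexive (prod-fromList θ I)))
                       (kill (ungraded (indep I (independent⇒unique M ind) (rank ind) c))) }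
      where
      lin-eq : ∀ i j → linearValue θ i ≈ linearValue θ j
      lin-eq i j with i Finₚ.≟ j
      ... | yes refl = ≈-refl
      ... | no i≢j = ≈-trans (≈-sym (ev-linForm θ i)) (≈-trans
              (x∙y⁻¹≈ε⇒x≈y _ _ (kill (ungraded (linear i j i≢j)))) (ev-linForm θ j))

  module _ (Z : Subset n) where
    ev-linFormZ : ∀ (ψ : VarZ M Z → Carrier) i → ev ψ (ungrade (linFormZ M Z i)) ≈ through (zFlatᵇ M Z) ψ i
    ev-linFormZ ψ i = ≈-trans (ev-ungrade ψ (linFormZ M Z i)) (ev-collect ψ (zFlatᵇ M Z) id (λ F → lookup F i))

    ev-total : ∀ (ψ : VarZ M Z → Carrier) → ev ψ (ungrade (totalZ M Z)) ≈ ∑ (term (zFlatᵇ M Z) ψ (λ _ → true))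
    ev-total ψ = ≈-trans (ev-ungrade ψ (totalZ M Z)) (ev-collect ψ (zFlatᵇ M Z) id (λ _ → true))

  -- `w` travels past the factors already treated, so the two assignments need only agree after
  -- multiplication by `w`.
  *-prod-cong : ∀ w {V : Set} (f g : V → Carrier) → (∀ v → w * f v ≈ w * g v) → ∀ l → w * prod f l ≈ w * prod g l
  *-prod-cong w f g h [] = ≈-refl
  *-prod-cong w f g h (v ∷ l) = begin
    w * (f v * prod f l)  ≈⟨ *-assoc w _ _ ⟨
    w * f v * prod f l    ≈⟨ *-cong (h v) ≈-refl ⟩
    w * g v * prod f l    ≈⟨ *-cong (*-comm w _) ≈-refl ⟩
    g v * w * prod f l    ≈⟨ *-assoc _ w _ ⟩
    g v * (w * prod f l)  ≈⟨ *-cong ≈-refl (*-prod-cong w f g h l) ⟩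
    g v * (w * prod g l)  ≈⟨ x∙yz≈y∙xz _ _ _ ⟩
    w * (g v * prod g l)  ∎

  *-over : ∀ w {X : Set} (xs : List X) (h : X → Carrier) → w * over xs h ≈ over xs (λ x → w * h x)
  *-over w [] h = zeroʳ w
  *-over w (x ∷ xs) h = ≈-trans (distribˡ w _ _) (+-cong ≈-refl (*-over w xs h))

  -- The factor at `v` is brought to the front and acts as the multiplier of `*-prod-cong`.
  prod-absorb : ∀ {V : Set} {f g : V → Carrier} {v l} → g v ≈ f v → (∀ u → f v * g u ≈ f v * f u) → v ∈ˡ l →
                prod f l ≈ 0# → prod g l ≈ 0#
  prod-absorb {f = f} {g} {v} p h v∈l q with ∈-∃++ v∈l
  ... | l₁ , l₂ , refl = begin
    prod g (l₁ ++ v ∷ l₂)    ≈⟨ prod-↭ g (Permₚ.shift v l₁ l₂) ⟩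
    g v * prod g (l₁ ++ l₂)  ≈⟨ *-cong p ≈-refl ⟩
    f v * prod g (l₁ ++ l₂)  ≈⟨ *-prod-cong (f v) g f h (l₁ ++ l₂) ⟩
    f v * prod f (l₁ ++ l₂)  ≈⟨ prod-↭ f (Permₚ.shift v l₁ l₂) ⟨
    prod f (l₁ ++ v ∷ l₂)    ≈⟨ q ⟩
    0#                       ∎

  module _ {V : Set} {G : Expr (List V) → Set} (ψ : V → Carrier) (w : Carrier) where
    open Presented G

    -- `ψ` itself need not respect the relations. After multiplication by `w` it does, because the
    -- elements killed by `w` form an ideal.
    annihilator-resp : (∀ {g} → G g → w * ev ψ g ≈ 0#) → ∀ {a b} → Eq Rel a b → w * ev ψ a ≈ w * ev ψ b
    annihilator-resp kill {a} {b} p = ≈-trans (lin-*ˡ _ w a) (≈-trans (lin-resp resp p) (≈-sym (lin-*ˡ _ w b)))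
      where
      resp : ∀ {e} → Rel e → lin (λ l → w * prod ψ l) e ≈ 0#
      resp (perm p) = sub-zero (*-cong ≈-refl (prod-↭ ψ p))
      resp (ideal u {g} r) = begin
        lin (λ l → w * prod ψ l) (bind (λ m → gen (u ++ m)) g) ≈⟨ lin-*ˡ _ w (bind (λ m → gen (u ++ m)) g) ⟨
        w * ev ψ (bind (λ m → gen (u ++ m)) g)                 ≈⟨ *-cong ≈-refl (ev-shift ψ u g) ⟩
        w * (prod ψ u * ev ψ g)                                ≈⟨ x∙yz≈y∙xz _ _ _ ⟩
        prod ψ u * (w * ev ψ g)                                ≈⟨ *-cong ≈-refl (kill r) ⟩
        prod ψ u * 0#                                          ≈⟨ zeroʳ _ ⟩
        0#                                                     ∎

module _ (C : CommutativeRing 0ℓ 0ℓ) where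
  open CommutativeRing C

  Annihilates : Carrier → Carrier → Set
  Annihilates w x = w * x ≈ 0#

-- Restriction to A(M_Z) and elements supported over Z.

module Contraction {n : ℕ} (M : Matroid n) (P : Subset n → Bool) (filter : IsOrderFilter M P)
                   (Z : Subset n) (maxZ : MaximalOutside M P Z) where
  open MaximalFlat M P filter Z maxZ public

  j₀ : Fin n
  j₀ = proj₁ Z-proper

  j₀∉Z : j₀ ∉ Z
  j₀∉Z = proj₂ Z-proper

  -- The restriction of x_i, i ∈ Z, to A(M_Z); read off the linear relation between i and j₀.
  β : Expr (List (VarZ M Z))
  β = ungrade (linFormZ M Z j₀) ⊕ ⊝ ungrade (totalZ M Z)

  -- Every variable that elements supported over Z annihilate goes to `𝟘`; all x_i with `i` in `Z`
  -- share the value `β`.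
  ρ : Var M P → Expr (List (VarZ M Z))
  ρ (inj₁ i) = if lookup Z i then β else 𝟘
  ρ (inj₂ (F , _)) with T? (zFlatᵇ M Z F)
  ... | yes z = gen ((F , z) ∷ [])
  ... | no _  = 𝟘

  if-∈ : ∀ {A : Set} {i} {x y : A} → i ∈ Z → (if lookup Z i then x else y) ≡ x
  if-∈ p rewrite Vecₚ.[]=⇒lookup p = refl

  if-∉ : ∀ {A : Set} {i} {x y : A} → i ∉ Z → (if lookup Z i then x else y) ≡ y
  if-∉ {i = i} p with lookup Z i in eq
  ... | true = contradiction (Vecₚ.lookup⇒[]= i Z eq) p
  ... | false = refl

  ρ-above : ∀ {F} (p : T (P F)) (z : T (zFlatᵇ M Z F)) → ρ (inj₂ (F , p)) ≡ gen ((F , z) ∷ [])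
  ρ-above {F} p z with T? (zFlatᵇ M Z F)
  ... | yes z′ = cong (λ t → gen ((F , t) ∷ [])) (T-irrelevant z′ z)
  ... | no ¬z = contradiction z ¬z

  ρ-not-above : ∀ {F} (p : T (P F)) → ¬ Z ⊆ F → ρ (inj₂ (F , p)) ≡ 𝟘
  ρ-not-above {F} p q with T? (zFlatᵇ M Z F)
  ... | yes z = ⊥-elim (q (proj₁ (zFlat⁻ z)))
  ... | no _ = refl

  lift : VarZ M Z → Var M P
  lift (F , z) = inj₂ (F , proj₂ (zFlat⁻ z))

  module _ (C : CommutativeRing 0ℓ 0ℓ) (ψ : VarZ M Z → CommutativeRing.Carrier C) where
    open CommutativeRing C renaming (refl to ≈-refl; sym to ≈-sym; trans to ≈-trans)
    open Models C M

    through-total : ∀ {i} → i ∈ Z → through (zFlatᵇ M Z) ψ i ≈ ∑ (term (zFlatᵇ M Z) ψ (λ _ → true))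
    through-total {i} i∈Z = over-cong (allSubsets {0} n) same
      where
      same : ∀ F → term (zFlatᵇ M Z) ψ (λ F → lookup F i) F ≈ term (zFlatᵇ M Z) ψ (λ _ → true) F
      same F with T⊎ (zFlatᵇ M Z F)
      ... | inj₂ ¬z = ≈-trans (reflexive (term-out (zFlatᵇ M Z) ψ (λ G → lookup G i) ¬z))
                        (≈-sym (reflexive (term-out (zFlatᵇ M Z) ψ (λ _ → true) ¬z)))
      ... | inj₁ z = ≈-trans (reflexive (term-in (zFlatᵇ M Z) ψ (λ G → lookup G i) z (∈⇒T (proj₁ (zFlat⁻ z) i∈Z))))
                        (≈-sym (reflexive (term-in (zFlatᵇ M Z) ψ (λ _ → true) z tt)))

  -- An element w that is supported over Z makes w·A(M,P) a quotient of A(M_Z).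
  module Annihilator (C : CommutativeRing 0ℓ 0ℓ) (θ : Var M P → CommutativeRing.Carrier C)
    (model : Models.IsModel C M P θ) (w : CommutativeRing.Carrier C)
    (w-element : ∀ {i} → i ∉ Z → Annihilates C w (θ (inj₁ i)))
    (w-flat : ∀ {F} (p : T (P F)) → ¬ Z ⊆ F → Annihilates C w (θ (inj₂ (F , p)))) where
    open CommutativeRing C renaming (refl to ≈-refl; sym to ≈-sym; trans to ≈-trans)
    open Models C M
    open IsModel model
    open import Relation.Binary.Reasoning.Setoid setoid
    open import Algebra.Properties.Ring ring using (-‿distribʳ-*)

    ψ : VarZ M Z → Carrier
    ψ v = θ (lift v)

    w-term : ∀ b F → w * term P (λ v → θ (inj₂ v)) b F ≈ w * term (zFlatᵇ M Z) ψ b F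
    w-term b F with T⊎ (b F)
    ... | inj₂ ¬t = *-cong ≈-refl (≈-trans (reflexive (term-false P _ b ¬t)) (≈-sym (reflexive (term-false (zFlatᵇ M Z) ψ b ¬t))))
    ... | inj₁ t with T⊎ (P F)
    ... | inj₂ ¬p = *-cong ≈-refl (≈-trans (reflexive (term-out P _ b ¬p))
                    (≈-sym (reflexive (term-out (zFlatᵇ M Z) ψ b (λ z → ¬p (proj₂ (zFlat⁻ z)))))))
    ... | inj₁ p with Z Subₚ.⊆? F
    ... | yes Z⊆F = *-cong ≈-refl (≈-trans (reflexive (term-in P _ b p t))
                      (≈-trans (reflexive (cong (λ q → θ (inj₂ (F , q))) (T-irrelevant p (proj₂ (zFlat⁻ z)))))
                             (≈-sym (reflexive (term-in (zFlatᵇ M Z) ψ b z t)))))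
      where z = zFlat⁺ p Z⊆F
    ... | no Z⊈F = begin
      w * term P (λ v → θ (inj₂ v)) b F ≈⟨ *-cong ≈-refl (reflexive (term-in P _ b p t)) ⟩
      w * θ (inj₂ (F , p))              ≈⟨ w-flat p Z⊈F ⟩
      0#                                ≈⟨ zeroʳ w ⟨
      w * 0#                            ≈⟨ *-cong ≈-refl (reflexive (term-out (zFlatᵇ M Z) ψ b (λ z → Z⊈F (proj₁ (zFlat⁻ z))))) ⟨
      w * term (zFlatᵇ M Z) ψ b F       ∎

    w-through : ∀ i → w * through P (λ v → θ (inj₂ v)) i ≈ w * ev ψ (ungrade (linFormZ M Z i))
    w-through i = begin
      w * through P (λ v → θ (inj₂ v)) i           ≈⟨ *-over w (allSubsets {0} n) (term P (λ v → θ (inj₂ v)) b) ⟩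
      ∑ (λ F → w * term P (λ v → θ (inj₂ v)) b F)  ≈⟨ over-cong (allSubsets {0} n) (w-term b) ⟩
      ∑ (λ F → w * term (zFlatᵇ M Z) ψ b F)        ≈⟨ *-over w (allSubsets {0} n) (term (zFlatᵇ M Z) ψ b) ⟨
      w * through (zFlatᵇ M Z) ψ i                 ≈⟨ *-cong ≈-refl (ev-linFormZ Z ψ i) ⟨
      w * ev ψ (ungrade (linFormZ M Z i))          ∎
      where
      b : Subset n → Bool
      b F = lookup F i

    w-total : ∀ {i} → i ∈ Z → w * ev ψ (ungrade (linFormZ M Z i)) ≈ w * ev ψ (ungrade (totalZ M Z))
    w-total {i} i∈Z = *-cong ≈-refl (≈-trans (ev-linFormZ Z ψ i)
      (≈-trans (through-total C ψ i∈Z) (≈-sym (ev-total Z ψ))))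

    w-linear : ∀ i j → w * θ (inj₁ i) + w * ev ψ (ungrade (linFormZ M Z i)) ≈
                       w * θ (inj₁ j) + w * ev ψ (ungrade (linFormZ M Z j))
    w-linear i j = begin
      w * θ (inj₁ i) + w * ev ψ (ungrade (linFormZ M Z i)) ≈⟨ expand i ⟨
      w * linearValue P θ i                                ≈⟨ *-cong ≈-refl (linear-eq i j) ⟩
      w * linearValue P θ j                                ≈⟨ expand j ⟩
      w * θ (inj₁ j) + w * ev ψ (ungrade (linFormZ M Z j)) ∎
      where
      expand : ∀ i → w * linearValue P θ i ≈ w * θ (inj₁ i) + w * ev ψ (ungrade (linFormZ M Z i))
      expand i = ≈-trans (distribˡ w _ _) (+-cong ≈-refl (w-through i))

    w-linear-∉ : ∀ i {j} → j ∉ Z → w * θ (inj₁ i) + w * ev ψ (ungrade (linFormZ M Z i)) ≈ w * ev ψ (ungrade (linFormZ M Z j))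
    w-linear-∉ i {j} j∉Z = ≈-trans (w-linear i j) (≈-trans (+-cong (w-element j∉Z) ≈-refl) (+-identityˡ _))

    w-sub : ∀ {x y} → w * (x + - y) ≈ w * x + - (w * y)
    w-sub = ≈-trans (distribˡ w _ _) (+-cong ≈-refl (≈-sym (-‿distribʳ-* w _)))

    -- For `i`, `j` outside `Z`, multiplying the linear relation of A(M,P₋) by `w` removes x_i, x_j
    -- and all flats not above `Z`; what remains is the linear relation of A(M_Z).
    w-relation : ∀ {g} → Ungraded (GenZ M Z) g → w * ev ψ g ≈ 0#
    w-relation (ungraded (incomp (F₁ , z₁) (F₂ , z₂) t)) = ≈-trans
      (*-cong ≈-refl (≈-trans (*-cong ≈-refl (*-identityʳ _)) (incomp-zero (proj₂ (zFlat⁻ z₁)) (proj₂ (zFlat⁻ z₂)) t))) (zeroʳ w)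
    w-relation (ungraded (linear i j i∉Z j∉Z _)) = ≈-trans w-sub (sub-zero (≈-trans
      (≈-sym (≈-trans (+-cong (w-element i∉Z) ≈-refl) (+-identityˡ _))) (w-linear-∉ i j∉Z)))

    w-resp : ∀ {a b} → Eq (Presented.Rel (Ungraded (GenZ M Z))) a b → w * ev ψ a ≈ w * ev ψ b
    w-resp = annihilator-resp ψ w w-relation

    -- Compare the linear forms at `i` and `j₀`: `w` kills the variable of `j₀`, and every flat
    -- above `Z` contains `i`, so the sum for `i` is the total.
    w-β : ∀ {i} → i ∈ Z → w * θ (inj₁ i) ≈ w * ev ψ β
    w-β {i} i∈Z = begin
      w * θ (inj₁ i)                                         ≈⟨ cancel _ _ ⟨
      (w * θ (inj₁ i) + w * ev ψ (ungrade (linFormZ M Z i))) + - (w * ev ψ (ungrade (linFormZ M Z i)))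
                                                             ≈⟨ +-cong (w-linear-∉ i j₀∉Z) (-‿cong (w-total i∈Z)) ⟩
      w * ev ψ (ungrade (linFormZ M Z j₀)) + - (w * ev ψ (ungrade (totalZ M Z))) ≈⟨ w-sub ⟨
      w * ev ψ β                                             ∎
      where
      cancel : ∀ x y → (x + y) + - y ≈ x
      cancel x y = ≈-trans (+-assoc x y _) (≈-trans (+-cong ≈-refl (-‿inverseʳ y)) (+-identityʳ x))

    w-var : ∀ v → w * θ v ≈ w * ev ψ (ρ v)
    w-var (inj₁ i) with i Subₚ.∈? Z
    ... | yes i∈Z = ≈-trans (w-β i∈Z) (*-cong ≈-refl (reflexive (cong (ev ψ) (≡.sym (if-∈ i∈Z)))))
    ... | no i∉Z = ≈-trans (w-element i∉Z) (≈-trans (≈-sym (zeroʳ w)) (*-cong ≈-refl (reflexive (cong (ev ψ) (≡.sym (if-∉ i∉Z))))))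
    w-var (inj₂ (F , p)) with Z Subₚ.⊆? F
    ... | no Z⊈F = ≈-trans (w-flat p Z⊈F) (≈-trans (≈-sym (zeroʳ w)) (*-cong ≈-refl (reflexive (cong (ev ψ) (≡.sym (ρ-not-above p Z⊈F))))))
    ... | yes Z⊆F = *-cong ≈-refl (≈-trans (reflexive (cong (λ q → θ (inj₂ (F , q))) (T-irrelevant p (proj₂ (zFlat⁻ z)))))
                      (≈-trans (≈-sym (*-identityʳ _)) (reflexive (cong (ev ψ) (≡.sym (ρ-above p z))))))
      where z = zFlat⁺ p Z⊆F

    -- Agreement on variables (`w-var`) spreads to monomials factor by factor, with `w` as the
    -- common multiplier.
    w-contract : ∀ e → w * ev θ e ≈ w * ev ψ (Evaluation.ev (Presented.ring (Ungraded (GenZ M Z))) ρ e)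
    w-contract e = begin
      w * ev θ e                             ≈⟨ lin-*ˡ _ w e ⟩
      lin (λ l → w * prod θ l) e             ≈⟨ lin-cong (*-prod-cong w θ _ w-var) e ⟩
      lin (λ l → w * prod (λ v → ev ψ (ρ v)) l) e ≈⟨ lin-*ˡ _ w e ⟨
      w * ev (λ v → ev ψ (ρ v)) e            ≈⟨ *-cong ≈-refl (ev-ev (Ungraded (GenZ M Z)) C ψ ρ e) ⟨
      w * ev ψ (Evaluation.ev (Presented.ring (Ungraded (GenZ M Z))) ρ e)    ∎

-- Φ and Ψ evaluated in an arbitrary ring.

module Pullback {n : ℕ} (M : Matroid n) (P : Subset n → Bool) (filter : IsOrderFilter M P)
                (Z : Subset n) (maxZ : MaximalOutside M P Z) where
  open Contraction M P filter Z maxZ public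

  P⁺ : Subset n → Bool
  P⁺ = P₊ M Z P

  P⁺-keep : ∀ {F} → T (P F) → T (P⁺ F)
  P⁺-keep p = Equivalence.from T-∨ (inj₁ p)

  P⁺-new : T (P⁺ Z)
  P⁺-new = Equivalence.from (T-∨ {P Z})
      (inj₂ (Equivalence.from (T-∧ {Z ⊆ᵇ Z}) (⊆⇒⊆ᵇ {A = Z} {Z} id , ⊆⇒⊆ᵇ {A = Z} {Z} id)))

  P⁺⁻ : ∀ {F} → T (P⁺ F) → T (P F) ⊎ F ≡ Z
  P⁺⁻ {F} t with Equivalence.to (T-∨ {P F}) t
  ... | inj₁ p = inj₁ p
  ... | inj₂ q = inj₂ (≟ᵇ⇒≡ q)

  P⁺-≢ : ∀ {F} → F ≢ Z → ¬ T (P F) → ¬ T (P⁺ F)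
  P⁺-≢ F≢Z ¬p t with P⁺⁻ t
  ... | inj₁ p = ¬p p
  ... | inj₂ q = F≢Z q

  module _ (C : CommutativeRing 0ℓ 0ℓ) (f : Var M P⁺ → CommutativeRing.Carrier C) where
    open CommutativeRing C renaming (refl to ≈-refl; sym to ≈-sym; trans to ≈-trans)
    open Models C M
    open import Relation.Binary.Reasoning.Setoid setoid
    open import Algebra.Properties.Semiring.Exp semiring using (_^_)

    t : Carrier
    t = f (xZ M Z P)

    -- The value of Φ(x_v) under `f`, so that Φ becomes a substitution.
    η : Var M P → Carrier
    η v = over (ΦVar M Z P v) f

    f-flat : ∀ {F} (p q : T (P⁺ F)) → f (inj₂ (F , p)) ≈ f (inj₂ (F , q))
    f-flat {F} p q = reflexive (cong (λ r → f (inj₂ (F , r))) (T-irrelevant p q))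

    η-in : ∀ {i} → i ∈ Z → η (inj₁ i) ≈ f (inj₁ i) + t
    η-in {i} p = ≈-trans (reflexive (cong (λ xs → over xs f) (if-∈ {i = i} p))) (+-cong ≈-refl (+-identityʳ t))

    η-out : ∀ {i} → i ∉ Z → η (inj₁ i) ≈ f (inj₁ i)
    η-out {i} p = ≈-trans (reflexive (cong (λ xs → over xs f) (if-∉ {i = i} p))) (+-identityʳ _)

    η-flat : ∀ {F} (p : T (P F)) (q : T (P⁺ F)) → η (inj₂ (F , p)) ≈ f (inj₂ (F , q))
    η-flat p q = ≈-trans (+-identityʳ _) (f-flat _ q)

    over-gen : {X : Set} (h : X → Carrier) (xs : List X) → lin h (sumE (map gen xs)) ≈ over xs h
    over-gen h [] = ≈-refl
    over-gen h (x ∷ xs) = +-cong ≈-refl (over-gen h xs)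

    over-++ : {X : Set} (h : X → Carrier) (xs ys : List X) → over (xs ++ ys) h ≈ over xs h + over ys h
    over-++ h [] ys = ≈-sym (+-identityˡ _)
    over-++ h (x ∷ xs) ys = ≈-trans (+-cong ≈-refl (over-++ h xs ys)) (≈-sym (+-assoc _ _ _))

    -- Distributivity: `choices` lists the monomials in the expansion of a product of sums.
    over-choices : ∀ {q} (v : Vec (List (Var M P⁺)) q) →
                   over (choices M Z P v) (λ m → prod f (toList m)) ≈ prod (λ xs → over xs f) (toList v)
    over-choices []ᵛ = +-identityʳ _
    over-choices (xs ∷ᵛ v) = go xs
      where
      mapped : ∀ x (ms : List (Vec (Var M P⁺) _)) →
               over (map (x ∷ᵛ_) ms) (λ m → prod f (toList m)) ≈ f x * over ms (λ m → prod f (toList m))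
      mapped x [] = ≈-sym (zeroʳ _)
      mapped x (m ∷ ms) = ≈-trans (+-cong ≈-refl (mapped x ms)) (≈-sym (distribˡ _ _ _))
      go : ∀ xs → over (concatMap (λ x → map (x ∷ᵛ_) (choices M Z P v)) xs) (λ m → prod f (toList m)) ≈
                  over xs f * prod (λ ys → over ys f) (toList v)
      go [] = ≈-sym (zeroˡ _)
      go (x ∷ xs) = ≈-trans (over-++ _ (map (x ∷ᵛ_) (choices M Z P v)) _) (≈-trans
        (+-cong (≈-trans (mapped x (choices M Z P v)) (*-cong ≈-refl (over-choices v))) (go xs)) (≈-sym (distribʳ _ _ _)))

    ev-Φ : ∀ {q} (m : Vec (Var M P) q) → ev f (ungrade (Φ M Z P m)) ≈ prod η (toList m)
    ev-Φ m = begin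
      ev f (ungrade (Φ M Z P m))                                        ≈⟨ ev-ungrade f (Φ M Z P m) ⟩
      lin (λ m → prod f (toList m)) (Φ M Z P m)                         ≈⟨ over-gen _ (choices M Z P (Vec.map (ΦVar M Z P) m)) ⟩
      over (choices M Z P (Vec.map (ΦVar M Z P) m)) (λ m → prod f (toList m)) ≈⟨ over-choices (Vec.map (ΦVar M Z P) m) ⟩
      prod (λ xs → over xs f) (toList (Vec.map (ΦVar M Z P) m))         ≈⟨ mapped m ⟩
      prod η (toList m)                                                 ∎
      where
      mapped : ∀ {q} (m : Vec (Var M P) q) → prod (λ xs → over xs f) (toList (Vec.map (ΦVar M Z P) m)) ≈ prod η (toList m)
      mapped []ᵛ = ≈-refl
      mapped (v ∷ᵛ m) = *-cong ≈-refl (mapped m)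

    ψ⁺ : VarZ M Z → Carrier
    ψ⁺ v = η (lift v)

    -- The fallback `nothing` does not occur, because `zFlat⁻` places every flat of M_Z in P₋ and
    -- hence in P₊.
    ιZ-just : ∀ v → ∃ λ u → ιZ M Z P v ≡ just u × f u ≈ ψ⁺ v
    ιZ-just (F , z) with T? (P⁺ F)
    ... | yes q = _ , refl , ≈-sym (η-flat _ q)
    ... | no ¬q = contradiction (P⁺-keep (proj₂ (zFlat⁻ z))) ¬q

    ιZs-just : ∀ {k} (m : Vec (VarZ M Z) k) → ∃ λ m′ → ιZs M Z P m ≡ just m′ × prod f (toList m′) ≈ prod ψ⁺ (toList m)
    ιZs-just []ᵛ = _ , refl , ≈-refl
    ιZs-just (v ∷ᵛ m) with ιZ M Z P v | ιZ-just v | ιZs M Z P m | ιZs-just m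
    ... | .(just u) | u , refl , p | .(just m′) | m′ , refl , q = _ , refl , *-cong p q

    prod-power : ∀ p {k} (m : Vec (Var M P⁺) k) → prod f (toList (replicate p (xZ M Z P) ++ᵛ m)) ≈ t ^ p * prod f (toList m)
    prod-power zero m = ≈-sym (*-identityˡ _)
    prod-power (suc p) m = ≈-trans (*-cong ≈-refl (prod-power p m)) (≈-sym (*-assoc _ _ _))

    ev-Ψ : ∀ p {k} (m : Vec (VarZ M Z) k) → ev f (ungrade (Ψ M Z P p m)) ≈ t ^ p * prod ψ⁺ (toList m)
    ev-Ψ p m with ιZs M Z P m | ιZs-just m
    ... | .(just m′) | m′ , refl , q = ≈-trans (prod-power p m′) (*-cong ≈-refl q)

    module Insert (i : Fin n) where
      b : Subset n → Bool
      b F = lookup F i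

      insert : through P⁺ (λ v → f (inj₂ v)) i ≈ through P (λ v → η (inj₂ v)) i + term P⁺ (λ v → f (inj₂ v)) b Z
      insert = ∑-insert (term P⁺ (λ v → f (inj₂ v)) b) (term P (λ v → η (inj₂ v)) b) Z old
                 (reflexive (term-out P _ b Z∉P))
        where
        old : ∀ F → F ≢ Z → term P⁺ (λ v → f (inj₂ v)) b F ≈ term P (λ v → η (inj₂ v)) b F
        old F F≢Z with T⊎ (b F) | T⊎ (P F)
        ... | inj₂ ¬u | _ = ≈-trans (reflexive (term-false P⁺ _ b ¬u)) (≈-sym (reflexive (term-false P _ b ¬u)))
        ... | inj₁ u | inj₁ p = ≈-trans (reflexive (term-in P⁺ _ b (P⁺-keep p) u))
                (≈-sym (≈-trans (reflexive (term-in P _ b p u)) (η-flat p (P⁺-keep p))))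
        ... | inj₁ u | inj₂ ¬p = ≈-trans (reflexive (term-out P⁺ _ b (P⁺-≢ F≢Z ¬p))) (≈-sym (reflexive (term-out P _ b ¬p)))

    -- For `i` in `Z` the new summand x_Z of the linear form is exactly the shift in Φ(x_i) = x_i +
    -- x_Z; for other `i` neither appears.
    η-linearValue : ∀ i → linearValue P⁺ f i ≈ linearValue P η i
    η-linearValue i with i Subₚ.∈? Z
    ... | yes i∈Z = begin
        f (inj₁ i) + through P⁺ (λ v → f (inj₂ v)) i            ≈⟨ +-cong ≈-refl (≈-trans (≈-trans insert (+-comm _ _))
                                                                     (+-cong (≈-trans (reflexive (term-in P⁺ _ b P⁺-new (∈⇒T i∈Z))) (f-flat _ _)) ≈-refl)) ⟩
        f (inj₁ i) + (t + through P (λ v → η (inj₂ v)) i)       ≈⟨ +-assoc _ _ _ ⟨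
        (f (inj₁ i) + t) + through P (λ v → η (inj₂ v)) i       ≈⟨ +-cong (η-in i∈Z) ≈-refl ⟨
        linearValue P η i                                       ∎
      where
      open Insert i
    ... | no i∉Z = +-cong (≈-sym (η-out i∉Z)) (≈-trans insert (≈-trans
        (+-cong ≈-refl (reflexive (term-false P⁺ _ b (λ u → i∉Z (T⇒∈ u))))) (+-identityʳ _)))
      where
      open Insert i

module PullbackModel {n : ℕ} (M : Matroid n) (P : Subset n → Bool) (filter : IsOrderFilter M P)
                     (Z : Subset n) (maxZ : MaximalOutside M P Z)
                     (C : CommutativeRing 0ℓ 0ℓ) (f : Var M (P₊ M Z P) → CommutativeRing.Carrier C)
                     (model : Models.IsModel C M (P₊ M Z P) f) where
  open CommutativeRing C renaming (refl to ≈-refl; sym to ≈-sym; trans to ≈-trans)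
  open Models C M
  open Pullback M P filter Z maxZ
  open IsModel model
  open import Relation.Binary.Reasoning.Setoid setoid

  xZ-var : f (inj₂ (Z , P⁺-new)) ≈ t C f
  xZ-var = f-flat C f _ _

  t-element : ∀ {i} → i ∉ Z → Annihilates C (t C f) (f (inj₁ i))
  t-element i∉Z = ≈-trans (*-comm _ _) (≈-trans (*-cong ≈-refl (≈-sym xZ-var)) (outside-zero P⁺-new i∉Z))

  t-flat : ∀ {F} (p : T (P F)) (q : T (P⁺ F)) → ¬ Z ⊆ F → Annihilates C (t C f) (f (inj₂ (F , q)))
  t-flat {F} p q Z⊈F = ≈-trans (*-cong (≈-sym xZ-var) ≈-refl)
    (incomp-zero P⁺-new q (incomparable {A = Z} {F} Z⊈F (P⊈Z p)))

  -- Well-definedness of Φ. Only x_i with `i` in `Z` is shifted, and each monomial relation with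
  -- such a factor has another one that x_Z annihilates: in x_i x_F with `i` outside `F`, the flat
  -- `F` is incomparable to `Z`; in a product relation, some x_j has `j` outside `Z`.
  η-model : IsModel P (η C f)
  η-model = record
    { isPreModel = record
      { incomp-zero = λ p₁ p₂ u → ≈-trans (*-cong (η-flat C f p₁ (P⁺-keep p₁)) (η-flat C f p₂ (P⁺-keep p₂))) (incomp-zero _ _ u)
      ; outside-zero = outside-η
      ; linear-eq = λ i j → ≈-trans (≈-sym (η-linearValue C f i)) (≈-trans (linear-eq i j) (η-linearValue C f j)) }
    ; indep-zero = indep-η }
    where
    outside-η : ∀ {i F} (p : T (P F)) → i ∉ F → η C f (inj₁ i) * η C f (inj₂ (F , p)) ≈ 0#
    outside-η {i} {F} p i∉F with i Subₚ.∈? Z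
    ... | no i∉Z = ≈-trans (*-cong (η-out C f i∉Z) (η-flat C f p (P⁺-keep p))) (outside-zero _ i∉F)
    ... | yes i∈Z = begin
      η C f (inj₁ i) * η C f (inj₂ (F , p))           ≈⟨ *-cong (η-in C f i∈Z) (η-flat C f p (P⁺-keep p)) ⟩
      (f (inj₁ i) + t C f) * f (inj₂ (F , P⁺-keep p)) ≈⟨ distribʳ _ _ _ ⟩
      _                                               ≈⟨ +-cong (outside-zero _ i∉F) (t-flat p _ (λ Z⊆F → i∉F (Z⊆F i∈Z))) ⟩
      0# + 0#                                         ≈⟨ +-identityˡ 0# ⟩
      0#                                              ∎

    indep-η : ∀ {I} → Independent M I → T (P (cl M (toSet I))) ⊎ cl M (toSet I) ≡ ⊤ → prod (λ i → η C f (inj₁ i)) I ≈ 0#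
    indep-η {I} ind c with leaves-Z {I} c
    ... | j , j∈I , j∉Z = prod-absorb (η-out C f j∉Z) absorb j∈I (indep-zero {I} ind (Sum.map₁ P⁺-keep c))
      where
      y y′ : Fin n → Carrier
      y i = f (inj₁ i)
      y′ i = η C f (inj₁ i)
      absorb : ∀ i → y j * y′ i ≈ y j * y i
      absorb i with i Subₚ.∈? Z
      ... | no i∉Z = *-cong ≈-refl (η-out C f i∉Z)
      ... | yes i∈Z = begin
        y j * y′ i              ≈⟨ *-cong ≈-refl (η-in C f i∈Z) ⟩
        y j * (y i + t C f)     ≈⟨ distribˡ _ _ _ ⟩
        y j * y i + y j * t C f ≈⟨ +-cong ≈-refl (≈-trans (*-comm _ _) (t-element j∉Z)) ⟩
        y j * y i + 0#          ≈⟨ +-identityʳ _ ⟩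
        y j * y i               ∎

  -- Here `w` is x_Z; `t-resp` is what makes Ψ respect the relations of A(M_Z).
  open Annihilator C (η C f) η-model (t C f)
    (λ i∉Z → ≈-trans (*-cong ≈-refl (η-out C f i∉Z)) (t-element i∉Z))
    (λ p Z⊈F → ≈-trans (*-cong ≈-refl (η-flat C f p (P⁺-keep p))) (t-flat p _ Z⊈F))
    public using () renaming (w-resp to t-resp; w-contract to t-contract)

-- The product over a basis of Z.

module BasisProduct {n : ℕ} (M : Matroid n) (P : Subset n → Bool) (filter : IsOrderFilter M P)
                    (Z : Subset n) (maxZ : MaximalOutside M P Z)
                    (C : CommutativeRing 0ℓ 0ℓ) (θ : Var M P → CommutativeRing.Carrier C)
                    (model : Models.IsModel C M P θ) where
  open CommutativeRing C renaming (refl to ≈-refl; sym to ≈-sym; trans to ≈-trans)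
  open Models C M
  open Contraction M P filter Z maxZ
  open IsModel model
  open import Relation.Binary.Reasoning.Setoid setoid
  open import Algebra.Properties.Group +-group using (∙-cancelʳ)

  y : Fin n → Carrier
  y i = θ (inj₁ i)

  prod-flat : ∀ {K F} (p : T (P F)) → ¬ (toSet K ⊆ F) → prod y K * θ (inj₂ (F , p)) ≈ 0#
  prod-flat {K} {F} p K⊈F with ∉-witness K⊈F
  ... | i , i∈K , i∉F = go K (toSet⁻ K i∈K)
    where
    go : ∀ K → i ∈ˡ K → prod y K * θ (inj₂ (F , p)) ≈ 0#
    go (_ ∷ K) (here refl) = ≈-trans (*-cong (*-comm _ _) ≈-refl) (≈-trans (*-assoc _ _ _)
      (≈-trans (*-cong ≈-refl (outside-zero p i∉F)) (zeroʳ _)))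
    go (k ∷ K) (there q) = ≈-trans (*-assoc _ _ _) (≈-trans (*-cong ≈-refl (go K q)) (zeroʳ _))

  swap-∈ : ∀ {i j K F} → Basis (i ∷ K) → Basis (j ∷ K) → T (P F) → toSet K ⊆ F → i ∈ F → j ∈ F
  swap-∈ {i} {j} {K} B B′ p K⊆F i∈F = Z⊆flat B (P-flat p)
    (λ { (here refl) → i∈F ; (there q) → K⊆F (toSet⁺ q) }) (basis⊆Z B′ (here refl))

  -- Multiply the linear relation between `i` and `j` by the product over `K`. Only flats containing
  -- `K` survive, and such a flat contains `i` exactly when it contains `Z`, exactly when it
  -- contains `j`; the two sums cancel.
  swap : ∀ {i j K} → Basis (i ∷ K) → Basis (j ∷ K) → prod y (i ∷ K) ≈ prod y (j ∷ K)
  swap {i} {j} {K} B B′ = ∙-cancelʳ (w * S i) _ _ (begin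
      y i * w + w * S i   ≈⟨ +-cong (*-comm _ _) ≈-refl ⟩
      w * y i + w * S i   ≈⟨ distribˡ _ _ _ ⟨
      w * (y i + S i)     ≈⟨ *-cong ≈-refl (linear-eq i j) ⟩
      w * (y j + S j)     ≈⟨ distribˡ _ _ _ ⟩
      w * y j + w * S j   ≈⟨ +-cong (*-comm _ _) ≈-refl ⟩
      y j * w + w * S j   ≈⟨ +-cong ≈-refl same ⟨
      y j * w + w * S i   ∎)
    where
    w = prod y K
    S = through P (λ v → θ (inj₂ v))
    x-term : Fin n → Subset n → Carrier
    x-term i = term P (λ v → θ (inj₂ v)) (λ F → lookup F i)
    vanish : ∀ i {F} (p : T (P F)) → ¬ (toSet K ⊆ F) → w * x-term i F ≈ 0#
    vanish i {F} p K⊈F with T⊎ (lookup F i)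
    ... | inj₁ u = ≈-trans (*-cong ≈-refl (reflexive (term-in P _ (λ F → lookup F i) p u))) (prod-flat {K} p K⊈F)
    ... | inj₂ ¬u = ≈-trans (*-cong ≈-refl (reflexive (term-false P _ (λ F → lookup F i) ¬u))) (zeroʳ w)
    same-term : ∀ F → w * x-term i F ≈ w * x-term j F
    same-term F with T⊎ (P F)
    ... | inj₂ ¬p = *-cong ≈-refl (≈-trans (reflexive (term-out P _ (λ F → lookup F i) ¬p))
                      (≈-sym (reflexive (term-out P _ (λ F → lookup F j) ¬p))))
    ... | inj₁ p with toSet K Subₚ.⊆? F
    ... | no K⊈F = ≈-trans (vanish i p K⊈F) (≈-sym (vanish j p K⊈F))
    ... | yes K⊆F with i Subₚ.∈? F
    ... | yes i∈F = *-cong ≈-refl (≈-trans (reflexive (term-in P _ (λ F → lookup F i) p (∈⇒T i∈F)))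
                      (≈-sym (reflexive (term-in P _ (λ F → lookup F j) p (∈⇒T (swap-∈ {i} {j} {K} B B′ p K⊆F i∈F))))))
    ... | no i∉F = *-cong ≈-refl (≈-trans (reflexive (term-false P _ (λ F → lookup F i) (λ u → i∉F (T⇒∈ u))))
                      (≈-sym (reflexive (term-false P _ (λ F → lookup F j) (λ u → i∉F (swap-∈ {j} {i} {K} B′ B p K⊆F (T⇒∈ u)))))))
    same : w * S i ≈ w * S j
    same = ≈-trans (*-over w (allSubsets {0} n) (x-term i)) (≈-trans (over-cong (allSubsets {0} n) same-term)
             (≈-sym (*-over w (allSubsets {0} n) (x-term j))))

  basis-↭ : ∀ {I J} → I ↭ J → Basis I → Basis J
  basis-↭ {I} {J} p B@(ind , _) = basis-full
    (independent M (ℕₚ.≤-trans (ℕₚ.≤-reflexive (≡.trans (Permₚ.↭-length (Perm.↭-sym p)) (sym (rank ind))))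
      (rkˡ-mono M I J (Permₚ.∈-resp-↭ p))))
    (λ q → basis⊆Z B (Permₚ.∈-resp-↭ (Perm.↭-sym p) q))
    (ℕₚ.≤-reflexive (≡.trans (sym (basis-length B)) (Permₚ.↭-length p)))

  -- Elements of the first basis are exchanged into the second one at a time, each exchange being a
  -- `swap`; `A` collects the part already common.
  basis-product : ∀ J I A → Basis (J ++ A) → Basis (I ++ A) → prod y (J ++ A) ≈ prod y (I ++ A)
  basis-product [] I A B B′ with I | ≡.trans (sym (Listₚ.length-++ I)) (≡.trans (basis-length B′) (sym (basis-length B)))
  ... | [] | _ = ≈-refl
  -- Both bases have rk(Z) elements, so nothing can be left over.
  ... | i ∷ I′ | q = contradiction (ℕₚ.≤-trans (s≤s (ℕₚ.m≤n+m (length A) (length I′))) (ℕₚ.≤-reflexive q)) ℕₚ.1+n≰n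
  basis-product (j ∷ J) I A B B′ with exchange M j I A
      (independent-suffix M J (proj₁ (basis-↭ (Perm.↭-sym (Permₚ.shift j J A)) B)))
      (cl-absorbs M (subst (j ∈_) (sym (proj₂ B′)) (basis⊆Z B (here refl))))
  ... | i , I′ , p , dep = begin
      prod y (j ∷ J ++ A)    ≈⟨ prod-↭ y (Permₚ.shift j J A) ⟨
      prod y (J ++ j ∷ A)    ≈⟨ basis-product J I′ (j ∷ A) (basis-↭ (Perm.↭-sym (Permₚ.shift j J A)) B)
                                  (basis-↭ (Perm.↭-sym (Permₚ.shift j I′ A)) B-j) ⟩
      prod y (I′ ++ j ∷ A)   ≈⟨ prod-↭ y (Permₚ.shift j I′ A) ⟩
      prod y (j ∷ I′ ++ A)   ≈⟨ swap {j} {i} {I′ ++ A} B-j B-i ⟩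
      prod y (i ∷ I′ ++ A)   ≈⟨ prod-↭ y p ⟨
      prod y (I ++ A)        ∎
    where
    B-i : Basis (i ∷ I′ ++ A)
    B-i = basis-↭ p B′
    B-j : Basis (j ∷ I′ ++ A)
    B-j = basis-full
      (independent M (ℕₚ.≤-trans (ℕₚ.≤-reflexive (sym (rank (proj₁ B-i))))
        (ℕₚ.≤-trans (rkˡ-mono M (i ∷ I′ ++ A) (i ∷ j ∷ I′ ++ A) (λ { (here q) → here q ; (there q) → there (there q) })) dep)))
      (λ { (here refl) → basis⊆Z B (here refl) ; (there q) → basis⊆Z B-i (there q) })
      (ℕₚ.≤-reflexive (sym (basis-length B-i)))

  prod-basis : ∀ {I J} → Basis I → Basis J → prod y I ≈ prod y J
  prod-basis {I} {J} B B′ = ≡.subst₂ (λ K L → prod y K ≈ prod y L) (Listₚ.++-identityʳ I) (Listₚ.++-identityʳ J)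
    (basis-product I J [] (subst Basis (sym (Listₚ.++-identityʳ I)) B) (subst Basis (sym (Listₚ.++-identityʳ J)) B′))

  module _ {I : List (Fin n)} (B : Basis I) where
    -- For `j` outside `Z`, x_j is killed by `basis-∷`. For `F` not above `Z`, some element of `I`
    -- is outside `F`, since a flat containing `I` contains its closure `Z`.
    open Annihilator C θ model (prod y I)
      (λ {j} j∉Z → ≈-trans (*-comm _ _) (indep-zero {j ∷ I} (proj₁ (basis-∷ B j∉Z)) (proj₂ (basis-∷ B j∉Z))))
      (λ p Z⊈F → prod-flat {I} p (λ I⊆F → Z⊈F (Z⊆flat B (P-flat p) (λ q → I⊆F (toSet⁺ q)))))
      public using () renaming (w-resp to basis-resp; w-contract to basis-contract)

-- The polynomial ring over a presented ring, with nothing as the indeterminate.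
module Polynomial {V : Set} (G : Expr (List V) → Set) where
  data Constant : Expr (List (Maybe V)) → Set where
    constant : ∀ {g} → G g → Constant (bind (λ l → gen (map just l)) g)

  open Presented G using (_⊛_; Rel) renaming (ring to R)
  open Presented Constant using () renaming (ring to R[t]; Rel to Rel[t]; _⊛_ to _⊠_)
  private
    module R = CommutativeRing R
    module S = CommutativeRing R[t]
    module E = Evaluation R
    module F = Evaluation R[t]
  infix 4 _≈_ _≈[t]_
  _≈_ = Eq Rel
  _≈[t]_ = Eq Rel[t]

  -- The index counts occurrences of `nothing`. Coefficients are read off expressions, and
  -- `coeff-resp` shows that they descend to the quotient.
  monomial-coeff : List (Maybe V) → ℕ → Expr (List V)
  monomial-coeff [] zero = gen []
  monomial-coeff [] (suc j) = 𝟘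
  monomial-coeff (just v ∷ l) j = gen (v ∷ []) ⊛ monomial-coeff l j
  monomial-coeff (nothing ∷ l) zero = 𝟘
  monomial-coeff (nothing ∷ l) (suc j) = monomial-coeff l j

  coeff : ℕ → Expr (List (Maybe V)) → Expr (List V)
  coeff j = E.lin (λ l → monomial-coeff l j)

  X : Expr (List (Maybe V))
  X = gen (nothing ∷ [])

  var : V → Expr (List (Maybe V))
  var v = gen (just v ∷ [])

  const : Expr (List V) → Expr (List (Maybe V))
  const = F.ev var

  private
    *-congˡ : ∀ {a b c} → b ≈ c → a ⊛ b ≈ a ⊛ c
    *-congˡ {a} p = R.*-cong (R.refl {a}) p

    monomial-coeff-↭ : ∀ {l m} → l ↭ m → ∀ j → monomial-coeff l j ≈ monomial-coeff m j
    monomial-coeff-↭ Perm.refl j = ≈refl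
    monomial-coeff-↭ (Perm.prep (just v) p) j = *-congˡ {gen (v ∷ [])} (monomial-coeff-↭ p j)
    monomial-coeff-↭ (Perm.prep nothing p) zero = ≈refl
    monomial-coeff-↭ (Perm.prep nothing p) (suc j) = monomial-coeff-↭ p j
    monomial-coeff-↭ (Perm.swap {xs = l} (just v) (just w) p) j = R.trans
      (x∙yz≈y∙xz (gen (v ∷ [])) (gen (w ∷ [])) (monomial-coeff l j))
      (*-congˡ {gen (w ∷ [])} (*-congˡ {gen (v ∷ [])} (monomial-coeff-↭ p j)))
      where open import Algebra.Properties.CommutativeSemigroup R.*-commutativeSemigroup using (x∙yz≈y∙xz)
    monomial-coeff-↭ (Perm.swap (just v) nothing p) zero = R.zeroʳ (gen (v ∷ []))
    monomial-coeff-↭ (Perm.swap (just v) nothing p) (suc j) = *-congˡ {gen (v ∷ [])} (monomial-coeff-↭ p j)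
    monomial-coeff-↭ (Perm.swap nothing (just v) p) zero = R.sym (R.zeroʳ (gen (v ∷ [])))
    monomial-coeff-↭ (Perm.swap nothing (just v) p) (suc j) = *-congˡ {gen (v ∷ [])} (monomial-coeff-↭ p j)
    monomial-coeff-↭ (Perm.swap nothing nothing p) zero = ≈refl
    monomial-coeff-↭ (Perm.swap nothing nothing p) (suc zero) = ≈refl
    monomial-coeff-↭ (Perm.swap nothing nothing p) (suc (suc j)) = monomial-coeff-↭ p j
    monomial-coeff-↭ (Perm.trans p q) j = ≈trans (monomial-coeff-↭ p j) (monomial-coeff-↭ q j)

    coeff-bind : ∀ {Y : Set} j (h : Y → Expr (List (Maybe V))) e → coeff j (bind h e) ≡ E.lin (λ y → coeff j (h y)) e
    coeff-bind j h e = E.lin-bind _ h e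

    coeff-constant : ∀ {g} → G g → ∀ u j → E.lin (λ l → monomial-coeff (u ++ map just l) j) g ≈ 𝟘
    coeff-constant {g} r [] zero = R.trans (E.lin-cong just-coeff g)
        (subst (λ x → x ≈ 𝟘) (≡.trans (bind≡lin Rel gen g) refl) (≈rel (Presented.ideal [] r)))
      where
      just-coeff : ∀ l → monomial-coeff (map just l) 0 ≈ gen l
      just-coeff [] = ≈refl
      just-coeff (v ∷ l) = *-congˡ {gen (v ∷ [])} (just-coeff l)
    coeff-constant {g} r [] (suc j) = E.lin-zero higher g
      where
      higher : ∀ l → monomial-coeff (map just l) (suc j) ≈ 𝟘
      higher [] = ≈refl
      higher (v ∷ l) = R.trans (*-congˡ {gen (v ∷ [])} (higher l)) (R.zeroʳ (gen (v ∷ [])))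
    coeff-constant {g} r (just v ∷ u) j = R.trans (R.sym (E.lin-*ˡ _ (gen (v ∷ [])) g))
      (R.trans (*-congˡ {gen (v ∷ [])} (coeff-constant r u j)) (R.zeroʳ (gen (v ∷ []))))
    coeff-constant {g} r (nothing ∷ u) zero = E.lin-0 g
    coeff-constant {g} r (nothing ∷ u) (suc j) = coeff-constant r u j

  coeff-resp : ∀ j {x y} → x ≈[t] y → coeff j x ≈ coeff j y
  coeff-resp j = E.lin-resp λ where
    (Presented.perm p) → R.trans (R.+-cong (monomial-coeff-↭ p j) ≈refl) (R.-‿inverseʳ _)
    (Presented.ideal u (constant {g} r)) → subst (_≈ 𝟘)
      (sym (≡.trans (coeff-bind j _ (bind _ g)) (E.lin-bind _ _ g))) (coeff-constant r u j)

  coeff-X-zero : ∀ x → coeff 0 (X ⊠ x) ≈ 𝟘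
  coeff-X-zero x = R.trans (R.reflexive (coeff-bind 0 _ x)) (E.lin-0 x)

  coeff-X-suc : ∀ j x → coeff (suc j) (X ⊠ x) ≈ coeff j x
  coeff-X-suc j x = R.reflexive (coeff-bind (suc j) _ x)

  coeff-var : ∀ j v x → coeff j (var v ⊠ x) ≈ gen (v ∷ []) ⊛ coeff j x
  coeff-var j v x = R.trans (R.reflexive (coeff-bind j _ x)) (R.sym (E.lin-*ˡ _ (gen (v ∷ [])) x))

  coeff-prod : ∀ j l x → coeff j (F.prod var l ⊠ x) ≈ gen l ⊛ coeff j x
  coeff-prod j [] x = R.trans (coeff-resp j (S.*-identityˡ x)) (R.sym (R.*-identityˡ _))
  coeff-prod j (v ∷ l) x = R.trans (coeff-resp j (S.*-assoc (var v) (F.prod var l) x))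
    (R.trans (coeff-var j v (F.prod var l ⊠ x)) (R.trans (*-congˡ {gen (v ∷ [])} (coeff-prod j l x))
      (R.sym (R.*-assoc (gen (v ∷ [])) (gen l) (coeff j x)))))

  coeff-lin : ∀ {Y : Set} j (h : Y → Expr (List (Maybe V))) e → coeff j (F.lin h e) ≡ E.lin (λ y → coeff j (h y)) e
  coeff-lin j h e = ≡.trans (cong (coeff j) (sym (bind≡lin Rel[t] h e))) (coeff-bind j h e)

  coeff-const : ∀ j a x → coeff j (const a ⊠ x) ≈ a ⊛ coeff j x
  coeff-const j a x = R.trans (coeff-resp j (F.lin-*ʳ _ x a)) (R.trans (R.reflexive (coeff-lin j _ a))
    (R.trans (E.lin-cong (λ l → coeff-prod j l x) a) (R.trans (R.sym (E.lin-*ʳ gen (coeff j x) a))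
      (R.*-cong {u = coeff j x} (R.trans (R.reflexive (sym (bind≡lin Rel gen a))) (R.reflexive (bind-gen a))) ≈refl))))

  const-kills : F.Kills var G
  const-kills {g} r = S.trans (F.lin-cong prod-var g) (subst (_≈[t] 𝟘) (≡.trans (bind-bind _ _ g) (bind≡lin Rel[t] _ g)) (≈rel (Presented.ideal [] (constant r))))
    where
    prod-var : ∀ l → F.prod var l ≈[t] gen (map just l)
    prod-var [] = ≈refl
    prod-var (v ∷ l) = S.*-cong (≈refl {a = var v}) (prod-var l)

  -- No test for zero coefficients is at hand, so instead of a degree there is a bound read off the
  -- expression; it starts the descending induction in `linear-cancel`.
  coeff-bound : ∀ x → ∃ λ N → ∀ j → N ≤ j → coeff j x ≈ 𝟘
  coeff-bound (gen l) = suc (length l) , bound l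
    where
    bound : ∀ l j → suc (length l) ≤ j → monomial-coeff l j ≈ 𝟘
    bound [] (suc j) p = ≈refl
    bound (just v ∷ l) (suc j) p = R.trans
      (*-congˡ {gen (v ∷ [])} (bound l (suc j) (ℕₚ.≤-trans (ℕₚ.n≤1+n _) p))) (R.zeroʳ (gen (v ∷ [])))
    bound (nothing ∷ l) (suc j) (s≤s p) = bound l j p
  coeff-bound 𝟘 = 0 , λ _ _ → ≈refl
  coeff-bound (a ⊕ b) with coeff-bound a | coeff-bound b
  ... | N , p | N′ , q = N +ℕ N′ , λ j N+N′≤j → R.trans
    (R.+-cong (p j (ℕₚ.m+n≤o⇒m≤o N N+N′≤j)) (q j (ℕₚ.m+n≤o⇒n≤o N N+N′≤j))) (R.+-identityˡ 𝟘)
  coeff-bound (⊝ a) with coeff-bound a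
  ... | N , p = N , λ j N≤j → R.trans (R.-‿cong (p j N≤j)) ε⁻¹≈ε
    where open import Algebra.Properties.Group R.+-group using (ε⁻¹≈ε)

  module _ (b : Expr (List V)) where
    private
      L : Expr (List (Maybe V))
      L = const b ⊕ ⊝ X

      zeros : ∀ {x y} → x ≈ 𝟘 → y ≈ 𝟘 → b ⊛ x ⊕ ⊝ y ≈ 𝟘
      zeros p q = R.trans (R.+-cong (R.trans (*-congˡ {b} p) (R.zeroʳ b)) (R.-‿cong q)) (R.-‿inverseʳ 𝟘)

    coeff-linear-suc : ∀ j h → coeff (suc j) (L ⊠ h) ≈ b ⊛ coeff (suc j) h ⊕ ⊝ coeff j h
    coeff-linear-suc j h = R.+-cong (coeff-const (suc j) b h) (R.-‿cong (coeff-X-suc j h))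

    coeff-linear-zero : ∀ h → coeff 0 (L ⊠ h) ≈ b ⊛ coeff 0 h ⊕ ⊝ 𝟘
    coeff-linear-zero h = R.+-cong (coeff-const 0 b h) (R.-‿cong (coeff-X-zero h))

    -- The leading coefficient of b - X is -1, so multiplication by it raises the degree by exactly
    -- one, whatever `b` is.
    linear-cancel : ∀ h m → (∀ j → m ≤ j → coeff (suc j) (L ⊠ h) ≈ 𝟘) → ∀ j → m ≤ j → coeff j h ≈ 𝟘
    linear-cancel h m vanish j m≤j with coeff-bound h
    ... | N , bound = descend N j m≤j (ℕₚ.m≤n+m N j)
      where
      -- Descending from the degree bound: the coefficient of X^(j+1) in L·h is b·h_{j+1} − h_j.
      descend : ∀ d j → m ≤ j → N ≤ j +ℕ d → coeff j h ≈ 𝟘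
      descend zero j p q = bound j (ℕₚ.≤-trans q (ℕₚ.≤-reflexive (ℕₚ.+-identityʳ j)))
      descend (suc d) j p q = begin
        coeff j h                                              ≈⟨ R.sym (⁻¹-involutive _) ⟩
        ⊝ (⊝ coeff j h)                                        ≈⟨ R.-‿cong (R.sym (R.+-identityˡ _)) ⟩
        ⊝ (𝟘 ⊕ ⊝ coeff j h)                                    ≈⟨ R.-‿cong (R.+-cong (R.sym (R.trans (*-congˡ {b} next) (R.zeroʳ b))) ≈refl) ⟩
        ⊝ (b ⊛ coeff (suc j) h ⊕ ⊝ coeff j h)                  ≈⟨ R.-‿cong (R.sym (coeff-linear-suc j h)) ⟩
        ⊝ coeff (suc j) (L ⊠ h)                                ≈⟨ R.-‿cong (vanish j p) ⟩
        ⊝ 𝟘                                                    ≈⟨ ε⁻¹≈ε ⟩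
        𝟘                                                      ∎
        where
        open import Algebra.Properties.Group R.+-group using (ε⁻¹≈ε; ⁻¹-involutive)
        open import Relation.Binary.Reasoning.Setoid R.setoid
        next : coeff (suc j) h ≈ 𝟘
        next = descend d (suc j) (ℕₚ.m≤n⇒m≤1+n p) (ℕₚ.≤-trans q (ℕₚ.≤-reflexive (ℕₚ.+-suc j d)))

    module _ {I : Set} where
      -- The power (b - X)^k, with `k` given as the length of a list so that it matches a product
      -- over a basis factor by factor.
      power : List I → Expr (List (Maybe V))
      power = F.prod (λ _ → L)

      -- Factors are removed one at a time, each lowering the degree bound by one, until no
      -- coefficient of `h` is left.
      power-cancel : ∀ (is : List I) h → (∀ j → length is ≤ j → coeff j (power is ⊠ h) ≈ 𝟘) → ∀ j → coeff j h ≈ 𝟘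
      power-cancel is h vanish j = go is h 0 (λ j p → vanish j (ℕₚ.≤-trans (ℕₚ.≤-reflexive (sym (ℕₚ.+-identityʳ _))) p)) j z≤n
        where
        go : ∀ (is : List I) h m → (∀ j → length is +ℕ m ≤ j → coeff j (power is ⊠ h) ≈ 𝟘) → ∀ j → m ≤ j → coeff j h ≈ 𝟘
        go [] h m v j p = R.trans (R.sym (coeff-resp j (S.*-identityˡ h))) (v j p)
        go (i ∷ is) h m v = go is h m (linear-cancel (power is ⊠ h) (length is +ℕ m)
          (λ j p → R.trans (R.sym (coeff-resp (suc j) (S.*-assoc L (power is) h))) (v (suc j) (s≤s p))))

      -- `h` is known to vanish only coefficientwise, so its multiples are treated coefficientwise
      -- as well.
      power-zero : ∀ (is : List I) {h} → (∀ j → coeff j h ≈ 𝟘) → ∀ j → coeff j (power is ⊠ h) ≈ 𝟘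
      power-zero [] {h} p j = R.trans (coeff-resp j (S.*-identityˡ h)) (p j)
      power-zero (i ∷ is) {h} p j = R.trans (coeff-resp j (S.*-assoc L (power is) h)) (step j)
        where
        step : ∀ j → coeff j (L ⊠ (power is ⊠ h)) ≈ 𝟘
        step zero = R.trans (coeff-linear-zero (power is ⊠ h)) (zeros (power-zero is {h} p 0) ≈refl)
        step (suc j) = R.trans (coeff-linear-suc j (power is ⊠ h)) (zeros (power-zero is {h} p (suc j)) (power-zero is {h} p j))

-- Powers of x_Z over the image of Φ.

module Spanning {n : ℕ} (M : Matroid n) (P : Subset n → Bool) (filter : IsOrderFilter M P)
                (Z : Subset n) (maxZ : MaximalOutside M P Z)
                (C : CommutativeRing 0ℓ 0ℓ) (f : Var M (P₊ M Z P) → CommutativeRing.Carrier C)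
                (model : Models.IsModel C M (P₊ M Z P) f) where
  open CommutativeRing C renaming (refl to ≈-refl; sym to ≈-sym; trans to ≈-trans)
  open Models C M
  open Pullback M P filter Z maxZ
  open IsModel model
  open import Relation.Binary.Reasoning.Setoid setoid
  open import Algebra.Properties.Semiring.Exp semiring using (_^_)
  open import Algebra.Properties.Ring ring using (-‿distribˡ-*; -‿distribʳ-*; -‿+-comm)
  open import Algebra.Properties.AbelianGroup +-abelianGroup using (ε⁻¹≈ε; inverseʳ-unique)
  open import Algebra.Properties.CommutativeSemigroup +-commutativeSemigroup using (interchange)
  open import Algebra.Properties.CommutativeSemigroup *-commutativeSemigroup using (x∙yz≈y∙xz)

  private
    T₀ : Carrier
    T₀ = t C f

  -- The polynomials in x_Z of degree below m over the image of A(M,P).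
  Span : ℕ → Carrier → Set
  Span zero x = x ≈ 0#
  Span (suc m) x = ∃ λ u → ∃ λ e → Span m u × x ≈ u + T₀ ^ m * ev (η C f) e

  span-≈ : ∀ m {x y} → y ≈ x → Span m x → Span m y
  span-≈ zero p q = ≈-trans p q
  span-≈ (suc m) p (u , e , s , q) = u , e , s , ≈-trans p q

  span-0 : ∀ m → Span m 0#
  span-0 zero = ≈-refl
  span-0 (suc m) = 0# , 𝟘 , span-0 m , ≈-sym (≈-trans (+-identityˡ _) (zeroʳ _))

  span-+ : ∀ m {x y} → Span m x → Span m y → Span m (x + y)
  span-+ zero p q = ≈-trans (+-cong p q) (+-identityˡ 0#)
  span-+ (suc m) (u , e , s , p) (u′ , e′ , s′ , p′) = u + u′ , e ⊕ e′ , span-+ m s s′ ,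
    ≈-trans (+-cong p p′) (≈-trans (interchange _ _ _ _) (+-cong ≈-refl (≈-sym (distribˡ _ _ _))))

  span-neg : ∀ m {x} → Span m x → Span m (- x)
  span-neg zero p = ≈-trans (-‿cong p) ε⁻¹≈ε
  span-neg (suc m) (u , e , s , p) = - u , ⊝ e , span-neg m s ,
    ≈-trans (-‿cong p) (≈-trans (≈-sym (-‿+-comm _ _)) (+-cong ≈-refl (-‿distribʳ-* _ _)))

  span-scale : ∀ m a {x} → Span m x → Span m (ev (η C f) a * x)
  span-scale zero a p = ≈-trans (*-cong ≈-refl p) (zeroʳ _)
  span-scale (suc m) a (u , e , s , p) = ev (η C f) a * u , (a ⊛ e) , span-scale m a s ,
      ≈-trans (*-cong ≈-refl p) (≈-trans (distribˡ _ _ _) (+-cong ≈-refl (≈-trans (x∙yz≈y∙xz _ _ _)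
        (*-cong ≈-refl (≈-sym (ev-⊛ {G = λ _ → ⊥} (η C f) a e))))))
    where open Presented {Var M P} (λ _ → ⊥) using (_⊛_)

  span-suc : ∀ m {x} → Span m x → Span (suc m) x
  span-suc m {x} s = x , 𝟘 , s , ≈-sym (≈-trans (+-cong ≈-refl (zeroʳ _)) (+-identityʳ x))

  span-power : ∀ m e → Span (suc m) (T₀ ^ m * ev (η C f) e)
  span-power m e = 0# , e , span-0 m , ≈-sym (+-identityˡ _)

  span-T : ∀ m {x} → Span m x → Span (suc m) (T₀ * x)
  span-T zero p = span-≈ 1 (≈-trans (*-cong ≈-refl p) (zeroʳ _)) (span-0 1)
  span-T (suc m) (u , e , s , p) = T₀ * u , e , span-T m s ,
    ≈-trans (*-cong ≈-refl p) (≈-trans (distribˡ _ _ _) (+-cong ≈-refl (≈-sym (*-assoc _ _ _))))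

  y η-y : Fin n → Carrier
  y i = f (inj₁ i)
  η-y i = η C f (inj₁ i)

  ev-η-y : ∀ i → ev (η C f) (gen (inj₁ i ∷ [])) ≈ η-y i
  ev-η-y i = *-identityʳ _

  span-η-y : ∀ m i {x} → Span m x → Span m (η-y i * x)
  span-η-y m i s = span-≈ m (*-cong (≈-sym (ev-η-y i)) ≈-refl) (span-scale m (gen (inj₁ i ∷ [])) s)

  -- Only the leading term is made explicit; membership of the rest in `Span` suffices to solve for
  -- the top power.
  monic : ∀ I → ∃ λ u → Span (length I) u × prod (λ i → T₀ + - η-y i) I ≈ T₀ ^ length I + u
  monic [] = 0# , ≈-refl , ≈-sym (+-identityʳ _)
  monic (i ∷ I) with monic I
  ... | u , s , p = T₀ * u + - (η-y i * (T₀ ^ m + u)) ,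
      span-+ (suc m) (span-T m s) (span-neg (suc m) (span-η-y (suc m) i (span-+ (suc m) top (span-suc m s)))) , (begin
        (T₀ + - η-y i) * prod (λ i → T₀ + - η-y i) I          ≈⟨ *-cong ≈-refl p ⟩
        (T₀ + - η-y i) * (T₀ ^ m + u)                         ≈⟨ distribʳ _ _ _ ⟩
        T₀ * (T₀ ^ m + u) + - η-y i * (T₀ ^ m + u)            ≈⟨ +-cong (distribˡ _ _ _) (≈-sym (-‿distribˡ-* _ _)) ⟩
        (T₀ ^ suc m + T₀ * u) + - (η-y i * (T₀ ^ m + u))      ≈⟨ +-assoc _ _ _ ⟩
        T₀ ^ suc m + (T₀ * u + - (η-y i * (T₀ ^ m + u)))      ∎)
    where
    m = length I
    top : Span (suc m) (T₀ ^ m)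
    top = span-≈ (suc m) (≈-sym (*-identityʳ _)) (span-power m (gen []))

  module _ (m : ℕ) (rk-Z : rk M Z ≡ suc m) where
    -- x_Z satisfies the monic equation ∏_{i ∈ I} (x_Z − Φ(x_i)) = ± ∏_{i ∈ I} x_i = 0 for a basis I of Z.
    integral : Span (suc m) (T₀ ^ suc m)
    integral with basis
    ... | I , B with monic I
    ... | u , s , p = span-≈ (suc m) (inverseʳ-unique _ _ (≈-trans (+-comm _ _)
          (≈-trans (+-cong (reflexive (cong (T₀ ^_) (sym len))) ≈-refl) (≈-trans (≈-sym p) vanish))))
          (span-neg (suc m) (subst (λ k → Span k u) len s))
      where
      len : length I ≡ suc m
      len = ≡.trans (basis-length B) rk-Z
      minus-y : ∀ {i} → i ∈ Z → T₀ + - η-y i ≈ - y i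
      minus-y {i} i∈Z = begin
        T₀ + - η-y i         ≈⟨ +-cong ≈-refl (-‿cong (η-in C f i∈Z)) ⟩
        T₀ + - (y i + T₀)    ≈⟨ +-cong ≈-refl (-‿+-comm _ _) ⟨
        T₀ + (- y i + - T₀)  ≈⟨ +-comm _ _ ⟩
        (- y i + - T₀) + T₀  ≈⟨ +-assoc _ _ _ ⟩
        - y i + (- T₀ + T₀)  ≈⟨ +-cong ≈-refl (-‿inverseˡ T₀) ⟩
        - y i + 0#           ≈⟨ +-identityʳ _ ⟩
        - y i                ∎
      negated : ∀ K → (∀ {i} → i ∈ˡ K → i ∈ Z) → prod (λ i → T₀ + - η-y i) K ≈ prod (λ i → - y i) K
      negated [] h = ≈-refl
      negated (i ∷ K) h = *-cong (minus-y (h (here refl))) (negated K (h ∘ there))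
      vanish : prod (λ i → T₀ + - η-y i) I ≈ 0#
      vanish with prod-neg y I
      ... | c , q = ≈-trans (negated I (basis⊆Z B)) (≈-trans q (≈-trans (*-cong ≈-refl
              (indep-zero (proj₁ B) (inj₁ (subst (λ F → T (P⁺ F)) (sym (proj₂ B)) P⁺-new)))) (zeroʳ c)))

    span-closed-T : ∀ {x} → Span (suc m) x → Span (suc m) (T₀ * x)
    span-closed-T (u , e , s , p) = span-≈ (suc m)
      (≈-trans (*-cong ≈-refl p) (≈-trans (distribˡ _ _ _) (+-cong ≈-refl
        (≈-trans (≈-sym (*-assoc _ _ _)) (*-comm _ _)))))
      (span-+ (suc m) (span-T m s) (span-scale (suc m) e integral))

    -- Each variable is linear in x_Z over the image of Φ: x_i = Φ(x_i) - x_Z for `i` in `Z`, and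
    -- all variables other than these and x_Z lie in the image.
    span-closed-var : ∀ v {x} → Span (suc m) x → Span (suc m) (f v * x)
    span-closed-var (inj₁ i) {x} s with i Subₚ.∈? Z
    ... | no i∉Z = span-≈ (suc m) (*-cong (≈-sym (η-out C f i∉Z)) ≈-refl) (span-η-y (suc m) i s)
    ... | yes i∈Z = span-≈ (suc m) (≈-trans (*-cong restore ≈-refl)
                      (≈-trans (distribʳ _ _ _) (+-cong ≈-refl (≈-sym (-‿distribˡ-* _ _)))))
                      (span-+ (suc m) (span-η-y (suc m) i s) (span-neg (suc m) (span-closed-T s)))
      where
      restore : y i ≈ η-y i + - T₀
      restore = ≈-sym (≈-trans (+-cong (η-in C f i∈Z) ≈-refl) (≈-trans (+-assoc _ _ _)
                  (≈-trans (+-cong ≈-refl (-‿inverseʳ T₀)) (+-identityʳ _))))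
    span-closed-var (inj₂ (F , q)) s with P⁺⁻ q
    ... | inj₁ p = span-≈ (suc m) (*-cong (≈-sym (≈-trans (*-identityʳ _) (η-flat C f p q))) ≈-refl)
                     (span-scale (suc m) (gen (inj₂ (F , p) ∷ [])) s)
    ... | inj₂ refl = span-≈ (suc m) (*-cong (f-flat C f q _) ≈-refl) (span-closed-T s)

    span-one : ∀ k → Span (suc k) 1#
    span-one zero = span-≈ 1 (≈-sym (*-identityʳ 1#)) (span-power 0 (gen []))
    span-one (suc k) = span-suc (suc k) (span-one k)

    spanning : ∀ e → Span (suc m) (ev f e)
    spanning (gen l) = go l
      where
      go : ∀ l → Span (suc m) (prod f l)
      go [] = span-one m
      go (v ∷ l) = span-closed-var v (go l)
    spanning 𝟘 = span-0 (suc m)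
    spanning (a ⊕ b) = span-+ (suc m) (spanning a) (spanning b)
    spanning (⊝ a) = span-neg (suc m) (spanning a)

-- Conversely, a model σ over P and an element τ supported over Z give values for the variables over P⁺
-- that satisfy all relations except ∏_{i ∈ I} x_i = 0 for the bases I of Z.
module Pushforward {n : ℕ} (M : Matroid n) (P : Subset n → Bool) (filter : IsOrderFilter M P)
                   (Z : Subset n) (maxZ : MaximalOutside M P Z)
                   (C : CommutativeRing 0ℓ 0ℓ) (σ : Var M P → CommutativeRing.Carrier C)
                   (model : Models.IsModel C M P σ) (τ : CommutativeRing.Carrier C)
                   (τ-element : ∀ {i} → i ∉ Z → Annihilates C (σ (inj₁ i)) τ)
                   (τ-flat : ∀ {F} (p : T (P F)) → ¬ Z ⊆ F → Annihilates C τ (σ (inj₂ (F , p)))) where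
  open CommutativeRing C renaming (refl to ≈-refl; sym to ≈-sym; trans to ≈-trans)
  open Models C M
  open Pullback M P filter Z maxZ
  open IsModel model
  open import Relation.Binary.Reasoning.Setoid setoid
  open import Algebra.Properties.Ring ring using (-‿distribʳ-*)
  open import Algebra.Properties.AbelianGroup +-abelianGroup using (ε⁻¹≈ε)

  θ : Var M P⁺ → Carrier
  θ (inj₁ i) = if lookup Z i then σ (inj₁ i) + - τ else σ (inj₁ i)
  θ (inj₂ (F , _)) with T⊎ (P F)
  ... | inj₁ p = σ (inj₂ (F , p))
  ... | inj₂ _ = τ

  θ-cases : ∀ {Q : Carrier → Set} → (∀ v → Q (σ v)) → (∀ v → Q (σ v + - τ)) → Q τ → ∀ v → Q (θ v)
  θ-cases a b c (inj₁ i) with lookup Z i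
  ... | true = b (inj₁ i)
  ... | false = a (inj₁ i)
  θ-cases a b c (inj₂ (F , _)) with T⊎ (P F)
  ... | inj₁ p = a (inj₂ (F , p))
  ... | inj₂ _ = c

  θ-in : ∀ {i} → i ∈ Z → θ (inj₁ i) ≈ σ (inj₁ i) + - τ
  θ-in p = reflexive (if-∈ p)

  θ-out : ∀ {i} → i ∉ Z → θ (inj₁ i) ≈ σ (inj₁ i)
  θ-out p = reflexive (if-∉ p)

  θ-old : ∀ {F} (q : T (P⁺ F)) (p : T (P F)) → θ (inj₂ (F , q)) ≈ σ (inj₂ (F , p))
  θ-old {F} q p with T⊎ (P F)
  ... | inj₁ p′ = reflexive (cong (λ r → σ (inj₂ (F , r))) (T-irrelevant p′ p))
  ... | inj₂ ¬p = contradiction p ¬p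

  θ-new : ∀ (q : T (P⁺ Z)) → θ (inj₂ (Z , q)) ≈ τ
  θ-new q with T⊎ (P Z)
  ... | inj₁ p = contradiction p Z∉P
  ... | inj₂ _ = ≈-refl

  -- Subtracting `τ` undoes the shift by x_Z in Φ, so `θ` extends `σ` along Φ. The linear relations
  -- over P₊ then follow from those over P₋ by `η-linearValue`.
  η-θ : ∀ v → η C θ v ≈ σ v
  η-θ (inj₁ i) with i Subₚ.∈? Z
  ... | no i∉Z = ≈-trans (η-out C θ i∉Z) (θ-out i∉Z)
  ... | yes i∈Z = begin
    η C θ (inj₁ i)                 ≈⟨ η-in C θ i∈Z ⟩
    θ (inj₁ i) + t C θ             ≈⟨ +-cong (θ-in i∈Z) (θ-new P⁺-new) ⟩
    (σ (inj₁ i) + - τ) + τ         ≈⟨ +-assoc _ _ _ ⟩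
    σ (inj₁ i) + (- τ + τ)         ≈⟨ +-cong ≈-refl (-‿inverseˡ τ) ⟩
    σ (inj₁ i) + 0#                ≈⟨ +-identityʳ _ ⟩
    σ (inj₁ i)                     ∎
  η-θ (inj₂ (F , p)) = ≈-trans (η-flat C θ p (P⁺-keep p)) (θ-old (P⁺-keep p) p)

  minus-τ : ∀ x y → y * τ ≈ 0# → y * (x + - τ) ≈ y * x
  minus-τ x y p = ≈-trans (distribˡ _ _ _) (≈-trans
    (+-cong ≈-refl (≈-trans (≈-sym (-‿distribʳ-* _ _)) (≈-trans (-‿cong p) ε⁻¹≈ε))) (+-identityʳ _))

  preModel : IsPreModel P⁺ θ
  preModel = record
    { incomp-zero = incomp-θ
    ; outside-zero = outside-θ
    ; linear-eq = λ i j → ≈-trans (η-linearValue C θ i) (≈-trans (≈-trans (value i)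
        (≈-trans (linear-eq i j) (≈-sym (value j)))) (≈-sym (η-linearValue C θ j))) }
    where
    value : ∀ i → linearValue P (η C θ) i ≈ linearValue P σ i
    value i = +-cong (η-θ (inj₁ i)) (over-cong (allSubsets {0} n) (term-cong P (λ F → lookup F i) (λ v → η-θ (inj₂ v))))
    incomp-θ : ∀ {F₁ F₂} (q₁ : T (P⁺ F₁)) (q₂ : T (P⁺ F₂)) → T (incomparableᵇ F₁ F₂) →
               θ (inj₂ (F₁ , q₁)) * θ (inj₂ (F₂ , q₂)) ≈ 0#
    incomp-θ {F₁} {F₂} q₁ q₂ u with P⁺⁻ q₁ | P⁺⁻ q₂
    ... | inj₁ p₁ | inj₁ p₂ = ≈-trans (*-cong (θ-old q₁ p₁) (θ-old q₂ p₂)) (incomp-zero p₁ p₂ u)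
    ... | inj₂ refl | inj₁ p₂ = ≈-trans (*-cong (θ-new q₁) (θ-old q₂ p₂))
            (τ-flat p₂ (proj₁ (incomparable⁻ {A = Z} {F₂} u)))
    ... | inj₁ p₁ | inj₂ refl = ≈-trans (*-comm _ _) (≈-trans (*-cong (θ-new q₂) (θ-old q₁ p₁))
            (τ-flat p₁ (proj₂ (incomparable⁻ {A = F₁} {Z} u))))
    ... | inj₂ refl | inj₂ refl = ⊥-elim (proj₁ (incomparable⁻ {A = Z} {Z} u) id)
    outside-θ : ∀ {i F} (q : T (P⁺ F)) → i ∉ F → θ (inj₁ i) * θ (inj₂ (F , q)) ≈ 0#
    outside-θ {i} {F} q i∉F with P⁺⁻ q
    ... | inj₂ refl = ≈-trans (*-cong (θ-out i∉F) (θ-new q)) (τ-element i∉F)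
    ... | inj₁ p with i Subₚ.∈? Z
    ... | no i∉Z = ≈-trans (*-cong (θ-out i∉Z) (θ-old q p)) (outside-zero p i∉F)
    ... | yes i∈Z = ≈-trans (*-cong (θ-in i∈Z) (θ-old q p)) (≈-trans (*-comm _ _) (≈-trans
            (minus-τ _ _ (≈-trans (*-comm _ _) (τ-flat p (λ Z⊆F → i∉F (Z⊆F i∈Z)))))
            (≈-trans (*-comm _ _) (outside-zero p i∉F))))

  indep-θ : ∀ {I} → Independent M I → T (P (cl M (toSet I))) ⊎ cl M (toSet I) ≡ ⊤ → prod (λ i → θ (inj₁ i)) I ≈ 0#
  indep-θ {I} ind c with leaves-Z {I} c
  ... | j , j∈I , j∉Z = prod-absorb (θ-out j∉Z) absorb j∈I (indep-zero {I} ind c)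
    where
    y y′ : Fin n → Carrier
    y i = σ (inj₁ i)
    y′ i = θ (inj₁ i)
    absorb : ∀ i → y j * y′ i ≈ y j * y i
    absorb i with i Subₚ.∈? Z
    ... | no i∉Z = *-cong ≈-refl (θ-out i∉Z)
    ... | yes i∈Z = ≈-trans (*-cong ≈-refl (θ-in i∈Z)) (minus-τ _ _ (τ-element j∉Z))

  -- A closure in P₋ or equal to `E` forces a factor outside `Z`, which absorbs `τ`; the only other
  -- member of P₊ is `Z` itself.
  relation-θ : ∀ {g} → Ungraded (GenP M P⁺) g → ev θ g ≈ 0# ⊎
               ∃ λ I → Basis I × ev θ g ≈ prod (λ i → σ (inj₁ i) + - τ) I
  relation-θ r with relation-value P⁺ preModel r
  ... | inj₁ p = inj₁ p
  ... | inj₂ (I , ind , inj₂ c , p) = inj₁ (≈-trans p (indep-θ {I} ind (inj₂ c)))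
  ... | inj₂ (I , ind , inj₁ q , p) with P⁺⁻ q
  ... | inj₁ c = inj₁ (≈-trans p (indep-θ {I} ind (inj₁ c)))
  ... | inj₂ c = inj₂ (I , (ind , c) , ≈-trans p (inside I (basis⊆Z (ind , c))))
    where
    inside : ∀ K → (∀ {i} → i ∈ˡ K → i ∈ Z) → prod (λ i → θ (inj₁ i)) K ≈ prod (λ i → σ (inj₁ i) + - τ) K
    inside [] h = ≈-refl
    inside (i ∷ K) h = *-cong (θ-in (h (here refl))) (inside K (h ∘ there))

-- The restriction ρ respects the relations.

module Restriction {n : ℕ} (M : Matroid n) (P : Subset n → Bool) (filter : IsOrderFilter M P)
                   (Z : Subset n) (maxZ : MaximalOutside M P Z) where
  open Contraction M P filter Z maxZ
  open CommutativeRing (Presented.ring (Ungraded (GenZ M Z))) renaming (refl to ≈-refl; sym to ≈-sym; trans to ≈-trans)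
  open Models (Presented.ring (Ungraded (GenZ M Z))) M
  open import Algebra.Properties.Group +-group using (x∙y⁻¹≈ε⇒x≈y)

  private
    GZ : Expr (List (VarZ M Z)) → Set
    GZ = Ungraded (GenZ M Z)

    form : Fin n → Carrier
    form i = ungrade (linFormZ M Z i)

    z : VarZ M Z → Carrier
    z v = gen (v ∷ [])

    zero-by : ∀ {a b : Carrier} → a ≡ 𝟘 → a * b ≈ 0#
    zero-by {b = b} refl = zeroˡ b

    zero-by′ : ∀ {a b : Carrier} → b ≡ 𝟘 → a * b ≈ 0#
    zero-by′ {a} refl = zeroʳ a

    form-≈ : ∀ {i j} → i ∉ Z → j ∉ Z → form i ≈ form j
    form-≈ {i} {j} i∉Z j∉Z with i Finₚ.≟ j
    ... | yes refl = ≈-refl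
    ... | no i≢j = x∙y⁻¹≈ε⇒x≈y _ _ (subst (_≈ 0#) (bind-gen (form i ⊕ ⊝ form j))
            (≈rel (Presented.ideal [] (ungraded (linear i j i∉Z j∉Z i≢j)))))

    ρ-term : ∀ b F → term P (λ v → ρ (inj₂ v)) b F ≈ term (zFlatᵇ M Z) z b F
    ρ-term b F with T⊎ (b F)
    ... | inj₂ ¬u = ≈-trans (reflexive (term-false P _ b ¬u)) (≈-sym (reflexive (term-false (zFlatᵇ M Z) z b ¬u)))
    ... | inj₁ u with T⊎ (P F)
    ... | inj₂ ¬p = ≈-trans (reflexive (term-out P _ b ¬p))
                      (≈-sym (reflexive (term-out (zFlatᵇ M Z) z b (λ q → ¬p (proj₂ (zFlat⁻ q))))))
    ... | inj₁ p with Z Subₚ.⊆? F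
    ... | yes Z⊆F = ≈-trans (reflexive (≡.trans (term-in P _ b p u) (ρ-above p (zFlat⁺ p Z⊆F))))
                      (≈-sym (reflexive (term-in (zFlatᵇ M Z) z b (zFlat⁺ p Z⊆F) u)))
    ... | no Z⊈F = ≈-trans (reflexive (≡.trans (term-in P _ b p u) (ρ-not-above p Z⊈F)))
                      (≈-sym (reflexive (term-out (zFlatᵇ M Z) z b (λ q → Z⊈F (proj₁ (zFlat⁻ q))))))

    ρ-through : ∀ i → through P (λ v → ρ (inj₂ v)) i ≈ form i
    ρ-through i = ≈-trans (over-cong (allSubsets {0} n) (ρ-term (λ F → lookup F i)))
      (≈-trans (≈-sym (ev-linFormZ Z z i)) (ev-var GZ (form i)))

    form-total : ∀ {i} → i ∈ Z → form i ≈ ungrade (totalZ M Z)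
    form-total {i} i∈Z = ≈-trans (≈-sym (≈-trans (≈-sym (ev-linFormZ Z z i)) (ev-var GZ (form i))))
      (≈-trans (through-total (Presented.ring (Ungraded (GenZ M Z))) z i∈Z) (≈-trans (≈-sym (ev-total Z z)) (ev-var GZ (ungrade (totalZ M Z)))))

  -- All linear forms restrict to the form of `j₀`: outside `Z` by the linear relations of A(M_Z),
  -- inside `Z` because `β` is that form minus the total. A product relation has a factor outside
  -- `Z`, which goes to zero.
  ρ-model : IsModel P ρ
  ρ-model = record
    { isPreModel = record
      { incomp-zero = incomp-ρ
      ; outside-zero = outside-ρ
      ; linear-eq = λ i j → ≈-trans (value i) (≈-sym (value j)) }
    ; indep-zero = indep-ρ }
    where
    incomp-ρ : ∀ {F₁ F₂} (p₁ : T (P F₁)) (p₂ : T (P F₂)) → T (incomparableᵇ F₁ F₂) →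
               ρ (inj₂ (F₁ , p₁)) * ρ (inj₂ (F₂ , p₂)) ≈ 0#
    incomp-ρ {F₁} {F₂} p₁ p₂ u with Z Subₚ.⊆? F₁ | Z Subₚ.⊆? F₂
    ... | no Z⊈F | _ = zero-by {b = ρ (inj₂ (F₂ , p₂))} (ρ-not-above p₁ Z⊈F)
    ... | yes _ | no Z⊈F = zero-by′ {a = ρ (inj₂ (F₁ , p₁))} (ρ-not-above p₂ Z⊈F)
    ... | yes Z⊆F₁ | yes Z⊆F₂ = ≡.subst₂ (λ a b → a * b ≈ 0#)
          (sym (ρ-above p₁ (zFlat⁺ p₁ Z⊆F₁))) (sym (ρ-above p₂ (zFlat⁺ p₂ Z⊆F₂)))
          (≈rel (Presented.ideal [] (ungraded (incomp _ _ u))))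

    outside-ρ : ∀ {i F} (p : T (P F)) → i ∉ F → ρ (inj₁ i) * ρ (inj₂ (F , p)) ≈ 0#
    outside-ρ {i} {F} p i∉F with i Subₚ.∈? Z
    ... | yes i∈Z = zero-by′ {a = ρ (inj₁ i)} (ρ-not-above p (λ Z⊆F → i∉F (Z⊆F i∈Z)))
    ... | no i∉Z = zero-by {b = ρ (inj₂ (F , p))} (if-∉ i∉Z)

    indep-ρ : ∀ {I} → Independent M I → T (P (cl M (toSet I))) ⊎ cl M (toSet I) ≡ ⊤ → prod (λ i → ρ (inj₁ i)) I ≈ 0#
    indep-ρ {I} _ c = vanish (leaves-Z {I} c)
      where
      vanish : (∃ λ j → j ∈ˡ I × j ∉ Z) → prod (λ i → ρ (inj₁ i)) I ≈ 0#
      vanish (j , j∈I , j∉Z) = prod-zero (λ i → ρ (inj₁ i)) (reflexive (if-∉ j∉Z)) j∈I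

    value : ∀ i → linearValue P ρ i ≈ form j₀
    value i with i Subₚ.∈? Z
    ... | no i∉Z = ≈-trans (+-cong (reflexive (if-∉ i∉Z)) (ρ-through i)) (≈-trans (+-identityˡ _) (form-≈ i∉Z j₀∉Z))
    ... | yes i∈Z = ≈-trans (+-cong (reflexive (if-∈ i∈Z)) (≈-trans (ρ-through i) (form-total i∈Z)))
            (≈-trans (+-assoc _ _ _) (≈-trans (+-cong ≈-refl (-‿inverseˡ (ungrade (totalZ M Z)))) (+-identityʳ _)))

-- The product ring and the ideal generated there.

module _ (C D : CommutativeRing 0ℓ 0ℓ) where
  private
    module C = CommutativeRing C
    module D = CommutativeRing D
    module EC = Evaluation C
    module ED = Evaluation D
    module E = Evaluation (DirectProduct.commutativeRing C D)

  product-lin : {X : Set} (f : X → C.Carrier × D.Carrier) (e : Expr X) →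
                E.lin f e ≡ (EC.lin (λ x → proj₁ (f x)) e , ED.lin (λ x → proj₂ (f x)) e)
  product-lin f (gen x) = refl
  product-lin f 𝟘 = refl
  product-lin f (a ⊕ b) rewrite product-lin f a | product-lin f b = refl
  product-lin f (⊝ a) rewrite product-lin f a = refl

  product-prod : {V : Set} (f : V → C.Carrier × D.Carrier) (l : List V) →
                 E.prod f l ≡ (EC.prod (λ v → proj₁ (f v)) l , ED.prod (λ v → proj₂ (f v)) l)
  product-prod f [] = refl
  product-prod f (v ∷ l) rewrite product-prod f l = refl

  product-ev : {V : Set} (f : V → C.Carrier × D.Carrier) (e : Expr (List V)) →
               (proj₁ (E.ev f e) C.≈ EC.ev (λ v → proj₁ (f v)) e) × (proj₂ (E.ev f e) D.≈ ED.ev (λ v → proj₂ (f v)) e)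
  product-ev f e rewrite product-lin (E.prod f) e =
    EC.lin-cong (λ l → C.reflexive (cong proj₁ (product-prod f l))) e ,
    ED.lin-cong (λ l → D.reflexive (cong proj₂ (product-prod f l))) e

module Lowest {V W : Set} (G : Expr (List W) → Set) (ρ : V → Expr (List W)) where
  open Polynomial G
  private
    module Q = CommutativeRing (Presented.ring G)
    module Q[t] = CommutativeRing (Presented.ring (Polynomial.Constant G))
    module EQ = Evaluation (Presented.ring G)
    module EQ[t] = Evaluation (Presented.ring (Polynomial.Constant G))

  -- Expresses that the constant term of `b` is ρ(a). The cofactor `w` makes the property pass to
  -- products using only the formulas for multiplication by a constant and by `X`.
  IsLowest : Expr (List V) → Expr (List (Maybe W)) → Set
  IsLowest a b = ∀ w → coeff 0 (b Q[t].* w) Q.≈ EQ.ev ρ a Q.* coeff 0 w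

  lowest-const : ∀ v → IsLowest (gen (v ∷ [])) (const (ρ v))
  lowest-const v w = Q.trans {j = ρ v Q.* coeff 0 w} (coeff-const 0 (ρ v) w)
    (Q.*-cong {ρ v} {ρ v Q.* gen []} {coeff 0 w} {coeff 0 w} (Q.sym (Q.*-identityʳ (ρ v))) Q.refl)

  lowest-X : IsLowest 𝟘 X
  lowest-X w = coeff-X-zero w

  lowest-linear : ∀ v → IsLowest (gen (v ∷ []) ⊕ ⊝ 𝟘) (const (ρ v) ⊕ ⊝ X)
  lowest-linear v w = Q.+-cong (lowest-const v w) (Q.-‿cong (lowest-X w))

  lowest-prod : {U : Set} (α : U → Expr (List V)) (β : U → Expr (List (Maybe W))) → (∀ u → IsLowest (α u) (β u)) →
                ∀ us → coeff 0 (EQ[t].prod β us) Q.≈ EQ.prod (λ u → EQ.ev ρ (α u)) us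
  lowest-prod α β h [] = Q.refl {gen []}
  lowest-prod α β h (u ∷ us) = Q.trans (h u (EQ[t].prod β us))
    (Q.*-cong {EQ.ev ρ (α u)} {EQ.ev ρ (α u)} Q.refl (lowest-prod α β h us))

-- If every relation of U maps under θ to zero or to (c , (b − X)^k), then so does the whole ideal, up to
-- multiples of the form (c·h(0) , (b − X)^k·h). As b − X is monic up to sign, the degree in X decides whether h = 0.
module Division {V W U I : Set} (GV : Expr (List V) → Set) (GW : Expr (List W) → Set) (GU : Expr (List U) → Set)
  (ρ : V → Expr (List W)) (lift : W → V) (θ : U → Expr (List V) × Expr (List (Maybe W)))
  (c : Expr (List V)) (b : Expr (List W)) (is : List I) where
  open Polynomial GW
  open Lowest GW ρ
  private
    module R = CommutativeRing (Presented.ring GV)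
    module Q = CommutativeRing (Presented.ring GW)
    module Q[t] = CommutativeRing (Presented.ring (Polynomial.Constant GW))
    module D = CommutativeRing (DirectProduct.commutativeRing (Presented.ring GV) (Presented.ring (Polynomial.Constant GW)))
    module ER = Evaluation (Presented.ring GV)
    module EQ = Evaluation (Presented.ring GW)
    module EQ[t] = Evaluation (Presented.ring (Polynomial.Constant GW))
    module ED = Evaluation (DirectProduct.commutativeRing (Presented.ring GV) (Presented.ring (Polynomial.Constant GW)))

    x : V → Expr (List V)
    x v = gen (v ∷ [])

    ψ : W → Expr (List V)
    ψ w = x (lift w)

  module _ (lowest-θ : ∀ u → IsLowest (proj₁ (θ u)) (proj₂ (θ u)))
    (c-resp : ∀ {a a′} → a Q.≈ a′ → c R.* ER.ev ψ a R.≈ c R.* ER.ev ψ a′)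
    (c-contract : ∀ e → c R.* ER.ev x e R.≈ c R.* ER.ev ψ (EQ.ev ρ e))
    (relation : ∀ {g} → GU g → (ED.ev θ g D.≈ D.0#) ⊎ (ED.ev θ g D.≈ (c , power b is))) where

    Multiple : D.Carrier → Set
    Multiple (a , p) = ∃ λ h → (a R.≈ c R.* ER.ev ψ (coeff 0 h)) × (p Q[t].≈ power b is Q[t].* h)

    multiple-≈ : ∀ {s s′} → s D.≈ s′ → Multiple s → Multiple s′
    multiple-≈ (p , q) (h , p′ , q′) = h , R.trans (R.sym p) p′ , Q[t].trans (Q[t].sym q) q′

    multiple-0 : Multiple D.0#
    multiple-0 = 𝟘 , R.sym (R.zeroʳ c) , Q[t].sym (Q[t].zeroʳ (power b is))

    multiple-+ : ∀ {s s′} → Multiple s → Multiple s′ → Multiple (s D.+ s′)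
    multiple-+ (h , p , q) (h′ , p′ , q′) = h ⊕ h′ ,
      R.trans (R.+-cong p p′) (R.sym (R.distribˡ c (ER.ev ψ (coeff 0 h)) (ER.ev ψ (coeff 0 h′)))) ,
      Q[t].trans (Q[t].+-cong q q′) (Q[t].sym (Q[t].distribˡ (power b is) h h′))

    multiple-neg : ∀ {s} → Multiple s → Multiple (D.- s)
    multiple-neg (h , p , q) = ⊝ h , R.trans (R.-‿cong p) (RP.-‿distribʳ-* c (ER.ev ψ (coeff 0 h))) ,
        Q[t].trans (Q[t].-‿cong q) (QP.-‿distribʳ-* (power b is) h)
      where
      module RP = Algebra.Properties.Ring R.ring
      module QP = Algebra.Properties.Ring Q[t].ring

    private
      α : U → Expr (List V)
      α u = proj₁ (θ u)

      β : U → Expr (List (Maybe W))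
      β u = proj₂ (θ u)

      -- By `c-contract` the first component may be replaced by the lift of its restriction, and by
      -- `IsLowest` that restriction is the constant term of the second component.
      c-lowest : ∀ us → c R.* ER.prod α us R.≈ c R.* ER.ev ψ (coeff 0 (EQ[t].prod β us))
      c-lowest us = R.trans (R.*-cong {c} {c} R.refl (R.sym (ev-var GV (ER.prod α us))))
        (R.trans (c-contract (ER.prod α us)) (c-resp (Q.trans (ev-ev GV (Presented.ring GW) ρ α (gen us)) (Q.sym (lowest-prod α β lowest-θ us)))))

      shifted : ∀ us {g} → GU g → Multiple (ED.prod θ us D.* ED.ev θ g)
      shifted us {g} r with relation r
      ... | inj₁ p = multiple-≈ (D.sym (D.trans (D.*-cong {ED.prod θ us} D.refl p) (D.zeroʳ (ED.prod θ us)))) multiple-0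
      ... | inj₂ p = multiple-≈ (D.sym (D.*-cong {ED.prod θ us} D.refl p)) (subst (λ s → Multiple (s D.* (c , power b is)))
              (sym (product-prod (Presented.ring GV) (Presented.ring (Polynomial.Constant GW)) θ us))
              (EQ[t].prod β us , R.trans (R.*-comm (ER.prod α us) c) (c-lowest us) ,
                Q[t].*-comm (EQ[t].prod β us) (power b is)))

    multiple-ev : ∀ {e} → Eq (Presented.Rel GU) e 𝟘 → Multiple (ED.ev θ e)
    multiple-ev {e} p = multiple-≈ (D.trans (D.+-cong {ED.ev θ e} D.refl -0≈0) (D.+-identityʳ (ED.ev θ e)))
        (ED.lin-resp-mod Multiple multiple-≈ multiple-0 multiple-+ multiple-neg ideal-multiple p)
      where
      -0≈0 : D.- D.0# D.≈ D.0#
      -0≈0 = Algebra.Properties.Group.ε⁻¹≈ε D.+-group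
      ideal-multiple : ∀ {e} → Presented.Rel GU e → Multiple (ED.ev θ e)
      ideal-multiple (Presented.perm {l} {m} p) =
        multiple-≈ (D.sym (D.trans (D.+-cong (ED.prod-↭ θ p) D.refl) (D.-‿inverseʳ (ED.prod θ m)))) multiple-0
      ideal-multiple (Presented.ideal us {g} r) = multiple-≈ (D.sym (ED.ev-shift θ us g)) (shifted us r)

    division : ∀ {e} → Eq (Presented.Rel GU) e 𝟘 → (∀ j → length is ≤ j → coeff j (proj₂ (ED.ev θ e)) Q.≈ 𝟘) →
               (proj₁ (ED.ev θ e) R.≈ 𝟘) × (∀ j → coeff j (proj₂ (ED.ev θ e)) Q.≈ 𝟘)
    division {e} p vanish with multiple-ev p
    ... | h , q , q′ =
        R.trans q (R.trans (c-resp (h≈0 0)) (R.zeroʳ c)) ,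
        λ j → Q.trans (coeff-resp j q′) (power-zero b is {h} h≈0 j)
      where
      h≈0 : ∀ j → coeff j h Q.≈ 𝟘
      h≈0 = power-cancel b is h (λ j k≤j → Q.trans (Q.sym (coeff-resp j q′)) (vanish j k≤j))

module Graph {V W : Set} (GV : Expr (List V) → Set) (GW : Expr (List W) → Set) (ρ : V → Expr (List W)) where
  open Polynomial GW
  private
    module R = CommutativeRing (Presented.ring GV)
    module Q = CommutativeRing (Presented.ring GW)
    module Q[t] = CommutativeRing (Presented.ring (Polynomial.Constant GW))
    module D = CommutativeRing (DirectProduct.commutativeRing (Presented.ring GV) (Presented.ring (Polynomial.Constant GW)))
    module ER = Evaluation (Presented.ring GV)
    module EQ = Evaluation (Presented.ring GW)
    module EQ[t] = Evaluation (Presented.ring (Polynomial.Constant GW))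
    module ED = Evaluation (DirectProduct.commutativeRing (Presented.ring GV) (Presented.ring (Polynomial.Constant GW)))

  σ : V → D.Carrier
  σ v = gen (v ∷ []) , const (ρ v)

  τ : D.Carrier
  τ = 𝟘 , X

  σ-kills : EQ.Kills ρ GV → ED.Kills σ GV
  σ-kills kill {g} r = R.trans (proj₁ (product-ev (Presented.ring GV) (Presented.ring (Polynomial.Constant GW)) σ g)) (var-kills GV r) ,
    Q[t].trans (proj₂ (product-ev (Presented.ring GV) (Presented.ring (Polynomial.Constant GW)) σ g)) (Q[t].trans (Q[t].sym (ev-ev GW (Presented.ring (Polynomial.Constant GW)) var ρ g))
      (EQ[t].ev-resp const-kills (kill r)))

  σ*τ≈0 : ∀ v → ρ v ≡ 𝟘 → σ v D.* τ D.≈ D.0#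
  σ*τ≈0 v p = R.zeroʳ (gen (v ∷ [])) , subst (λ a → const a Q[t].* X Q[t].≈ 𝟘) (sym p) (Q[t].zeroˡ X)

  -- `is` is the basis in a given relation, `js` a fixed one. The second component depends only on
  -- the length, as `ρ` is constant on the x_i with `i` in `Z`; the first is matched by a hypothesis
  -- that `prod-basis` later supplies.
  σ-τ-prod : ∀ {I J : Set} (f : I → V) b (is : List I) (js : List J) {c} →
             (∀ {i} → i ∈ˡ is → ρ (f i) ≡ b) → length is ≡ length js → ER.prod (λ i → gen (f i ∷ [])) is R.≈ c →
             ED.prod (λ i → σ (f i) D.+ D.- τ) is D.≈ (c , power b js)
  σ-τ-prod f b is js {c} ρ≡b len p = subst (D._≈ (c , power b js)) (sym (product-prod (Presented.ring GV) (Presented.ring (Polynomial.Constant GW)) _ is))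
      (R.trans (ER.prod-cong (λ i → R.trans (R.+-cong {gen (f i ∷ [])} R.refl -0≈0) (R.+-identityʳ (gen (f i ∷ [])))) is) p ,
       subst (Q[t]._≈ power b js) (sym (second is js ρ≡b len)) Q[t].refl)
    where
    -0≈0 : ⊝ 𝟘 R.≈ 𝟘
    -0≈0 = Algebra.Properties.Group.ε⁻¹≈ε R.+-group
    second : ∀ is js → (∀ {i} → i ∈ˡ is → ρ (f i) ≡ b) → length is ≡ length js →
             EQ[t].prod (λ i → const (ρ (f i)) ⊕ ⊝ X) is ≡ power b js
    second [] [] h q = refl
    second (i ∷ is) (j ∷ js) h q = cong₂ Q[t]._*_ (cong (λ a → const a ⊕ ⊝ X) (h (here refl)))
      (second is js (h ∘ there) (ℕₚ.suc-injective q))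

  open Algebra.Properties.Semiring.Exp D.semiring using (_^_)

  private
    one : Expr (List (Maybe W))
    one = gen []

    coeff-const-zero : ∀ a → coeff 0 (const a) Q.≈ a
    coeff-const-zero a = Q.trans (coeff-resp 0 (Q[t].sym (Q[t].*-identityʳ (const a))))
      (Q.trans (coeff-const 0 a one) (Q.*-identityʳ a))

    coeff-const-suc : ∀ j a → coeff (suc j) (const a) Q.≈ 𝟘
    coeff-const-suc j a = Q.trans (coeff-resp (suc j) (Q[t].sym (Q[t].*-identityʳ (const a))))
      (Q.trans (coeff-const (suc j) a one) (Q.zeroʳ a))

    prod-const : ∀ {U : Set} (g : U → Expr (List W)) l → EQ[t].prod (λ u → const (g u)) l Q[t].≈ const (EQ.prod g l)
    prod-const g l = Q[t].sym (ev-ev GW (Presented.ring (Polynomial.Constant GW)) var g (gen l))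

  σ-prod₁ : ∀ l → proj₁ (ED.prod σ l) R.≈ gen l
  σ-prod₁ l = R.trans (R.reflexive (cong proj₁ (product-prod (Presented.ring GV) (Presented.ring (Polynomial.Constant GW)) σ l))) (ev-var GV (gen l))

  σ-prod₂ : ∀ j l → coeff (suc j) (proj₂ (ED.prod σ l)) Q.≈ 𝟘
  σ-prod₂ j l = Q.trans (Q.reflexive (cong (λ s → coeff (suc j) (proj₂ s)) (product-prod (Presented.ring GV) (Presented.ring (Polynomial.Constant GW)) σ l)))
    (Q.trans (coeff-resp (suc j) (prod-const ρ l)) (coeff-const-suc j (EQ.prod ρ l)))

  -- `τ` is zero in the first component. As p ≥ 1 in every Ψ-summand, only the Φ-summand is visible
  -- there.
  τ-power₁ : ∀ p s → proj₁ (τ ^ suc p D.* s) R.≈ 𝟘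
  τ-power₁ p s = R.trans (R.*-cong (R.zeroˡ (proj₁ (τ ^ p))) (R.refl {proj₁ s})) (R.zeroˡ (proj₁ s))

  module _ (f : W → V) (ρ-f : ∀ w → ρ (f w) ≡ gen (w ∷ [])) where
    private
      lifted : List W → D.Carrier
      lifted l = ED.prod (λ w → σ (f w)) l

      lifted₂ : ∀ l → proj₂ (lifted l) Q[t].≈ const (gen l)
      lifted₂ l = Q[t].trans (Q[t].reflexive (cong proj₂ (product-prod (Presented.ring GV) (Presented.ring (Polynomial.Constant GW)) (λ w → σ (f w)) l)))
        (Q[t].trans (EQ[t].prod-cong (λ w → Q[t].reflexive (cong const (ρ-f w))) l)
        (Q[t].trans (prod-const (λ w → gen (w ∷ [])) l)
          (EQ[t].ev-resp const-kills (ev-var GW (gen l)))))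

      unfold : ∀ p l j → coeff j (proj₂ (τ ^ suc p D.* lifted l)) Q.≈ coeff j (X Q[t].* proj₂ (τ ^ p D.* lifted l))
      unfold p l j = coeff-resp j (Q[t].*-assoc X (proj₂ (τ ^ p)) (proj₂ (lifted l)))

      base : ∀ l j → coeff j (proj₂ (τ ^ 0 D.* lifted l)) Q.≈ coeff j (const (gen l))
      base l j = coeff-resp j (Q[t].trans (Q[t].*-identityˡ (proj₂ (lifted l))) (lifted₂ l))

    -- The exponent shows up as the degree in X, which separates the summands with different `p`.
    τ-power-coeff : ∀ p l → coeff p (proj₂ (τ ^ p D.* lifted l)) Q.≈ gen l
    τ-power-coeff zero l = Q.trans (base l 0) (coeff-const-zero (gen l))
    τ-power-coeff (suc p) l = Q.trans (unfold p l (suc p))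
      (Q.trans (coeff-X-suc p (proj₂ (τ ^ p D.* lifted l))) (τ-power-coeff p l))

    τ-power-coeff-≢ : ∀ p l {j} → j ≢ p → coeff j (proj₂ (τ ^ p D.* lifted l)) Q.≈ 𝟘
    τ-power-coeff-≢ zero l {zero} q = contradiction refl q
    τ-power-coeff-≢ zero l {suc j} q = Q.trans (base l (suc j)) (coeff-const-suc j (gen l))
    τ-power-coeff-≢ (suc p) l {zero} q = Q.trans (unfold p l 0) (coeff-X-zero (proj₂ (τ ^ p D.* lifted l)))
    τ-power-coeff-≢ (suc p) l {suc j} q = Q.trans (unfold p l (suc j))
      (Q.trans (coeff-X-suc j (proj₂ (τ ^ p D.* lifted l))) (τ-power-coeff-≢ p l (q ∘ cong suc)))

-- The homomorphism to the product ring.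

module Kernel {n : ℕ} (M : Matroid n) (P : Subset n → Bool) (filter : IsOrderFilter M P)
              (Z : Subset n) (maxZ : MaximalOutside M P Z) where
  open Pullback M P filter Z maxZ
  open Restriction M P filter Z maxZ using (ρ-model)

  open Graph (Ungraded (GenP M P)) (Ungraded (GenZ M Z)) ρ public
  open Polynomial (Ungraded (GenZ M Z)) using (coeff; power) public
  open Lowest (Ungraded (GenZ M Z)) ρ

  module R = CommutativeRing (Presented.ring (Ungraded (GenP M P)))
  module Q = CommutativeRing (Presented.ring (Ungraded (GenZ M Z)))
  module D = CommutativeRing (DirectProduct.commutativeRing (Presented.ring (Ungraded (GenP M P))) (Presented.ring (Polynomial.Constant (Ungraded (GenZ M Z)))))
  module ER = Evaluation (Presented.ring (Ungraded (GenP M P)))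
  module ED = Evaluation (DirectProduct.commutativeRing (Presented.ring (Ungraded (GenP M P))) (Presented.ring (Polynomial.Constant (Ungraded (GenZ M Z)))))

  σ-model : Models.IsModel (DirectProduct.commutativeRing (Presented.ring (Ungraded (GenP M P))) (Presented.ring (Polynomial.Constant (Ungraded (GenZ M Z))))) M P σ
  σ-model = Models.kills⇒model
    (DirectProduct.commutativeRing (Presented.ring (Ungraded (GenP M P))) (Presented.ring (Polynomial.Constant (Ungraded (GenZ M Z)))))
    M P (σ-kills (Models.model⇒kills (Presented.ring (Ungraded (GenZ M Z))) M P ρ-model))

  open Pushforward M P filter Z maxZ (DirectProduct.commutativeRing (Presented.ring (Ungraded (GenP M P))) (Presented.ring (Polynomial.Constant (Ungraded (GenZ M Z))))) σ σ-model τ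
    (λ {i} i∉Z → σ*τ≈0 (inj₁ i) (if-∉ i∉Z))
    (λ {F} p Z⊈F → D.trans (D.*-comm τ (σ (inj₂ (F , p)))) (σ*τ≈0 (inj₂ (F , p)) (ρ-not-above p Z⊈F)))
    public using (θ; η-θ; θ-new; θ-cases; relation-θ)

  x-model : Models.IsModel (Presented.ring (Ungraded (GenP M P))) M P (λ v → gen (v ∷ []))
  x-model = Models.kills⇒model (Presented.ring (Ungraded (GenP M P))) M P (var-kills (Ungraded (GenP M P)))

  open BasisProduct M P filter Z maxZ (Presented.ring (Ungraded (GenP M P))) (λ v → gen (v ∷ [])) x-model using (y; prod-basis; basis-resp; basis-contract)

  module _ {I : List (Fin n)} (I-basis : Basis I) where
    relation : ∀ {g} → Ungraded (GenP M P⁺) g → ED.ev θ g D.≈ D.0# ⊎ ED.ev θ g D.≈ (ER.prod y I , power β I)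
    relation {g} r = Sum.map₂ (λ (J , B , p) →
      D.trans {ED.ev θ g} {ED.prod (λ i → σ (inj₁ i) D.+ D.- τ) J} {ER.prod y I , power β I} p
        (σ-τ-prod inj₁ β J I (λ i∈J → if-∈ (basis⊆Z B i∈J))
          (≡.trans (basis-length B) (sym (basis-length I-basis))) (prod-basis B I-basis))) (relation-θ r)

    Low : D.Carrier → Set
    Low (a , b) = IsLowest a b

    lowest-θ : ∀ v → Low (θ v)
    lowest-θ = θ-cases {Low} lowest-const lowest-linear lowest-X

    division : ∀ {e} → Eq (Presented.Rel (Ungraded (GenP M P⁺))) e 𝟘 →
               (∀ j → length I ≤ j → coeff j (proj₂ (ED.ev θ e)) Q.≈ 𝟘) →
               (proj₁ (ED.ev θ e) R.≈ 𝟘) × (∀ j → coeff j (proj₂ (ED.ev θ e)) Q.≈ 𝟘)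
    division = Division.division (Ungraded (GenP M P)) (Ungraded (GenZ M Z)) (Ungraded (GenP M P⁺))
      ρ lift θ (ER.prod y I) β I lowest-θ (basis-resp I-basis) (basis-contract I-basis) relation

-- Values of Φ ⊕ ⨁ Ψ.

module Values {n : ℕ} (M : Matroid n) (P : Subset n → Bool) (filter : IsOrderFilter M P)
              (Z : Subset n) (maxZ : MaximalOutside M P Z)
              (C : CommutativeRing 0ℓ 0ℓ) (f : Var M (P₊ M Z P) → CommutativeRing.Carrier C) where
  open CommutativeRing C renaming (refl to ≈-refl; sym to ≈-sym; trans to ≈-trans)
  open Pullback M P filter Z maxZ
  open Models C M
  open import Algebra.Properties.Semiring.Exp semiring using (_^_; ^-congˡ)

  value : ∀ {q} → SumGen M Z P q → Carrier
  value (inj₁ m) = prod (η C f) (toList m)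
  value (inj₂ (p , _ , _ , _ , _ , m)) = t C f ^ p * prod (ψ⁺ C f) (toList m)

  ev-ΦΨ : ∀ {q} (s : SumGen M Z P q) → ev f (ungrade (ΦΨ M Z P q s)) ≈ value s
  ev-ΦΨ (inj₁ m) = ev-Φ C f m
  ev-ΦΨ (inj₂ (p , k , h₁ , h₂ , refl , m)) = ev-Ψ C f p m

  ev-bind : ∀ {X : Set} {d} (h : X → Expr (Vec (Var M P⁺) d)) (e : Expr X) →
            ev f (ungrade (bind h e)) ≈ lin (λ u → ev f (ungrade (h u))) e
  ev-bind h e = ≈-trans (reflexive (cong (ev f) (bind-bind _ h e))) (reflexive (lin-bind (prod f) _ e))

  ev-bind-ΦΨ : ∀ {q} (a : Expr (SumGen M Z P q)) → ev f (ungrade (bind (ΦΨ M Z P q) a)) ≈ lin value a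
  ev-bind-ΦΨ {q} a = ≈-trans (ev-bind (ΦΨ M Z P q) a) (lin-cong ev-ΦΨ a)

  module _ (model : IsModel P⁺ f) where
    open PullbackModel M P filter Z maxZ C f model

    value-rel : ∀ {q e} → SumRel M Z P q e → lin value e ≈ 0#
    value-rel (left {e} r) = ≈-trans (reflexive (lin-bind value _ e))
      (≈-trans (≈-sym (ev-ungrade (η C f) e)) (ev-resp (model⇒kills P η-model) (ungrade-rel r)))
    -- Since p ≥ 1, one factor x_Z can be set aside for `t-resp`; the remaining power then
    -- multiplies zero.
    value-rel (right (suc p) k h₁ h₂ h₃ {e} r) = ≈-trans (reflexive (lin-bind value _ e))
      (≈-trans (≈-sym (lin-*ˡ (λ m → prod (ψ⁺ C f) (toList m)) (t C f ^ suc p) e))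
      (≈-trans (*-cong (*-comm _ _) (≈-sym (ev-ungrade (ψ⁺ C f) e)))
      (≈-trans (*-assoc _ _ _) (≈-trans (*-cong ≈-refl (≈-trans (t-resp (ungrade-rel r)) (zeroʳ _))) (zeroʳ _)))))

-- Components in the direct sum.

module Components {n : ℕ} (M : Matroid n) (P : Subset n → Bool) (Z : Subset n) (q : ℕ) where
  S : Set
  S = SumGen M Z P q

  _∼_ : Expr S → Expr S → Set
  _∼_ = Eq (SumRel M Z P q)

  left-gen : S → Expr (Vec (Var M P) q)
  left-gen (inj₁ m) = gen m
  left-gen (inj₂ _) = 𝟘

  -- The degree `k` varies with the generator, so components are collected as list monomials in the
  -- ungraded ring.
  right-gen : ℕ → S → Expr (List (VarZ M Z))
  right-gen j (inj₁ _) = 𝟘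
  right-gen j (inj₂ (p , _ , _ , _ , _ , m)) with p ℕₚ.≟ j
  ... | yes _ = gen (toList m)
  ... | no _  = 𝟘

  placeᴸ : Expr (Vec (Var M P) q) → Expr S
  placeᴸ = bind (λ m → gen (inj₁ m))

  place-at : ∀ p k → 1 ≤ p → p ≤ rk M Z ∸ 1 → p +ℕ k ≡ q → List (VarZ M Z) → Expr S
  place-at p k h₁ h₂ h₃ l = bind (λ m → gen (inj₂ (p , k , h₁ , h₂ , h₃ , m))) (monomial k l)

  -- The value `𝟘` is the default when `p` indexes no summand.
  place-gen : ℕ → List (VarZ M Z) → Expr S
  place-gen p l with 1 ℕₚ.≤? p | p ℕₚ.≤? rk M Z ∸ 1 | p ℕₚ.≤? q
  ... | yes h₁ | yes h₂ | yes h = place-at p (q ∸ p) h₁ h₂ (ℕₚ.m+[n∸m]≡n h) l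
  ... | _ | _ | _ = 𝟘

  placeᴿ : ℕ → Expr (List (VarZ M Z)) → Expr S
  placeᴿ p = bind (place-gen p)

  place-at-irrelevant : ∀ p {k k′} {h₁ h₁′ h₂ h₂′} (h₃ : p +ℕ k ≡ q) (h₃′ : p +ℕ k′ ≡ q) l →
                        place-at p k h₁ h₂ h₃ l ≡ place-at p k′ h₁′ h₂′ h₃′ l
  place-at-irrelevant p {k} {k′} {h₁} {h₁′} {h₂} {h₂′} h₃ h₃′ l
    with ℕₚ.+-cancelˡ-≡ p k k′ (≡.trans h₃ (sym h₃′))
  ... | refl rewrite ℕₚ.≤-irrelevant h₁ h₁′ | ℕₚ.≤-irrelevant h₂ h₂′ | ℕₚ.≡-irrelevant h₃ h₃′ = refl

  place-gen-≡ : ∀ p {k} h₁ h₂ (h₃ : p +ℕ k ≡ q) (m : Vec (VarZ M Z) k) →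
                place-gen p (toList m) ≡ gen (inj₂ (p , k , h₁ , h₂ , h₃ , m))
  place-gen-≡ p {k} h₁ h₂ h₃ m with 1 ℕₚ.≤? p | p ℕₚ.≤? rk M Z ∸ 1 | p ℕₚ.≤? q
  ... | no ¬h | _ | _ = contradiction h₁ ¬h
  ... | yes _ | no ¬h | _ = contradiction h₂ ¬h
  ... | yes _ | yes _ | no ¬h = contradiction (ℕₚ.≤-trans (ℕₚ.m≤m+n p k) (ℕₚ.≤-reflexive h₃)) ¬h
  ... | yes _ | yes _ | yes h = ≡.trans (place-at-irrelevant p (ℕₚ.m+[n∸m]≡n h) h₃ (toList m))
          (cong (bind (λ m → gen (inj₂ (p , k , h₁ , h₂ , h₃ , m)))) (monomial-toList m))

  place-gen-≢ : ∀ p l → p +ℕ length l ≢ q → place-gen p l ≡ 𝟘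
  place-gen-≢ p l ≢q with 1 ℕₚ.≤? p | p ℕₚ.≤? rk M Z ∸ 1 | p ℕₚ.≤? q
  ... | no _ | _ | _ = refl
  ... | yes _ | no _ | _ = refl
  ... | yes _ | yes _ | no _ = refl
  ... | yes h₁ | yes h₂ | yes h = cong (bind (λ m → gen (inj₂ (p , q ∸ p , h₁ , h₂ , ℕₚ.m+[n∸m]≡n h , m))))
          (monomial-length (q ∸ p) l λ len → ≢q (≡.trans (cong (p +ℕ_) len) (ℕₚ.m+[n∸m]≡n h)))

  placeᴸ-resp : ∀ {a} → Eq (A M P q) a 𝟘 → placeᴸ a ∼ 𝟘
  placeᴸ-resp = bind-resp (SumRel M Z P q) _ (λ r → ≈rel (left r))

  placeᴿ-resp : ∀ p {a} → Eq (Presented.Rel (Ungraded (GenZ M Z))) a 𝟘 → placeᴿ p a ∼ 𝟘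
  placeᴿ-resp p {a} a≈0 with 1 ℕₚ.≤? p | p ℕₚ.≤? rk M Z ∸ 1 | p ℕₚ.≤? q
  ... | no _ | _ | _ = bind-zero (SumRel M Z P q) (λ _ → ≈refl) a
  ... | yes _ | no _ | _ = bind-zero (SumRel M Z P q) (λ _ → ≈refl) a
  ... | yes _ | yes _ | no _ = bind-zero (SumRel M Z P q) (λ _ → ≈refl) a
  ... | yes h₁ | yes h₂ | yes h = subst (_∼ 𝟘) (bind-bind _ (monomial (q ∸ p)) a)
          (bind-resp (SumRel M Z P q) _ (λ r → ≈rel (right p (q ∸ p) h₁ h₂ (ℕₚ.m+[n∸m]≡n h) r))
            (degree-resp (q ∸ p) a≈0))

  -- Reassembles a generator from its left component and its right components of index at most `j`.
  -- At `rk M Z ∸ 1` every summand is included, so vanishing components force a zero expression.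
  pieces : ℕ → S → Expr S
  pieces zero s = placeᴸ (left-gen s)
  pieces (suc j) s = pieces j s ⊕ placeᴿ (suc j) (right-gen (suc j) s)

  x⊕𝟘 : ∀ {x} → (x ⊕ 𝟘) ∼ x
  x⊕𝟘 = ≈trans ≈comm ≈idl

  right-gen-≢ : ∀ {j p k h₁ h₂ h₃ m} → p ≢ j → right-gen j (inj₂ (p , k , h₁ , h₂ , h₃ , m)) ≡ 𝟘
  right-gen-≢ {j} {p} p≢j with p ℕₚ.≟ j
  ... | yes p≡j = contradiction p≡j p≢j
  ... | no _ = refl

  right-gen-≡ : ∀ {p k h₁ h₂ h₃ m} → right-gen p (inj₂ (p , k , h₁ , h₂ , h₃ , m)) ≡ gen (toList m)
  right-gen-≡ {p} with p ℕₚ.≟ p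
  ... | yes _ = refl
  ... | no p≢p = contradiction refl p≢p

  pieces-left : ∀ j m → pieces j (inj₁ m) ∼ gen (inj₁ m)
  pieces-left zero m = ≈refl
  pieces-left (suc j) m = ≈trans (≈cong⊕ (pieces-left j m) ≈refl) x⊕𝟘

  pieces-below : ∀ j {p k h₁ h₂ h₃ m} → j < p → pieces j (inj₂ (p , k , h₁ , h₂ , h₃ , m)) ∼ 𝟘
  pieces-below zero j<p = ≈refl
  pieces-below (suc j) {p} {k} {h₁} {h₂} {h₃} {m} j<p = ≈trans
    (≈cong⊕ (pieces-below j {p} {k} {h₁} {h₂} {h₃} {m} (ℕₚ.≤-trans (ℕₚ.n≤1+n _) j<p))
      (subst (λ e → placeᴿ (suc j) e ∼ 𝟘) (sym (right-gen-≢ {suc j} {p} {k} {h₁} {h₂} {h₃} {m} (ℕₚ.>⇒≢ j<p))) ≈refl)) x⊕𝟘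

  pieces-from : ∀ j {p k h₁ h₂ h₃ m} → p ≤ j → pieces j (inj₂ (p , k , h₁ , h₂ , h₃ , m)) ∼ gen (inj₂ (p , k , h₁ , h₂ , h₃ , m))
  pieces-from zero {h₁ = h₁} p≤0 = contradiction (ℕₚ.≤-trans h₁ p≤0) λ ()
  pieces-from (suc j) {p} {k} {h₁} {h₂} {h₃} {m} p≤1+j with p ℕₚ.≤? j
  ... | yes p≤j = ≈trans (≈cong⊕ (pieces-from j {p} {k} {h₁} {h₂} {h₃} {m} p≤j)
          (subst (λ e → placeᴿ (suc j) e ∼ 𝟘) (sym (right-gen-≢ {suc j} {p} {k} {h₁} {h₂} {h₃} {m} (ℕₚ.<⇒≢ (s≤s p≤j)))) ≈refl)) x⊕𝟘
  ... | no p≰j with ℕₚ.≤-antisym p≤1+j (ℕₚ.≰⇒> p≰j)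
  ... | refl = ≈trans (≈cong⊕ (pieces-below j {suc j} {k} {h₁} {h₂} {h₃} {m} ℕₚ.≤-refl)
          (≡.subst₂ (λ e e′ → placeᴿ (suc j) e ∼ e′) (sym (right-gen-≡ {suc j} {k} {h₁} {h₂} {h₃} {m}))
            (place-gen-≡ (suc j) h₁ h₂ h₃ m) ≈refl)) ≈idl

  pieces-∼ : ∀ s → pieces (rk M Z ∸ 1) s ∼ gen s
  pieces-∼ (inj₁ m) = pieces-left (rk M Z ∸ 1) m
  pieces-∼ (inj₂ (p , k , h₁ , h₂ , h₃ , m)) = pieces-from (rk M Z ∸ 1) {p} {k} {h₁} {h₂} {h₃} {m} h₂

  components-zero : ∀ e → Eq (A M P q) (bind left-gen e) 𝟘 →
                    (∀ j → Eq (Presented.Rel (Ungraded (GenZ M Z))) (bind (right-gen (suc j)) e) 𝟘) → e ∼ 𝟘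
  components-zero e l r = ≈trans (≡.subst (_∼ bind (pieces (rk M Z ∸ 1)) e) (bind-gen e)
      (bind-cong (SumRel M Z P q) (λ s → ≈sym (pieces-∼ s)) e)) (go (rk M Z ∸ 1))
    where
    open Linear (exprGroup (SumRel M Z P q))
    go : ∀ j → bind (pieces j) e ∼ 𝟘
    go zero = subst (_∼ 𝟘) (bind-bind _ left-gen e) (placeᴸ-resp l)
    go (suc j) = ≈trans (≡.subst₂ _∼_ (sym (bind≡lin (SumRel M Z P q) (pieces (suc j)) e))
        (cong₂ _⊕_ (sym (bind≡lin (SumRel M Z P q) (pieces j) e))
          (≡.trans (sym (bind≡lin (SumRel M Z P q) _ e)) (sym (bind-bind (place-gen (suc j)) (right-gen (suc j)) e))))
        (lin-+ (pieces j) (λ s → placeᴿ (suc j) (right-gen (suc j) s)) e))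
      (≈trans (≈cong⊕ (go j) (placeᴿ-resp (suc j) (r j))) x⊕𝟘)

-- Injectivity.

module Injective {n : ℕ} (M : Matroid n) (P : Subset n → Bool) (filter : IsOrderFilter M P)
                 (Z : Subset n) (maxZ : MaximalOutside M P Z) (q : ℕ) where
  open Pullback M P filter Z maxZ
  open Kernel M P filter Z maxZ
  open Components M P Z q
  open Values M P filter Z maxZ (DirectProduct.commutativeRing (Presented.ring (Ungraded (GenP M P))) (Presented.ring (Polynomial.Constant (Ungraded (GenZ M Z))))) θ
  open Algebra.Properties.Semiring.Exp D.semiring using (_^_; ^-congˡ)
  open Polynomial (Ungraded (GenZ M Z)) using (coeff-resp; coeff-lin)

  private
    module EQ = Evaluation (Presented.ring (Ungraded (GenZ M Z)))

    lift-ρ : ∀ v → ρ (lift v) ≡ gen (v ∷ [])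
    lift-ρ (F , z) = ρ-above (proj₂ (zFlat⁻ z)) z

  target : S → D.Carrier
  target (inj₁ m) = ED.prod σ (toList m)
  target (inj₂ (p , _ , _ , _ , _ , m)) = τ ^ p D.* ED.prod (λ v → σ (lift v)) (toList m)

  value≈target : ∀ s → value s D.≈ target s
  value≈target (inj₁ m) = ED.prod-cong η-θ (toList m)
  value≈target (inj₂ (p , _ , _ , _ , _ , m)) =
    D.*-cong {t (DirectProduct.commutativeRing (Presented.ring (Ungraded (GenP M P))) (Presented.ring (Polynomial.Constant (Ungraded (GenZ M Z))))) θ ^ p}
      {τ ^ p}
      {ED.prod (ψ⁺ (DirectProduct.commutativeRing (Presented.ring (Ungraded (GenP M P))) (Presented.ring (Polynomial.Constant (Ungraded (GenZ M Z))))) θ) (toList m)}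
      {ED.prod (λ v → σ (lift v)) (toList m)}
      (^-congˡ p (θ-new P⁺-new)) (ED.prod-cong (λ v → η-θ (lift v)) (toList m))

  target₁ : ∀ s → proj₁ (target s) R.≈ ungrade (left-gen s)
  target₁ (inj₁ m) = σ-prod₁ (toList m)
  target₁ (inj₂ (suc p , _ , _ , _ , _ , m)) = τ-power₁ p (ED.prod (λ v → σ (lift v)) (toList m))

  target₂ : ∀ j s → coeff (suc j) (proj₂ (target s)) Q.≈ right-gen (suc j) s
  target₂ j (inj₁ m) = σ-prod₂ j (toList m)
  target₂ j s@(inj₂ (p , k , h₁ , h₂ , h₃ , m)) = go (p ℕₚ.≟ suc j)
    where
    go : Dec (p ≡ suc j) → coeff (suc j) (proj₂ (target s)) Q.≈ right-gen (suc j) s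
    go (yes refl) = subst (coeff p (proj₂ (target s)) Q.≈_) (sym (right-gen-≡ {p} {k} {h₁} {h₂} {h₃} {m}))
      (τ-power-coeff lift lift-ρ p (toList m))
    go (no p≢) = subst (coeff (suc j) (proj₂ (target s)) Q.≈_) (sym (right-gen-≢ {suc j} {p} {k} {h₁} {h₂} {h₃} {m} p≢))
      (τ-power-coeff-≢ lift lift-ρ p (toList m) (p≢ ∘ sym))

  -- Ψ-summands have exponent at most rk(Z) - 1, while the Φ-summand sits in exponent 0; the
  -- condition 1 ≤ j keeps the latter away, as the rank is not yet known to be positive.
  target₂-high : ∀ j → 1 ≤ j → rk M Z ≤ j → ∀ s → coeff j (proj₂ (target s)) Q.≈ 𝟘
  target₂-high (suc j) _ _ (inj₁ m) = σ-prod₂ j (toList m)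
  target₂-high j 1≤j rk≤j (inj₂ (p , _ , _ , p≤ , _ , m)) = τ-power-coeff-≢ lift lift-ρ p (toList m)
    (ℕₚ.>⇒≢ (ℕₚ.≤-trans (s≤s p≤) (bound (rk M Z) 1≤j rk≤j)))
    where
    bound : ∀ k {j} → 1 ≤ j → k ≤ j → suc (k ∸ 1) ≤ j
    bound zero h _ = h
    bound (suc k) _ h = h

  module _ (e : Expr S) where
    image : Expr (List (Var M P⁺))
    image = ungrade (bind (ΦΨ M Z P q) e)

    image-θ : ED.ev θ image D.≈ ED.lin target e
    image-θ = D.trans (ev-bind-ΦΨ e) (ED.lin-cong value≈target e)

    image₁ : proj₁ (ED.ev θ image) R.≈ ungrade (bind left-gen e)
    image₁ = R.trans (proj₁ image-θ) (R.trans (R.reflexive (cong proj₁ (product-lin (Presented.ring (Ungraded (GenP M P))) (Presented.ring (Polynomial.Constant (Ungraded (GenZ M Z)))) target e)))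
      (R.trans (ER.lin-cong target₁ e)
        (R.reflexive (sym (≡.trans (bind-bind _ left-gen e) (bind≡lin (Presented.Rel (Ungraded (GenP M P))) _ e))))))

    image₂ : ∀ j → coeff j (proj₂ (ED.ev θ image)) Q.≈ EQ.lin (λ s → coeff j (proj₂ (target s))) e
    image₂ j = Q.trans (coeff-resp j (proj₂ image-θ))
      (Q.reflexive (≡.trans (cong (λ s → coeff j (proj₂ s)) (product-lin (Presented.ring (Ungraded (GenP M P))) (Presented.ring (Polynomial.Constant (Ungraded (GenZ M Z)))) target e))
        (coeff-lin j (λ s → proj₂ (target s)) e)))

    module _ (rk-Z : 1 ≤ rk M Z) {I : List (Fin n)} (I-basis : Basis I)
             (image≈0 : Eq (Presented.Rel (Ungraded (GenP M P⁺))) image 𝟘) where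
      high : ∀ j → length I ≤ j → rk M Z ≤ j
      high j = ℕₚ.≤-trans (ℕₚ.≤-reflexive (sym (basis-length I-basis)))

      divided : (proj₁ (ED.ev θ image) R.≈ 𝟘) × (∀ j → coeff j (proj₂ (ED.ev θ image)) Q.≈ 𝟘)
      -- The image has degree below rk(Z) in X, and rk(Z) is the length of the basis, the exponent
      -- of b - X.
      divided = division I-basis {image} image≈0 λ j I≤j →
        Q.trans (image₂ j) (EQ.lin-zero (target₂-high j (ℕₚ.≤-trans rk-Z (high j I≤j)) (high j I≤j)) e)

      kernel-zero : e ∼ 𝟘
      kernel-zero = components-zero e
        (ungrade-injective (R.trans (R.sym image₁) (proj₁ divided)))
        (λ j → Q.trans (Q.reflexive (bind≡lin (Presented.Rel (Ungraded (GenZ M Z))) (right-gen (suc j)) e))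
          (Q.trans (Q.sym (EQ.lin-cong (target₂ j) e)) (Q.trans (Q.sym (image₂ (suc j))) (proj₂ divided (suc j)))))

-- Well-definedness and surjectivity.

module Surjective {n : ℕ} (M : Matroid n) (P : Subset n → Bool) (filter : IsOrderFilter M P)
                  (Z : Subset n) (maxZ : MaximalOutside M P Z) (q : ℕ) where
  open Pullback M P filter Z maxZ
  open Components M P Z q

  R⁺ : CommutativeRing 0ℓ 0ℓ
  R⁺ = Presented.ring (Ungraded (GenP M P⁺))

  module R⁺ = CommutativeRing R⁺
  module E⁺ = Evaluation R⁺

  f : Var M P⁺ → R⁺.Carrier
  f v = gen (v ∷ [])

  f-model : Models.IsModel R⁺ M P⁺ f
  f-model = Models.kills⇒model R⁺ M P⁺ (var-kills (Ungraded (GenP M P⁺)))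

  open Values M P filter Z maxZ R⁺ f
  open PullbackModel M P filter Z maxZ R⁺ f f-model using (t-contract)
  open Spanning M P filter Z maxZ R⁺ f f-model using (Span; spanning)
  open Algebra.Properties.Semiring.Exp R⁺.semiring using (_^_)

  private
    T₀ : R⁺.Carrier
    T₀ = t R⁺ f

    ΦΨq : S → Expr (Vec (Var M P⁺) q)
    ΦΨq = ΦΨ M Z P q

    Rel⁺ : Expr (Vec (Var M P⁺) q) → Set
    Rel⁺ = A M P⁺ q

  image : ∀ a → ungrade (bind ΦΨq a) R⁺.≈ E⁺.lin value a
  image a = R⁺.trans (R⁺.sym (ev-var (Ungraded (GenP M P⁺)) (ungrade (bind ΦΨq a)))) (ev-bind-ΦΨ a)

  well-defined : ∀ a b → Eq (SumRel M Z P q) a b → Eq Rel⁺ (bind ΦΨq a) (bind ΦΨq b)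
  well-defined a b p = ungrade-injective
    (R⁺.trans (image a) (R⁺.trans (E⁺.lin-resp (value-rel f-model) p) (R⁺.sym (image b))))

  -- Spanning produces inhomogeneous elements, so surjectivity is phrased for the degree-`q` part of
  -- an arbitrary ring element.
  Hit : R⁺.Carrier → Set
  Hit x = ∃ λ a → Eq Rel⁺ (bind ΦΨq a) (degree q x)

  hit-≈ : ∀ {x y} → x R⁺.≈ y → Hit x → Hit y
  hit-≈ p (a , h) = a , ≈trans h (degree-resp q p)

  hit-lin : ∀ {X : Set} (h : X → R⁺.Carrier) (piece : X → Expr S) →
            (∀ u → Eq Rel⁺ (bind ΦΨq (piece u)) (degree q (h u))) → ∀ e → Hit (E⁺.lin h e)
  hit-lin h piece p e = bind piece e ,
    ≡.subst₂ (Eq Rel⁺) (sym (bind-bind ΦΨq piece e))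
      (≡.trans (sym (bind-bind (monomial q) h e)) (cong (degree q) (bind≡lin (Presented.Rel (Ungraded (GenP M P⁺))) h e)))
      (bind-cong Rel⁺ p e)

  monomial-fromList : ∀ {V : Set} (l : List V) → monomial (length l) l ≡ gen (fromList l)
  monomial-fromList l = ≡.trans (cong (monomial (length l)) (sym (toList-fromList l))) (monomial-toList (fromList l))

  -- A monomial of the wrong length contributes zero on both sides.
  left-piece : ∀ l → Eq Rel⁺ (bind ΦΨq (placeᴸ (monomial q l))) (degree q (ungrade (Φ M Z P (fromList l))))
  left-piece l with length l ℕₚ.≟ q
  ... | yes refl = ≡.subst₂ (Eq Rel⁺) (cong (λ e → bind ΦΨq (placeᴸ e)) (sym (monomial-fromList l)))
                     (sym (degree-ungrade (Φ M Z P (fromList l)))) ≈refl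
  ... | no ≢q = ≈trans (subst (λ e → Eq Rel⁺ (bind ΦΨq (placeᴸ e)) 𝟘) (sym (monomial-length q l ≢q)) ≈refl)
                  (≈sym (degree-ungrade-≢ Rel⁺ ≢q (Φ M Z P (fromList l))))

  right-piece : ∀ p → 1 ≤ p → p ≤ rk M Z ∸ 1 → ∀ l →
                Eq Rel⁺ (bind ΦΨq (place-gen p l)) (degree q (ungrade (Ψ M Z P p (fromList l))))
  right-piece p h₁ h₂ l with (p +ℕ length l) ℕₚ.≟ q
  ... | yes refl = ≡.subst₂ (Eq Rel⁺)
          (cong (bind ΦΨq) (sym (≡.trans (cong (place-gen p) (sym (toList-fromList l))) (place-gen-≡ p h₁ h₂ refl (fromList l)))))
          (sym (degree-ungrade (Ψ M Z P p (fromList l)))) ≈refl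
  ... | no ≢q = ≈trans (subst (λ e → Eq Rel⁺ (bind ΦΨq e) 𝟘) (sym (place-gen-≢ p l ≢q)) ≈refl)
                  (≈sym (degree-ungrade-≢ Rel⁺ ≢q (Ψ M Z P p (fromList l))))

  ungrade-Φ : ∀ l → ungrade (Φ M Z P (fromList l)) R⁺.≈ E⁺.prod (η R⁺ f) l
  ungrade-Φ l = subst (λ l′ → ungrade (Φ M Z P (fromList l)) R⁺.≈ E⁺.prod (η R⁺ f) l′) (toList-fromList l)
    (R⁺.trans (R⁺.sym (ev-var (Ungraded (GenP M P⁺)) (ungrade (Φ M Z P (fromList l))))) (ev-Φ R⁺ f (fromList l)))

  ungrade-Ψ : ∀ p l → ungrade (Ψ M Z P p (fromList l)) R⁺.≈ T₀ ^ p R⁺.* E⁺.prod (ψ⁺ R⁺ f) l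
  ungrade-Ψ p l = subst (λ l′ → ungrade (Ψ M Z P p (fromList l)) R⁺.≈ T₀ ^ p R⁺.* E⁺.prod (ψ⁺ R⁺ f) l′) (toList-fromList l)
    (R⁺.trans (R⁺.sym (ev-var (Ungraded (GenP M P⁺)) (ungrade (Ψ M Z P p (fromList l))))) (ev-Ψ R⁺ f p (fromList l)))

  -- For j = 0 the element comes from Φ. For j ≥ 1 one factor x_Z lets Φ(a) be replaced by ψ(ρ(a)),
  -- and the product comes from the Ψ-summand with p = j.
  hit-power : ∀ j → j ≤ rk M Z ∸ 1 → ∀ e → Hit (T₀ ^ j R⁺.* E⁺.ev (η R⁺ f) e)
  hit-power zero _ e = hit-≈ (R⁺.trans (E⁺.lin-cong ungrade-Φ e) (R⁺.sym (R⁺.*-identityˡ (E⁺.ev (η R⁺ f) e))))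
    (hit-lin (λ l → ungrade (Φ M Z P (fromList l))) (λ l → placeᴸ (monomial q l)) left-piece e)
  hit-power (suc j) j< e = hit-≈ (R⁺.trans (E⁺.lin-cong (ungrade-Ψ (suc j)) e′) (R⁺.sym contract))
      (hit-lin (λ l → ungrade (Ψ M Z P (suc j) (fromList l))) (place-gen (suc j)) (right-piece (suc j) (s≤s z≤n) j<) e′)
    where
    e′ : Expr (List (VarZ M Z))
    e′ = Evaluation.ev (Presented.ring (Ungraded (GenZ M Z))) ρ e
    regroup : ∀ x → T₀ ^ suc j R⁺.* x R⁺.≈ T₀ ^ j R⁺.* (T₀ R⁺.* x)
    regroup x = R⁺.trans (R⁺.*-cong {v = x} (R⁺.*-comm T₀ (T₀ ^ j)) R⁺.refl) (R⁺.*-assoc (T₀ ^ j) T₀ x)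
    contract : T₀ ^ suc j R⁺.* E⁺.ev (η R⁺ f) e R⁺.≈ E⁺.lin (λ l → T₀ ^ suc j R⁺.* E⁺.prod (ψ⁺ R⁺ f) l) e′
    contract = R⁺.trans (regroup (E⁺.ev (η R⁺ f) e))
      (R⁺.trans (R⁺.*-cong {T₀ ^ j} R⁺.refl (t-contract e))
      (R⁺.trans (R⁺.sym (regroup (E⁺.ev (ψ⁺ R⁺ f) e′))) (E⁺.lin-*ˡ (E⁺.prod (ψ⁺ R⁺ f)) (T₀ ^ suc j) e′)))

  hit-span : ∀ j → j ≤ suc (rk M Z ∸ 1) → ∀ {x} → Span j x → Hit x
  hit-span zero _ p = 𝟘 , degree-resp q (R⁺.sym p)
  hit-span (suc j) (s≤s j≤) (u , e , s , p) =
    let (a , h) = hit-span j (ℕₚ.m≤n⇒m≤1+n j≤) s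
        (b , k) = hit-power j j≤ e
    in a ⊕ b , ≈trans (≈cong⊕ h k) (degree-resp q (R⁺.sym p))

  -- For positive rank, `suc (rk M Z ∸ 1)` equals rk(Z), the number of powers of x_Z that `spanning`
  -- uses.
  surjective : 1 ≤ rk M Z → ∀ y → ∃ λ a → Eq Rel⁺ (bind ΦΨq a) y
  surjective 1≤rk y =
    let (a , h) = hit-≈ (ev-var (Ungraded (GenP M P⁺)) (ungrade y))
                    (hit-span (suc (rk M Z ∸ 1)) ℕₚ.≤-refl (spanning (rk M Z ∸ 1) (sym (ℕₚ.m+[n∸m]≡n 1≤rk)) (ungrade y)))
    in a , subst (Eq Rel⁺ (bind ΦΨq a)) (degree-ungrade y) h

theorem6p18 : ∀ {n : ℕ} (M : Matroid n) (r : ℕ) → rk M ⊤ ≡ suc r → Loopless M →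
    (P₋ : Subset n → Bool) → IsOrderFilter M P₋ →
    (Z : Subset n) → MaximalOutside M P₋ Z →
    (q : ℕ) → 1 ≤ q →
    IsIso (SumRel M Z P₋ q) (A M (P₊ M Z P₋) q) (ΦΨ M Z P₋ q)
theorem6p18 {n} M r _ loopless P filter Z maxZ q _ =
    well-defined , injective , surjective 1≤rk
  where
  open Surjective M P filter Z maxZ q using (well-defined; surjective)
  open Injective M P filter Z maxZ q using (kernel-zero)
  open MaximalFlat M P filter Z maxZ using (Z-nonempty; basis)
  open import Algebra.Properties.Group using (x∙y⁻¹≈ε⇒x≈y)

  i : Fin n
  i = proj₁ Z-nonempty

  -- `Z` contains an element, which has rank 1 by looplessness.
  1≤rk : 1 ≤ rk M Z
  1≤rk = ℕₚ.≤-trans (ℕₚ.≤-reflexive (sym (loopless i)))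
    (rk-mono M ⁅ i ⁆ Z (λ j∈ → subst (_∈ Z) (sym (Subₚ.x∈⁅y⁆⇒x≡y i j∈)) (proj₂ Z-nonempty)))

  injective : ∀ a b → Eq (A M (P₊ M Z P) q) (bind (ΦΨ M Z P q) a) (bind (ΦΨ M Z P q) b) → Eq (SumRel M Z P q) a b
  injective a b p = x∙y⁻¹≈ε⇒x≈y (AbelianGroup.group (exprGroup (SumRel M Z P q))) a b
    (kernel-zero (a ⊕ ⊝ b) 1≤rk (proj₂ basis)
      (ungrade-resp (≈trans (≈cong⊕ p ≈refl) (≈trans ≈comm ≈invl))))
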